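{- The \textsc{Paw-free Edge Editing} problem, parameterized by $k$, admits a kernel with $\mathcal{O}(k^6)$ vertices. That is, there is a polynomial-time algorithm that, given an instance $(G,k)$, outputs an instance $(G',k')$ of the same problem with $k'\le k$ such that $(G',k')$ is a yes-instance if and only if $(G,k)$ is a yes-instance, and $G'$ has $\mathcal{O}(k^6)$ vertices.
   Context: The paw is the graph on four vertices $x_1,x_2,x_3,x_4$ with edges $x_1x_2,x_2x_3,x_1x_3,x_3x_4$ (a triangle with one pendant edge). A graph is paw-free if it contains no induced subgraph isomorphic to the paw. For a graph $G$ and a set $A$ of unordered pairs of distinct vertices of $G$, $G\Delta A$ denotes the graph on $V(G)$ whose edge set is the symmetric difference of $E(G)$ and $A$. \textsc{Paw-free Edge Editing}: given a graph $G$ and an integer $k$, decide whether there is a set $A$ of at most $k$ unordered vertex pairs such that $G\Delta A$ is paw-free (i.e., at most $k$ edge additions/deletions). A kernel is a polynomial-time algorithm mapping an instance $(G,k)$ to an equivalent instance $(G',k')$ whose size is bounded by a function of $k$ only. -}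

module Defs where

open import Data.Bool using (Bool; true; false; _∨_; _xor_; if_then_else_)
open import Data.Bool.Properties using (∨-comm) renaming (_≟_ to _≟ᵇ_)
open import Data.Fin using (Fin; _<?_)
open import Data.Fin.Patterns using (0F; 1F; 2F; 3F)
open import Data.Fin.Properties using (all?) renaming (_≟_ to _≟ᶠ_)
open import Data.List using (List; []; _∷_; length; filter; map; allFin; cartesianProduct)
import Data.List.Membership.DecPropositional as DecMembership
open import Data.Nat using (ℕ; zero; suc; _+_; _*_; _∸_; _^_; _≤_; _≥_; _≤?_)
open import Data.Nat.Logarithm using (⌊log₂_⌋)
open import Data.Product using (Σ; ∃-syntax; _×_; _,_)
open import Data.Product.Properties using (≡-dec)
open import Data.Sum using (_⊎_; inj₁; inj₂)
open import Data.Unit using (⊤; tt)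
open import Function.Definitions using (Injective)
open import Relation.Binary.PropositionalEquality using (_≡_; refl; cong₂)
open import Relation.Nullary using (¬_; does)
open import Relation.Nullary.Decidable using (_×-dec_; from-yes)

-- A set of unordered pairs of distinct elements of Fin n.
record PairSet (n : ℕ) : Set where
  field
    has    : Fin n → Fin n → Bool
    sym    : ∀ i j → has i j ≡ has j i
    irrefl : ∀ i → has i i ≡ false

open PairSet public using (has)

∣_∣ : ∀ {n} → PairSet n → ℕ
∣_∣ {n} A =
  length (filter (λ (i , j) → (i <? j) ×-dec (has A i j ≟ᵇ true))
                 (cartesianProduct (allFin n) (allFin n)))

_⊖_ : ∀ {n} → PairSet n → PairSet n → PairSet n
A ⊖ B = record
  { has    = λ i j → has A i j xor has B i j
  ; sym    = λ i j → cong₂ _xor_ (PairSet.sym A i j) (PairSet.sym B i j)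
  ; irrefl = λ i → cong₂ _xor_ (PairSet.irrefl A i) (PairSet.irrefl B i)
  }

record Graph : Set where
  constructor graph
  field
    order : ℕ
    edges : PairSet order

  adj : Fin order → Fin order → Bool
  adj = has edges

open Graph public

_Δ_ : (G : Graph) → PairSet (order G) → Graph
G Δ A = graph (order G) (edges G ⊖ A)

-- An isomorphism from H onto an induced subgraph of G.
record InducedCopy (H G : Graph) : Set where
  field
    embed     : Fin (order H) → Fin (order G)
    injective : Injective _≡_ _≡_ embed
    preserves : ∀ i j → adj H i j ≡ adj G (embed i) (embed j)

paw : Graph
paw = graph 4 record
  { has    = joined
  ; sym    = λ i j → ∨-comm (does ((i , j) ∈? pawEdges)) (does ((j , i) ∈? pawEdges))
  ; irrefl = from-yes (all? λ i → joined i i ≟ᵇ false)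
  }
  where
  open DecMembership (≡-dec (_≟ᶠ_ {4}) (_≟ᶠ_ {4})) using (_∈?_)

  pawEdges : List (Fin 4 × Fin 4)
  pawEdges = (0F , 1F) ∷ (1F , 2F) ∷ (0F , 2F) ∷ (2F , 3F) ∷ []

  joined : Fin 4 → Fin 4 → Bool
  joined i j = does ((i , j) ∈? pawEdges) ∨ does ((j , i) ∈? pawEdges)

PawFree : Graph → Set
PawFree G = ¬ InducedCopy paw G

record Instance : Set where
  constructor ⟪_,_⟫
  field
    input  : Graph
    budget : ℕ

open Instance public

-- The yes-instances of Paw-free Edge Editing.
Editable : Instance → Set
Editable ⟪ G , k ⟫ = Σ (PairSet (order G)) λ A → ∣ A ∣ ≤ k × PawFree (G Δ A)

infixr 6 _`×_
infixr 5 _`⊎_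
infixr 4 _⨾_
infix  3 _⇒_

data Ty : Set where
  unit nat  : Ty
  _`×_ _`⊎_ : Ty → Ty → Ty
  list      : Ty → Ty

bool : Ty
bool = unit `⊎ unit

⟦_⟧ : Ty → Set
⟦ unit ⟧   = ⊤
⟦ nat ⟧    = ℕ
⟦ a `× b ⟧ = ⟦ a ⟧ × ⟦ b ⟧
⟦ a `⊎ b ⟧ = ⟦ a ⟧ ⊎ ⟦ b ⟧
⟦ list a ⟧ = List ⟦ a ⟧

encodeBool : Bool → ⟦ bool ⟧
encodeBool b = if b then inj₁ tt else inj₂ tt

-- Natural numbers are measured in binary.
mutual
  size : ∀ {a} → ⟦ a ⟧ → ℕ
  size {unit}   _        = 1
  size {nat}    n        = suc ⌊log₂ n ⌋
  size {a `× b} (x , y)  = size {a} x + size {b} y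
  size {a `⊎ b} (inj₁ x) = suc (size {a} x)
  size {a `⊎ b} (inj₂ y) = suc (size {b} y)
  size {list a} xs       = sizeList {a} xs

  sizeList : ∀ {a} → List ⟦ a ⟧ → ℕ
  sizeList     []       = 1
  sizeList {a} (x ∷ xs) = suc (size {a} x + sizeList {a} xs)

data Op : Ty → Ty → Set where
  id        : ∀ {a} → Op a a
  unit      : ∀ {a} → Op a unit
  fst       : ∀ {a b} → Op (a `× b) a
  snd       : ∀ {a b} → Op (a `× b) b
  inl       : ∀ {a b} → Op a (a `⊎ b)
  inr       : ∀ {a b} → Op b (a `⊎ b)
  distrib   : ∀ {a b c} → Op ((a `⊎ b) `× c) ((a `× c) `⊎ (b `× c))
  nil       : ∀ {a b} → Op b (list a)
  cons      : ∀ {a} → Op (a `× list a) (list a)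
  uncons    : ∀ {a} → Op (list a) (unit `⊎ (a `× list a))
  zero      : ∀ {a} → Op a nat
  suc       : Op nat nat
  add monus : Op (nat `× nat) nat
  leq       : Op (nat `× nat) bool

runOp : ∀ {a b} → Op a b → ⟦ a ⟧ → ⟦ b ⟧
runOp id      x            = x
runOp unit    _            = tt
runOp fst     (x , _)      = x
runOp snd     (_ , y)      = y
runOp inl     x            = inj₁ x
runOp inr     y            = inj₂ y
runOp distrib (inj₁ x , z) = inj₁ (x , z)
runOp distrib (inj₂ y , z) = inj₂ (y , z)
runOp nil     _            = []
runOp cons    (x , xs)     = x ∷ xs
runOp uncons  []           = inj₁ tt
runOp uncons  (x ∷ xs)     = inj₂ (x , xs)
runOp zero    _            = 0
runOp suc     n            = suc n
runOp add     (m , n)      = m + n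
runOp monus   (m , n)      = m ∸ n
runOp leq     (m , n)      = encodeBool (does (m ≤? n))

-- A Turing-complete programming language; `loop p` repeats p for as long as it
-- answers in the left summand.
data _⇒_ : Ty → Ty → Set where
  op   : ∀ {a b} → Op a b → a ⇒ b
  _⨾_  : ∀ {a b c} → a ⇒ b → b ⇒ c → a ⇒ c
  pair : ∀ {a b c} → a ⇒ b → a ⇒ c → a ⇒ b `× c
  case : ∀ {a b c} → a ⇒ c → b ⇒ c → a `⊎ b ⇒ c
  loop : ∀ {a b} → a ⇒ a `⊎ b → a ⇒ b

-- `p ∣ x ⇓ y [ t ]`: program p halts on input x with output y in time t.
-- Every construct except composition is charged the size of its input plus
-- one.  An output is never larger than the time spent producing it, so sharing
-- or big numbers cannot make a run cheaper than it is on a Turing machine, up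
-- to a polynomial.
infix 2 _∣_⇓_[_]

data _∣_⇓_[_] : ∀ {a b} → a ⇒ b → ⟦ a ⟧ → ⟦ b ⟧ → ℕ → Set where
  op⇓   : ∀ {a b} {o : Op a b} {x} →
          op o ∣ x ⇓ runOp o x [ suc (size {a} x) ]
  seq⇓  : ∀ {a b c} {p : a ⇒ b} {q : b ⇒ c} {x y z t u} →
          p ∣ x ⇓ y [ t ] → q ∣ y ⇓ z [ u ] →
          p ⨾ q ∣ x ⇓ z [ t + u ]
  pair⇓ : ∀ {a b c} {p : a ⇒ b} {q : a ⇒ c} {x y z t u} →
          p ∣ x ⇓ y [ t ] → q ∣ x ⇓ z [ u ] →
          pair p q ∣ x ⇓ (y , z) [ suc (size {a} x) + (t + u) ]
  inj₁⇓ : ∀ {a b c} {p : a ⇒ c} {q : b ⇒ c} {x y t} →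
          p ∣ x ⇓ y [ t ] →
          case p q ∣ inj₁ x ⇓ y [ suc (size {a `⊎ b} (inj₁ x)) + t ]
  inj₂⇓ : ∀ {a b c} {p : a ⇒ c} {q : b ⇒ c} {x y t} →
          q ∣ x ⇓ y [ t ] →
          case p q ∣ inj₂ x ⇓ y [ suc (size {a `⊎ b} (inj₂ x)) + t ]
  stop⇓ : ∀ {a b} {p : a ⇒ a `⊎ b} {x y t} →
          p ∣ x ⇓ inj₂ y [ t ] →
          loop p ∣ x ⇓ y [ suc (size {a} x) + t ]
  next⇓ : ∀ {a b} {p : a ⇒ a `⊎ b} {x x′ y t u} →
          p ∣ x ⇓ inj₁ x′ [ t ] → loop p ∣ x′ ⇓ y [ u ] →
          loop p ∣ x ⇓ y [ suc (size {a} x) + (t + u) ]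

record PolynomialTime {X Y : Set} {a b : Ty}
                      (encodeX : X → ⟦ a ⟧) (encodeY : Y → ⟦ b ⟧)
                      (f : X → Y) : Set where
  field
    program  : a ⇒ b
    time     : X → ℕ
    computes : ∀ x → program ∣ encodeX x ⇓ encodeY (f x) [ time x ]
    constant : ℕ
    degree   : ℕ
    bounded  : ∀ x → time x ≤ constant * size {a} (encodeX x) ^ degree

-- The adjacency matrix, row by row.
encodeGraph : Graph → ⟦ list (list bool) ⟧
encodeGraph G =
  map (λ i → map (λ j → encodeBool (adj G i j)) (allFin (order G))) (allFin (order G))

encodeInstance : Instance → ⟦ list (list bool) `× nat ⟧
encodeInstance ⟪ G , k ⟫ = encodeGraph G , k

_∈O_ : (ℕ → ℕ) → (ℕ → ℕ) → Set
f ∈O g = ∃[ c ] ∃[ k₀ ] (∀ k → k ≥ k₀ → f k ≤ c * g k)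

{-# OPTIONS --safe #-}
-- A component of a paw-free graph is triangle-free or complete multipartite.
-- A vertex v is deletable if any cheap solution for the graph with v isolated
-- yields one for the whole graph.  This holds if the vertices within distance
-- two of v form a paw-free component.  Otherwise, since a solution of size k
-- touches at most 2k vertices, it is ensured by having more than 2k witnesses of
-- the right kind: twins of v, single parts in a complete multipartite component
-- around v, or, if v is to hang from triangle-free components only, common
-- neighbours of adjacent neighbours of v, with a certificate that no neighbour of v
-- gets into a triangle.  The certificate rests on normal solutions, in which
-- every vertex keeps more than half of its neighbours: there, all vertices of a
-- triangle component are joined by short walks of input edges to a surviving
-- triangle of the input.  Conversely, in a yes-instance without deletable
-- vertices the untouched vertices lie near the 2k touched ones, either in their
-- complete multipartite components, O(k^2), or in triangle-free components within
-- distance five through vertices of degree O(k), O(k^6).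
-- Deletability is expressible in first-order logic with a counting quantifier,
-- so a single compiler from formulas to programs makes the kernel polynomial.

module Submission where

open import Data.Bool using (Bool; true; false; if_then_else_; T; _xor_; _∧_)
open import Data.Bool.Properties using (T?; T-≡; ∨-identityʳ) renaming (_≟_ to _≟ᵇ_)
open import Data.Empty using (⊥; ⊥-elim)
open import Data.Fin using (Fin; zero; suc; toℕ)
import Data.Fin as Fin
open import Data.Fin.Patterns using (0F; 1F; 2F; 3F)
open import Data.Fin.Properties using (any?; all?; toℕ-injective) renaming (_≟_ to _≟ᶠ_)
import Data.Fin.Properties as Fin
open import Data.List using (List; []; _∷_; _++_; length; filter; map; allFin; tabulate; cartesianProduct;
  foldl; foldr; reverse; upTo; downFrom; applyUpTo)
import Data.List as List
open import Data.List.Membership.Propositional.Properties using (∈-filter⁺; ∈-lookup; ∈-allFin)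
open import Data.List.Properties using (map-tabulate; map-upTo; map-∘; map-cong; filter-++; reverse-foldl; reverse-upTo;
  tabulate-cong; tabulate-lookup; length-++; length-downFrom; length-tabulate; length-map)
import Data.List.Relation.Unary.All as All
import Data.List.Relation.Unary.AllPairs as AllPairs
open import Data.List.Relation.Unary.Any using (index)
open import Data.List.Relation.Unary.Any.Properties using (lookup-index)
open import Data.List.Relation.Unary.Unique.Propositional using (Unique)
import Data.List.Relation.Unary.Unique.Propositional.Properties as Unique
open import Data.Nat using (ℕ; zero; suc; _+_; _*_; _∸_; _^_; _⊓_; _≤_; _<_; z≤n; s≤s; z<s; _≤?_; _<?_; _≤ᵇ_)
open import Data.Nat.Induction using (<-wellFounded)
open import Data.Nat.Logarithm using (⌊log₂_⌋; ⌊log₂⌋-mono-≤; ⌊log₂[2*b]⌋≡1+⌊log₂b⌋)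
open import Data.Nat.Properties
open import Data.Nat.Tactic.RingSolver using (solve-∀)
open import Data.Product using (Σ; ∃; Σ-syntax; _×_; _,_; proj₁; proj₂)
open import Data.Sum using (_⊎_; inj₁; inj₂; [_,_]′)
open import Data.Unit using (tt)
open import Data.Vec using (Vec; []; _∷_; lookup)
open import Function using (_∘_; _⟨_⟩_; case_of_)
open import Function.Bundles using (_⇔_; mk⇔; Equivalence)
open import Induction.WellFounded using (Acc; acc)
open import Relation.Binary.Definitions using (tri<; tri≈; tri>)
open import Relation.Binary.PropositionalEquality using (_≡_; _≢_; refl; sym; trans; cong; cong₂; subst; subst₂; module ≡-Reasoning)
open import Relation.Nullary using (Dec; yes; no; does; ¬_; contradiction)
open import Relation.Nullary.Decidable using (_×-dec_; _⊎-dec_; _→-dec_; ¬?; map′; does-⇔; dec-true; dec-false; decidable-stable)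
open import Relation.Unary using (Decidable)
open import Algebra.Properties.CommutativeMonoid.Sum +-0-commutativeMonoid using (sum; sum-cong-≗; ∑-distrib-+; ∑-comm)
open import Algebra.Properties.Semiring.Sum +-*-semiring using (*-distribˡ-sum; *-distribʳ-sum)
open import Defs hiding (id; unit; fst; snd; inl; inr; distrib; nil; cons; uncons; zero; suc; add; monus; leq)

-- Counting in finite sets

-- An untouched vertex has the same neighbours in the input and in the edited graph, so every rule
-- looks for untouched witnesses that carry structure from one to the other. The obstacle is the
-- last rule: a solution for the graph without `v` might build a triangle around a neighbour of `v`
-- out of added pairs, where the input shows nothing. Normal solutions exclude this. A component
-- without a triangle of surviving input edges can do without its added pairs, and a vertex with at
-- least as many edits as input edges can be isolated at no extra cost. What remains leaves a trace
-- in the input that a formula can find within three steps. The distance five consists of one step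
-- from a touched end of a deleted triangle edge, three steps of such a walk, and one step to `v`;
-- each costs a factor O(k), and the touched vertices contribute the sixth. A deleted vertex is
-- merely isolated. This keeps the vertex set, hence the type of edit sets, fixed during the
-- reduction; isolated vertices are discarded once, at the end.

sum-mono : ∀ {n} {f g : Fin n → ℕ} → (∀ i → f i ≤ g i) → sum f ≤ sum g
sum-mono {zero}  f≤g = z≤n
sum-mono {suc n} f≤g = +-mono-≤ (f≤g zero) (sum-mono (f≤g ∘ suc))

sum-mono-< : ∀ {n} {f g : Fin n → ℕ} → (∀ i → f i ≤ g i) → ∀ i → f i < g i → sum f < sum g
sum-mono-< {suc n} f≤g zero    f<g = +-mono-<-≤ f<g (sum-mono (f≤g ∘ suc))
sum-mono-< {suc n} f≤g (suc i) f<g = +-mono-≤-< (f≤g zero) (sum-mono-< (f≤g ∘ suc) i f<g)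

sum-zero : ∀ {n} {f : Fin n → ℕ} → (∀ i → f i ≡ 0) → sum f ≡ 0
sum-zero {zero}  f≡0 = refl
sum-zero {suc n} f≡0 = cong₂ _+_ (f≡0 zero) (sum-zero (f≡0 ∘ suc))

sum-single : ∀ {n} {f : Fin n → ℕ} i → (∀ j → j ≢ i → f j ≡ 0) → sum f ≡ f i
sum-single {suc n} {f} zero    off = trans (cong (f zero +_) (sum-zero (λ j → off (suc j) λ ()))) (+-identityʳ _)
sum-single {suc n} {f} (suc i) off =
  trans (cong (_+ sum (f ∘ suc)) (off zero λ ())) (sum-single i λ j j≢i → off (suc j) λ { refl → j≢i refl })

f≤sum : ∀ {n} (f : Fin n → ℕ) i → f i ≤ sum f
f≤sum f zero    = m≤m+n _ _
f≤sum f (suc i) = ≤-trans (f≤sum (f ∘ suc) i) (m≤n+m _ _)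

bit : Bool → ℕ
bit b = if b then 1 else 0

bit-mono : ∀ {A B : Set} (a : Dec A) (b : Dec B) → (A → B) → bit (does a) ≤ bit (does b)
bit-mono (yes _) (yes _) f = ≤-refl
bit-mono (yes a) (no ¬b) f = contradiction (f a) ¬b
bit-mono (no _)  _       f = z≤n

bit-yes : ∀ {A : Set} (a? : Dec A) → A → bit (does a?) ≡ 1
bit-yes a? a = cong bit (dec-true a? a)

bit-no : ∀ {A : Set} (a? : Dec A) → ¬ A → bit (does a?) ≡ 0
bit-no a? ¬a = cong bit (dec-false a? ¬a)

bit≤1 : ∀ b → bit b ≤ 1
bit≤1 true  = ≤-refl
bit≤1 false = z≤n

count : ∀ {n} {P : Fin n → Set} → Decidable P → ℕ
count P? = sum λ i → bit (does (P? i))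

module _ {n : ℕ} {P Q : Fin n → Set} (P? : Decidable P) (Q? : Decidable Q) where

  count-mono : (∀ {i} → P i → Q i) → count P? ≤ count Q?
  count-mono P⊆Q = sum-mono λ i → bit-mono (P? i) (Q? i) P⊆Q

  count-mono-< : (∀ {i} → P i → Q i) → ∀ {i} → ¬ P i → Q i → count P? < count Q?
  count-mono-< P⊆Q {i} ¬p q = sum-mono-< (λ i → bit-mono (P? i) (Q? i) P⊆Q) i
    (subst₂ _<_ (sym (bit-no (P? i) ¬p)) (sym (bit-yes (Q? i) q)) ≤-refl)

  count-exceeds : count Q? < count P? → ∃ λ i → P i × ¬ Q i
  count-exceeds lt with any? (λ i → P? i ×-dec ¬? (Q? i))
  ... | yes w = w
  ... | no ¬w = contradiction
    (count-mono λ {i} p → decidable-stable (Q? i) λ ¬q → ¬w (i , p , ¬q)) (<⇒≱ lt)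

module _ {n : ℕ} {P : Fin n → Set} (P? : Decidable P) where

  count-inhabited : 0 < count P? → ∃ P
  count-inhabited lt with any? P?
  ... | yes w = w
  ... | no ¬w = contradiction (sum-zero λ i → bit-no (P? i) λ p → ¬w (i , p)) (>⇒≢ lt)

  count≤n : count P? ≤ n
  count≤n = go (λ i → bit≤1 (does (P? i)))
    where
    go : ∀ {n} {f : Fin n → ℕ} → (∀ i → f i ≤ 1) → sum f ≤ n
    go {zero}  _   = z≤n
    go {suc n} f≤1 = +-mono-≤ (f≤1 zero) (go (f≤1 ∘ suc))

module _ {n : ℕ} {P Q R : Fin n → Set}
         (P? : Decidable P) (Q? : Decidable Q) (R? : Decidable R) where

  count-∪ : (∀ {i} → P i → Q i ⊎ R i) → count P? ≤ count Q? + count R?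
  count-∪ P⊆ = ≤-trans (sum-mono λ i → step (P? i) (Q? i) (R? i) P⊆) (≤-reflexive (∑-distrib-+ (λ i → bit (does (Q? i))) (λ i → bit (does (R? i)))))
    where
    step : ∀ {A B C : Set} (a : Dec A) (b : Dec B) (c : Dec C) → (A → B ⊎ C) →
           bit (does a) ≤ bit (does b) + bit (does c)
    step (no _)  _       _       _ = z≤n
    step (yes _) (yes _) _       _ = s≤s z≤n
    step (yes _) (no _)  (yes _) _ = ≤-refl
    step (yes a) (no ¬b) (no ¬c) f = ⊥-elim ([ ¬b , ¬c ]′ (f a))

count-singleton : ∀ {n} (i : Fin n) → count (λ j → j ≟ᶠ i) ≡ 1
count-singleton i = trans (sum-single i λ j j≢i → bit-no (j ≟ᶠ i) j≢i) (bit-yes (i ≟ᶠ i) refl)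

-- The strict bound on the others leaves room for the pivot itself. It fits formulas such as
-- `otherTwin` and `common`, which exclude the vertex at which they are evaluated.
count-pivot : ∀ {n} {P : Fin n → Set} (P? : Decidable P) {c} →
              (∀ i → P i → count (λ j → ¬? (j ≟ᶠ i) ×-dec P? j) < c) → count P? ≤ c
count-pivot P? {c} few with any? P?
... | no ¬w      = subst (_≤ c) (sym (sum-zero λ i → bit-no (P? i) λ p → ¬w (i , p))) z≤n
... | yes (i , p) = ≤-trans (count-∪ P? (λ j → j ≟ᶠ i) (λ j → ¬? (j ≟ᶠ i) ×-dec P? j) split)
                            (+-mono-≤ (≤-reflexive (count-singleton i)) ≤-refl ⟨ ≤-trans ⟩ few i p)
  where
  split : ∀ {j} → _ → j ≡ i ⊎ (j ≢ i × _)
  split {j} q with j ≟ᶠ i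
  ... | yes j≡i = inj₁ j≡i
  ... | no j≢i  = inj₂ (j≢i , q)

count-⋃ : ∀ {n} {P Q : Fin n → Set} {R : Fin n → Fin n → Set}
          (P? : Decidable P) (Q? : Decidable Q) (R? : ∀ s → Decidable (R s)) {c} →
          (∀ s → Q s → count (R? s) ≤ c) → (∀ {x} → P x → ∃ λ s → Q s × R s x) →
          count P? ≤ count Q? * c
count-⋃ {n} {P} {Q} {R} P? Q? R? {c} small cover = begin
  sum (λ x → bit (does (P? x)))            ≤⟨ sum-mono pointwise ⟩
  sum (λ x → sum λ s → q s * r s x)        ≡⟨ ∑-comm (λ x s → q s * r s x) ⟩
  sum (λ s → sum λ x → q s * r s x)        ≡⟨ sum-cong-≗ (λ s → sym (*-distribˡ-sum (q s) (r s))) ⟩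
  sum (λ s → q s * sum (r s))              ≤⟨ sum-mono bounded ⟩
  sum (λ s → q s * c)                      ≡⟨ sym (*-distribʳ-sum c q) ⟩
  count Q? * c                             ∎
  where
  open ≤-Reasoning
  q : Fin n → ℕ
  q s = bit (does (Q? s))
  r : Fin n → Fin n → ℕ
  r s x = bit (does (R? s x))
  pointwise : ∀ x → bit (does (P? x)) ≤ sum λ s → q s * r s x
  pointwise x with P? x
  ... | no _  = z≤n
  ... | yes p with cover p
  ...   | s , qs , rsx = ≤-trans
    (≤-reflexive (sym (cong₂ _*_ (bit-yes (Q? s) qs) (bit-yes (R? s x) rsx))))
    (f≤sum (λ s → q s * r s x) s)
  bounded : ∀ s → q s * sum (r s) ≤ q s * c
  bounded s with Q? s
  ... | no _   = z≤n
  ... | yes qs = +-monoˡ-≤ 0 (small s qs)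

-- Graphs

infix 4 _∋_∼_ _∋?_∼_

record _∋_∼_ {n} (E : PairSet n) (x y : Fin n) : Set where
  constructor edge
  field joined : T (has E x y)

open _∋_∼_ using (joined)

_∋?_∼_ : ∀ {n} (E : PairSet n) (x y : Fin n) → Dec (E ∋ x ∼ y)
E ∋? x ∼ y = map′ edge joined (T? (has E x y))

∼-sym : ∀ {n} {E : PairSet n} {x y} → E ∋ x ∼ y → E ∋ y ∼ x
∼-sym {E = E} {x} {y} (edge e) = edge (subst T (PairSet.sym E x y) e)

∼-irrefl : ∀ {n} {E : PairSet n} {x} → ¬ E ∋ x ∼ x
∼-irrefl {E = E} {x} (edge e) = subst T (PairSet.irrefl E x) e

∼⇒≢ : ∀ {n} {E : PairSet n} {x y} → E ∋ x ∼ y → x ≢ y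
∼⇒≢ e refl = ∼-irrefl e

module _ {n} {R : Fin n → Fin n → Set} (R? : ∀ x y → Dec (R x y))
         (R-sym : ∀ {x y} → R x y → R y x) (R-irrefl : ∀ {x} → ¬ R x x) where

  pairs : PairSet n
  pairs = record
    { has    = λ x y → does (R? x y)
    ; sym    = λ x y → does-⇔ (mk⇔ R-sym R-sym) (R? x y) (R? y x)
    ; irrefl = λ x → dec-false (R? x x) R-irrefl
    }

  pairs⁺ : ∀ {x y} → R x y → pairs ∋ x ∼ y
  pairs⁺ {x} {y} r = edge (subst T (sym (dec-true (R? x y) r)) tt)

  pairs⁻ : ∀ {x y} → pairs ∋ x ∼ y → R x y
  pairs⁻ {x} {y} (edge e) with R? x y
  ... | yes r = r

module _ {n} {E A : PairSet n} {x y : Fin n} where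

  ⊖-keep : E ∋ x ∼ y → ¬ A ∋ x ∼ y → (E ⊖ A) ∋ x ∼ y
  ⊖-keep (edge e) ¬a = edge (go (has E x y) (has A x y) e (¬a ∘ edge))
    where
    go : ∀ b c → T b → ¬ T c → T (b xor c)
    go true true  _ ¬c = ¬c _
    go true false _ _  = _

  ⊖-add : ¬ E ∋ x ∼ y → A ∋ x ∼ y → (E ⊖ A) ∋ x ∼ y
  ⊖-add ¬e (edge a) = edge (go (has E x y) (has A x y) (¬e ∘ edge) a)
    where
    go : ∀ b c → ¬ T b → T c → T (b xor c)
    go true  _    ¬b _ = ⊥-elim (¬b _)
    go false true _  _ = _

  ⊖-cases : (E ⊖ A) ∋ x ∼ y → (E ∋ x ∼ y × ¬ A ∋ x ∼ y) ⊎ (¬ E ∋ x ∼ y × A ∋ x ∼ y)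
  ⊖-cases (edge h) with E ∋? x ∼ y | A ∋? x ∼ y
  ... | yes e | no ¬a = inj₁ (e , ¬a)
  ... | no ¬e | yes a = inj₂ (¬e , a)
  ... | yes (edge e) | yes (edge a) = ⊥-elim (go (has E x y) (has A x y) e a h)
    where
    go : ∀ b c → T b → T c → ¬ T (b xor c)
    go true true _ _ ()
  ... | no ¬e | no ¬a = ⊥-elim (go (has E x y) (has A x y) (¬e ∘ edge) (¬a ∘ edge) h)
    where
    go : ∀ b c → ¬ T b → ¬ T c → ¬ T (b xor c)
    go true  _     ¬b _  _ = ¬b _
    go false true  _  ¬c _ = ¬c _

  ⊖-old : (E ⊖ A) ∋ x ∼ y → ¬ A ∋ x ∼ y → E ∋ x ∼ y
  ⊖-old h ¬a with ⊖-cases h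
  ... | inj₁ (e , _) = e
  ... | inj₂ (_ , a) = contradiction a ¬a

  ⊖-deleted : E ∋ x ∼ y → ¬ (E ⊖ A) ∋ x ∼ y → A ∋ x ∼ y
  ⊖-deleted e ¬h with A ∋? x ∼ y
  ... | yes a = a
  ... | no ¬a = contradiction (⊖-keep e ¬a) ¬h

-- A positive form of paw-freeness that names no embedding. The inequalities not listed follow from
-- irreflexivity.
NoPaw : ∀ {n} → PairSet n → Set
NoPaw E = ∀ {a b c d} → E ∋ a ∼ b → E ∋ b ∼ c → E ∋ a ∼ c → E ∋ c ∼ d → d ≢ a → d ≢ b →
          E ∋ a ∼ d ⊎ E ∋ b ∼ d

NoPaw⇒PawFree : ∀ {n} {E : PairSet n} → NoPaw E → PawFree (graph n E)
NoPaw⇒PawFree {E = E} noPaw copy = case noPaw (∈ 0F 1F) (∈ 1F 2F) (∈ 0F 2F) (∈ 2F 3F) (≢ 3F 0F λ ()) (≢ 3F 1F λ ())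
                   of [ ∉ 0F 3F refl , ∉ 1F 3F refl ]′
  where
  open InducedCopy copy
  ∈ : ∀ i j {_ : T (adj paw i j)} → E ∋ embed i ∼ embed j
  ∈ i j {t} = edge (subst T (preserves i j) t)
  ∉ : ∀ i j → adj paw i j ≡ false → ¬ E ∋ embed i ∼ embed j
  ∉ i j eq (edge e) = subst T (trans (sym (preserves i j)) eq) e
  ≢ : ∀ i j → i ≢ j → embed i ≢ embed j
  ≢ i j i≢j eq = i≢j (injective eq)

PawFree⇒NoPaw : ∀ {n} {E : PairSet n} → PawFree (graph n E) → NoPaw E
PawFree⇒NoPaw {n} {E} pawFree {a} {b} {c} {d} ab bc ac cd d≢a d≢b with E ∋? a ∼ d | E ∋? b ∼ d
... | yes ad | _      = inj₁ ad
... | no _   | yes bd = inj₂ bd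
... | no ¬ad | no ¬bd = ⊥-elim (pawFree record
  { embed = φ ; injective = λ {i} {j} → φ-injective i j ; preserves = φ-preserves })
  where
  φ : Fin 4 → Fin n
  φ 0F = a
  φ 1F = b
  φ 2F = c
  φ 3F = d
  φ-injective : ∀ i j → φ i ≡ φ j → i ≡ j
  φ-injective 0F 0F _ = refl
  φ-injective 0F 1F p = ⊥-elim (∼⇒≢ ab p)
  φ-injective 0F 2F p = ⊥-elim (∼⇒≢ ac p)
  φ-injective 0F 3F p = ⊥-elim (d≢a (sym p))
  φ-injective 1F 0F p = ⊥-elim (∼⇒≢ ab (sym p))
  φ-injective 1F 1F _ = refl
  φ-injective 1F 2F p = ⊥-elim (∼⇒≢ bc p)
  φ-injective 1F 3F p = ⊥-elim (d≢b (sym p))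
  φ-injective 2F 0F p = ⊥-elim (∼⇒≢ ac (sym p))
  φ-injective 2F 1F p = ⊥-elim (∼⇒≢ bc (sym p))
  φ-injective 2F 2F _ = refl
  φ-injective 2F 3F p = ⊥-elim (∼⇒≢ cd p)
  φ-injective 3F 0F p = ⊥-elim (d≢a p)
  φ-injective 3F 1F p = ⊥-elim (d≢b p)
  φ-injective 3F 2F p = ⊥-elim (∼⇒≢ cd (sym p))
  φ-injective 3F 3F _ = refl
  yes′ : ∀ {x y} → E ∋ x ∼ y → true ≡ has E x y
  yes′ (edge e) = sym (Equivalence.to T-≡ e)
  no′ : ∀ {x y} → ¬ E ∋ x ∼ y → false ≡ has E x y
  no′ {x} {y} ¬e = sym (dec-false (E ∋? x ∼ y) ¬e)
  φ-preserves : ∀ i j → adj paw i j ≡ has E (φ i) (φ j)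
  φ-preserves 0F 0F = no′ ∼-irrefl
  φ-preserves 0F 1F = yes′ ab
  φ-preserves 0F 2F = yes′ ac
  φ-preserves 0F 3F = no′ ¬ad
  φ-preserves 1F 0F = yes′ (∼-sym ab)
  φ-preserves 1F 1F = no′ ∼-irrefl
  φ-preserves 1F 2F = yes′ bc
  φ-preserves 1F 3F = no′ ¬bd
  φ-preserves 2F 0F = yes′ (∼-sym ac)
  φ-preserves 2F 1F = yes′ (∼-sym bc)
  φ-preserves 2F 2F = no′ ∼-irrefl
  φ-preserves 2F 3F = yes′ cd
  φ-preserves 3F 0F = no′ (¬ad ∘ ∼-sym)
  φ-preserves 3F 1F = no′ (¬bd ∘ ∼-sym)
  φ-preserves 3F 2F = yes′ (∼-sym cd)
  φ-preserves 3F 3F = no′ ∼-irrefl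

deg : ∀ {n} → PairSet n → Fin n → ℕ
deg E x = count (E ∋? x ∼_)

-- The degree sum replaces `∣_∣` in all comparisons of size: being symmetric, it can be transformed
-- without regard to the order of the two ends of a pair. It also serves as the termination measure
-- for normalisation.
vol : ∀ {n} → PairSet n → ℕ
vol E = sum (deg E)

vol-mono : ∀ {n} {E F : PairSet n} → (∀ {x y} → E ∋ x ∼ y → F ∋ x ∼ y) → vol E ≤ vol F
vol-mono {E = E} {F} E⊆F = sum-mono λ x → count-mono (E ∋? x ∼_) (F ∋? x ∼_) E⊆F

vol-mono-< : ∀ {n} {E F : PairSet n} → (∀ {x y} → E ∋ x ∼ y → F ∋ x ∼ y) →
             ∀ {x y} → ¬ E ∋ x ∼ y → F ∋ x ∼ y → vol E < vol F
vol-mono-< {E = E} {F} E⊆F {x} ¬e f =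
  sum-mono-< (λ x → count-mono (E ∋? x ∼_) (F ∋? x ∼_) E⊆F) x
             (count-mono-< (E ∋? x ∼_) (F ∋? x ∼_) E⊆F ¬e f)

length-filter-tabulate : ∀ {n} {B : Set} {P : B → Set} (P? : ∀ b → Dec (P b)) (f : Fin n → B) →
                         length (filter P? (tabulate f)) ≡ count (P? ∘ f)
length-filter-tabulate {zero}  P? f = refl
length-filter-tabulate {suc n} P? f with does (P? (f zero))
... | true  = cong suc (length-filter-tabulate P? (f ∘ suc))
... | false = length-filter-tabulate P? (f ∘ suc)

length-filter-cartesianProduct :
  ∀ {m n} {B C : Set} {P : B × C → Set} (P? : ∀ b → Dec (P b)) (f : Fin m → B) (g : Fin n → C) →
  length (filter P? (cartesianProduct (tabulate f) (tabulate g))) ≡ sum λ i → count λ j → P? (f i , g j)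
length-filter-cartesianProduct {zero}  P? f g = refl
length-filter-cartesianProduct {suc m} P? f g = begin
  length (filter P? (row ++ rest))                     ≡⟨ cong length (filter-++ P? row rest) ⟩
  length (filter P? row ++ filter P? rest)             ≡⟨ length-++ (filter P? row) ⟩
  length (filter P? row) + length (filter P? rest)     ≡⟨ cong₂ _+_ first (length-filter-cartesianProduct P? (f ∘ suc) g) ⟩
  _                                                    ∎
  where
  open ≡-Reasoning
  row  = map (f zero ,_) (tabulate g)
  rest = cartesianProduct (tabulate (f ∘ suc)) (tabulate g)
  first : length (filter P? row) ≡ count λ j → P? (f zero , g j)
  first = trans (cong (length ∘ filter P?) (map-tabulate g (f zero ,_))) (length-filter-tabulate P? ((f zero ,_) ∘ g))

vol≡2∣_∣ : ∀ {n} (A : PairSet n) → vol A ≡ ∣ A ∣ + ∣ A ∣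
vol≡2∣_∣ {n} A = begin
  sum (λ i → sum λ j → bit (has A i j))                        ≡⟨ sum-cong-≗ (λ i → trans (sum-cong-≗ (split i)) (∑-distrib-+ (u i) (λ j → u j i))) ⟩
  sum (λ i → sum (u i) + sum (λ j → u j i))                    ≡⟨ ∑-distrib-+ (λ i → sum (u i)) (λ i → sum λ j → u j i) ⟩
  sum (λ i → sum (u i)) + sum (λ i → sum (λ j → u j i))        ≡⟨ cong (sum (λ i → sum (u i)) +_) (∑-comm (λ i j → u j i)) ⟩
  sum (λ i → sum (u i)) + sum (λ i → sum (u i))                ≡⟨ sym (cong₂ _+_ size≡ size≡) ⟩
  ∣ A ∣ + ∣ A ∣                                                ∎
  where
  open ≡-Reasoning
  u? : ∀ (ij : Fin n × Fin n) → Dec _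
  u? (i , j) = (i Fin.<? j) ×-dec (has A i j ≟ᵇ true)
  u : Fin n → Fin n → ℕ
  u i j = bit (does (u? (i , j)))
  size≡ : ∣ A ∣ ≡ sum (λ i → sum (u i))
  size≡ = length-filter-cartesianProduct u? (λ i → i) (λ j → j)
  ordered : ∀ {i j} → i Fin.< j → u i j ≡ bit (has A i j)
  ordered {i} {j} i<j rewrite dec-true (i Fin.<? j) i<j with has A i j
  ... | true  = refl
  ... | false = refl
  reversed : ∀ {i j} → ¬ i Fin.< j → u i j ≡ 0
  reversed {i} {j} i≮j rewrite dec-false (i Fin.<? j) i≮j = refl
  split : ∀ i j → bit (has A i j) ≡ u i j + u j i
  split i j with Fin.<-cmp i j
  ... | tri< i<j _ j≮i = sym (trans (cong₂ _+_ (ordered i<j) (reversed j≮i)) (+-identityʳ _))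
  ... | tri> i≮j _ j<i = trans (cong bit (PairSet.sym A i j)) (sym (cong₂ _+_ (reversed i≮j) (ordered j<i)))
  ... | tri≈ i≮i refl _ = trans (cong bit (PairSet.irrefl A i)) (sym (cong₂ _+_ (reversed i≮i) (reversed i≮i)))

∣∣-mono-vol : ∀ {m n} {A : PairSet m} {B : PairSet n} → vol A ≤ vol B → ∣ A ∣ ≤ ∣ B ∣
∣∣-mono-vol {A = A} {B} le with ∣ A ∣ ≤? ∣ B ∣
... | yes p = p
... | no ¬p = contradiction (subst₂ _≤_ vol≡2∣ A ∣ vol≡2∣ B ∣ le) (<⇒≱ (+-mono-< (≰⇒> ¬p) (≰⇒> ¬p)))

∣∣-mono : ∀ {n} {A B : PairSet n} → (∀ {x y} → A ∋ x ∼ y → B ∋ x ∼ y) → ∣ A ∣ ≤ ∣ B ∣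
∣∣-mono {A = A} {B} A⊆B = ∣∣-mono-vol {A = A} {B} (vol-mono A⊆B)

Touched : ∀ {n} → PairSet n → Fin n → Set
Touched A x = ∃ λ y → A ∋ x ∼ y

touched? : ∀ {n} (A : PairSet n) → Decidable (Touched A)
touched? A x = any? λ y → A ∋? x ∼ y

count-touched : ∀ {n} (A : PairSet n) → count (touched? A) ≤ ∣ A ∣ + ∣ A ∣
count-touched A = subst (count (touched? A) ≤_) vol≡2∣ A ∣ (sum-mono bound)
  where
  bound : ∀ x → bit (does (touched? A x)) ≤ deg A x
  bound x with touched? A x
  ... | no _        = z≤n
  ... | yes (y , e) = ≤-trans (≤-reflexive (sym (bit-yes (A ∋? x ∼ y) e))) (f≤sum (λ y → bit (has A x y)) y)

-- Normal solutions

InTriangle : ∀ {n} → PairSet n → Fin n → Set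
InTriangle H x = ∃ λ y → ∃ λ z → H ∋ x ∼ y × H ∋ y ∼ z × H ∋ x ∼ z

inTriangle? : ∀ {n} (H : PairSet n) → Decidable (InTriangle H)
inTriangle? H x = any? λ y → any? λ z → H ∋? x ∼ y ×-dec H ∋? y ∼ z ×-dec H ∋? x ∼ z

-- A component of a paw-free graph that contains a triangle is complete
-- multipartite: every edge lies in a triangle, and nonadjacent vertices with a
-- common neighbour have the same neighbourhood.
module Multipartite {n} {H : PairSet n} (noPaw : NoPaw H) where

  triangle-edge : ∀ {x p} → InTriangle H x → H ∋ x ∼ p → ∃ λ q → H ∋ x ∼ q × H ∋ p ∼ q
  triangle-edge {x} {p} (y , z , xy , yz , xz) xp with p ≟ᶠ y | p ≟ᶠ z
  ... | yes refl | _        = z , xz , yz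
  ... | no _     | yes refl = y , xy , ∼-sym yz
  ... | no p≢y   | no p≢z   with noPaw yz (∼-sym xz) (∼-sym xy) xp p≢y p≢z
  ...   | inj₁ yp = y , xy , ∼-sym yp
  ...   | inj₂ zp = z , xz , ∼-sym zp

  triangle-step : ∀ {x p} → InTriangle H x → H ∋ x ∼ p → InTriangle H p
  triangle-step {x} tri xp with triangle-edge tri xp
  ... | q , xq , pq = x , q , ∼-sym xp , xq , pq

  -- Let `q` complete a triangle on `px`. By `past`, a vertex attached to one end of an edge in the
  -- neighbourhood of `x` but not to `x` is attached to the other end; so `y` sees `q`. As a
  -- neighbour of `x`, `z` sees `p` or `q`, and `past` applies again.
  same-part : ∀ {p x y z} → InTriangle H p → H ∋ p ∼ x → H ∋ p ∼ y → ¬ H ∋ x ∼ y →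
              H ∋ x ∼ z → H ∋ y ∼ z
  same-part {p} {x} {y} {z} tri px py ¬xy xz with x ≟ᶠ y
  ... | yes refl = xz
  ... | no x≢y with triangle-edge tri px
  ...   | q , pq , xq = goal
    where
    past : ∀ {r s} → H ∋ r ∼ s → H ∋ x ∼ r → H ∋ x ∼ s → H ∋ s ∼ y → H ∋ r ∼ y
    past rs xr xs sy with noPaw xr rs xs sy (λ { refl → x≢y refl }) (λ { refl → ¬xy xr })
    ... | inj₁ xy = contradiction xy ¬xy
    ... | inj₂ ry = ry
    qy : H ∋ q ∼ y
    qy = past (∼-sym pq) xq (∼-sym px) py
    goal : H ∋ y ∼ z
    goal with z ≟ᶠ p | z ≟ᶠ q
    ... | yes refl | _        = ∼-sym py
    ... | no _     | yes refl = ∼-sym qy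
    ... | no z≢p   | no z≢q   with noPaw pq (∼-sym xq) px xz z≢p z≢q
    ...   | inj₁ pz = ∼-sym (past (∼-sym pz) xz (∼-sym px) py)
    ...   | inj₂ qz = ∼-sym (past (∼-sym qz) xz xq qy)

  -- If `a` misses `y`, the two share the neighbour `b` and hence a part; then `y` sees the
  -- neighbour `x` of `a`, which is excluded. So `a` itself is a common neighbour of `x` and `y`.
  same-part-linked : ∀ {a b x y z} → InTriangle H a → H ∋ x ∼ a → H ∋ y ∼ b → H ∋ a ∼ b → ¬ H ∋ x ∼ y →
                     H ∋ x ∼ z → H ∋ y ∼ z
  same-part-linked {a} {b} {x} {y} tri xa yb ab ¬xy xz with H ∋? a ∼ y
  ... | yes ay = same-part tri (∼-sym xa) ay ¬xy xz
  ... | no ¬ay = contradiction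
    (∼-sym (same-part (triangle-step tri ab) (∼-sym ab) (∼-sym yb) ¬ay (∼-sym xa))) ¬xy

-- The hypotheses say that `H₂` arises from `H` by isolating the vertices outside `Q`, and no vertex
-- of a paw is isolated.
NoPaw-restrict : ∀ {n} {H H₂ : PairSet n} {Q : Fin n → Set} → NoPaw H →
                 (∀ {x y} → H₂ ∋ x ∼ y → H ∋ x ∼ y × Q x) →
                 (∀ {x y} → H ∋ x ∼ y → Q x → Q y → H₂ ∋ x ∼ y) → NoPaw H₂
NoPaw-restrict noPaw ⇒H ⇒H₂ ab bc ac cd d≢a d≢b
  with noPaw (proj₁ (⇒H ab)) (proj₁ (⇒H bc)) (proj₁ (⇒H ac)) (proj₁ (⇒H cd)) d≢a d≢b
... | inj₁ ad = inj₁ (⇒H₂ ad (proj₂ (⇒H ab)) (proj₂ (⇒H (∼-sym cd))))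
... | inj₂ bd = inj₂ (⇒H₂ bd (proj₂ (⇒H bc)) (proj₂ (⇒H (∼-sym cd))))

Kept : ∀ {n} → PairSet n → PairSet n → Fin n → Fin n → Set
Kept E A x y = E ∋ x ∼ y × (E ⊖ A) ∋ x ∼ y

-- In a paw-free edited graph this says that the component of `x` contains a triangle of unedited
-- input edges: a vertex of a complete multipartite component sees at least two corners of every
-- triangle. `anchor-step` is this invariance along edges.
Anchored : ∀ {n} → PairSet n → PairSet n → Fin n → Set
Anchored E A x = ∃ λ a → ∃ λ b → ∃ λ c → Kept E A a b × Kept E A b c × Kept E A a c × (E ⊖ A) ∋ x ∼ a

-- Isolating an edited vertex in the edited graph keeps it paw-free; in a
-- normal solution no such move pays off, and no added pair can be given up
-- because its component contains no surviving triangle of the input.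
record Normal {n} (E A : PairSet n) : Set where
  field
    light    : ∀ {x y} → (E ⊖ A) ∋ x ∼ y → deg A x < deg E x
    anchored : ∀ {x y} → (E ⊖ A) ∋ x ∼ y → ¬ E ∋ x ∼ y → Anchored E A x

module _ {n} (E : PairSet n) where

  kept? : ∀ A x y → Dec (Kept E A x y)
  kept? A x y = E ∋? x ∼ y ×-dec (E ⊖ A) ∋? x ∼ y

  anchored? : ∀ A → Decidable (Anchored E A)
  anchored? A x = any? λ a → any? λ b → any? λ c →
    kept? A a b ×-dec kept? A b c ×-dec kept? A a c ×-dec (E ⊖ A) ∋? x ∼ a

  module Isolate (A : PairSet n) (v : Fin n) where

    R : Fin n → Fin n → Set
    R x y = (x ≡ v ⊎ y ≡ v) × E ∋ x ∼ y ⊎ (x ≢ v × y ≢ v) × A ∋ x ∼ y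

    R? : ∀ x y → Dec (R x y)
    R? x y = ((x ≟ᶠ v ⊎-dec y ≟ᶠ v) ×-dec E ∋? x ∼ y) ⊎-dec ((¬? (x ≟ᶠ v) ×-dec ¬? (y ≟ᶠ v)) ×-dec A ∋? x ∼ y)

    R-sym : ∀ {x y} → R x y → R y x
    R-sym (inj₁ (inj₁ p , e))  = inj₁ (inj₂ p , ∼-sym e)
    R-sym (inj₁ (inj₂ p , e))  = inj₁ (inj₁ p , ∼-sym e)
    R-sym (inj₂ ((p , q) , a)) = inj₂ ((q , p) , ∼-sym a)

    R-irrefl : ∀ {x} → ¬ R x x
    R-irrefl (inj₁ (_ , e)) = ∼-irrefl e
    R-irrefl (inj₂ (_ , a)) = ∼-irrefl a

    A₂ : PairSet n
    A₂ = pairs R? R-sym R-irrefl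

    H₂⇒H : ∀ {x y} → (E ⊖ A₂) ∋ x ∼ y → (E ⊖ A) ∋ x ∼ y × x ≢ v
    H₂⇒H {x} {y} h with ⊖-cases h
    ... | inj₁ (e , ¬a₂) = ⊖-keep e (λ a → ¬a₂ (pairs⁺ R? R-sym R-irrefl (inj₂ ((x≢v , y≢v) , a)))) , x≢v
      where
      x≢v : x ≢ v
      x≢v eq = ¬a₂ (pairs⁺ R? R-sym R-irrefl (inj₁ (inj₁ eq , e)))
      y≢v : y ≢ v
      y≢v eq = ¬a₂ (pairs⁺ R? R-sym R-irrefl (inj₁ (inj₂ eq , e)))
    ... | inj₂ (¬e , a₂) with pairs⁻ R? R-sym R-irrefl a₂
    ...   | inj₁ (_ , e)              = contradiction e ¬e
    ...   | inj₂ ((x≢v , y≢v) , a) = ⊖-add ¬e a , x≢v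

    H⇒H₂ : ∀ {x y} → (E ⊖ A) ∋ x ∼ y → x ≢ v → y ≢ v → (E ⊖ A₂) ∋ x ∼ y
    H⇒H₂ h x≢v y≢v with ⊖-cases h
    ... | inj₂ (¬e , a) = ⊖-add ¬e (pairs⁺ R? R-sym R-irrefl (inj₂ ((x≢v , y≢v) , a)))
    ... | inj₁ (e , ¬a) = ⊖-keep e λ a₂ → case pairs⁻ R? R-sym R-irrefl a₂ of λ
      { (inj₁ (inj₁ p , _)) → x≢v p
      ; (inj₁ (inj₂ p , _)) → y≢v p
      ; (inj₂ (_ , a))      → ¬a a }

    private
      e a a₂ : Fin n → Fin n → ℕ
      e x y  = bit (has E x y)
      a x y  = bit (has A x y)
      a₂ x y = bit (has A₂ x y)
      at : Fin n → ℕ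
      at x = bit (does (x ≟ᶠ v))

    -- `A₂` exchanges the pairs of `A` at `v` for the input edges at `v`. The withdrawn terms stand
    -- on the other side to avoid subtraction; at the diagonal entry of `v` everything vanishes by
    -- irreflexivity.
    balance : ∀ x y → a₂ x y + (at x * a v y + at y * a x v) ≡ a x y + (at x * e v y + at y * e x v)
    balance x y with x ≟ᶠ v | y ≟ᶠ v
    ... | yes refl | yes refl rewrite PairSet.irrefl A v | PairSet.irrefl E v = refl
    ... | no _     | no _     = refl
    ... | yes refl | no _     rewrite ∨-identityʳ (has E v y) = swap (e v y) (a v y)
      where
      swap : ∀ p q → p + (q + 0 + 0) ≡ q + (p + 0 + 0)
      swap = solve-∀
    ... | no _     | yes refl rewrite ∨-identityʳ (has E x v) = swap (e x v) (a x v)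
      where
      swap : ∀ p q → p + (q + 0) ≡ q + (p + 0)
      swap = solve-∀

    sum-cross : ∀ (F : PairSet n) (f : Fin n → Fin n → ℕ) →
                sum (λ x → sum λ y → f x y + (at x * bit (has F v y) + at y * bit (has F x v))) ≡
                sum (λ x → sum (f x)) + (deg F v + deg F v)
    sum-cross F f = begin
      sum (λ x → sum λ y → f x y + (p x y + q x y))
        ≡⟨ sum-cong-≗ (λ x → trans (∑-distrib-+ (f x) (λ y → p x y + q x y)) (cong (sum (f x) +_) (∑-distrib-+ (p x) (q x)))) ⟩
      sum (λ x → sum (f x) + (sum (p x) + sum (q x)))
        ≡⟨ trans (∑-distrib-+ (λ x → sum (f x)) (λ x → sum (p x) + sum (q x)))
                 (cong (sum (λ x → sum (f x)) +_) (∑-distrib-+ (λ x → sum (p x)) (λ x → sum (q x)))) ⟩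
      sum (λ x → sum (f x)) + (sum (λ x → sum (p x)) + sum (λ x → sum (q x)))
        ≡⟨ cong (sum (λ x → sum (f x)) +_) (cong₂ _+_ row column) ⟩
      sum (λ x → sum (f x)) + (deg F v + deg F v) ∎
      where
      open ≡-Reasoning
      p q : Fin n → Fin n → ℕ
      p x y = at x * bit (has F v y)
      q x y = at y * bit (has F x v)
      at-v : at v ≡ 1
      at-v = bit-yes (v ≟ᶠ v) refl
      at-other : ∀ x → x ≢ v → at x ≡ 0
      at-other x = bit-no (x ≟ᶠ v)
      row : sum (λ x → sum (p x)) ≡ deg F v
      row = trans (sum-single v λ x x≢v → sum-zero λ y → cong (_* bit (has F v y)) (at-other x x≢v))
                  (sum-cong-≗ λ y → trans (cong (_* bit (has F v y)) at-v) (+-identityʳ _))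
      column : sum (λ x → sum (q x)) ≡ deg F v
      column = sum-cong-≗ λ x → trans (sum-single v λ y y≢v → cong (_* bit (has F x v)) (at-other y y≢v))
        (trans (cong (_* bit (has F x v)) at-v) (trans (+-identityʳ _) (cong bit (PairSet.sym F x v))))

    vol-isolate : vol A₂ + (deg A v + deg A v) ≡ vol A + (deg E v + deg E v)
    vol-isolate = trans (sym (sum-cross A a₂))
      (trans (sum-cong-≗ λ x → sum-cong-≗ λ y → balance x y) (sum-cross E a))

    cheaper : deg E v ≤ deg A v → ∣ A₂ ∣ ≤ ∣ A ∣
    cheaper le = ∣∣-mono-vol {A = A₂} {A} (+-cancelʳ-≤ (deg A v + deg A v) _ _
      (≤-trans (≤-reflexive vol-isolate) (+-monoʳ-≤ (vol A) (+-mono-≤ le le))))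

  module Forget (A : PairSet n) (noPaw : NoPaw (E ⊖ A)) where

    open Multipartite noPaw

    private
      Z = Anchored E A

    anchor-tri : ∀ {x} → Z x → InTriangle (E ⊖ A) x
    anchor-tri (a , b , c , (_ , ab) , (_ , bc) , (_ , ac) , xa) = triangle-step (b , c , ab , bc , ac) (∼-sym xa)

    anchor-step : ∀ {x y} → Z x → (E ⊖ A) ∋ x ∼ y → Z y
    anchor-step {x} {y} z@(a , b , c , (eab , ab) , bc , ac , xa) xy with (E ⊖ A) ∋? y ∼ a
    ... | yes ya = a , b , c , (eab , ab) , bc , ac , ya
    ... | no ¬ya = b , a , c , (∼-sym eab , ∼-sym ab) , ac , bc ,
                   same-part (anchor-tri z) xa xy (¬ya ∘ ∼-sym) ab

    R : Fin n → Fin n → Set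
    R x y = A ∋ x ∼ y × (E ∋ x ∼ y ⊎ Z x × Z y)

    R? : ∀ x y → Dec (R x y)
    R? x y = A ∋? x ∼ y ×-dec (E ∋? x ∼ y ⊎-dec (anchored? A x ×-dec anchored? A y))

    R-sym : ∀ {x y} → R x y → R y x
    R-sym (a , inj₁ e)         = ∼-sym a , inj₁ (∼-sym e)
    R-sym (a , inj₂ (zx , zy)) = ∼-sym a , inj₂ (zy , zx)

    R-irrefl : ∀ {x} → ¬ R x x
    R-irrefl (a , _) = ∼-irrefl a

    A₂ : PairSet n
    A₂ = pairs R? R-sym R-irrefl

    A₂⊆A : ∀ {x y} → A₂ ∋ x ∼ y → A ∋ x ∼ y
    A₂⊆A = proj₁ ∘ pairs⁻ R? R-sym R-irrefl

    H₂⊆H : ∀ {x y} → (E ⊖ A₂) ∋ x ∼ y → (E ⊖ A) ∋ x ∼ y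
    H₂⊆H h with ⊖-cases h
    ... | inj₁ (e , ¬a₂) = ⊖-keep e λ a → ¬a₂ (pairs⁺ R? R-sym R-irrefl (a , inj₁ e))
    ... | inj₂ (¬e , a₂) = ⊖-add ¬e (A₂⊆A a₂)

    H⇒H₂ : ∀ {x y} → (E ⊖ A) ∋ x ∼ y → Z x → Z y → (E ⊖ A₂) ∋ x ∼ y
    H⇒H₂ h zx zy with ⊖-cases h
    ... | inj₁ (e , ¬a) = ⊖-keep e (¬a ∘ A₂⊆A)
    ... | inj₂ (¬e , a) = ⊖-add ¬e (pairs⁺ R? R-sym R-irrefl (a , inj₂ (zx , zy)))

    H₂⇒E : ∀ {x y} → (E ⊖ A₂) ∋ x ∼ y → ¬ Z x → E ∋ x ∼ y
    H₂⇒E h ¬zx with ⊖-cases h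
    ... | inj₁ (e , _)   = e
    ... | inj₂ (¬e , a₂) with pairs⁻ R? R-sym R-irrefl a₂
    ...   | _ , inj₁ e        = e
    ...   | _ , inj₂ (zx , _) = contradiction zx ¬zx

    -- If the corner `c` were not anchored, neither would be its neighbours, so the triangle would
    -- consist of input edges kept by `A` and would itself anchor `c`. Hence every triangle lies
    -- among anchored vertices, together with its pendant edges, and there the two edited graphs
    -- agree.
    noPaw₂ : NoPaw (E ⊖ A₂)
    noPaw₂ {a} {b} {c} {d} ab bc ac cd d≢a d≢b = result
      (noPaw (H₂⊆H ab) (H₂⊆H bc) (H₂⊆H ac) (H₂⊆H cd) d≢a d≢b)
      where
      zc : Z c
      zc = decidable-stable (anchored? A c) λ ¬zc →
        let ¬zx : ∀ {x} → (E ⊖ A) ∋ c ∼ x → ¬ Z x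
            ¬zx cx zx = ¬zc (anchor-step zx (∼-sym cx))
            ¬za = ¬zx (∼-sym (H₂⊆H ac))
            ¬zb = ¬zx (∼-sym (H₂⊆H bc))
        in ¬zc (a , b , c , (H₂⇒E ab ¬za , H₂⊆H ab) , (H₂⇒E bc ¬zb , H₂⊆H bc)
               , (H₂⇒E ac ¬za , H₂⊆H ac) , ∼-sym (H₂⊆H ac))
      za = anchor-step zc (∼-sym (H₂⊆H ac))
      zb = anchor-step zc (∼-sym (H₂⊆H bc))
      zd = anchor-step zc (H₂⊆H cd)
      result : (E ⊖ A) ∋ a ∼ d ⊎ (E ⊖ A) ∋ b ∼ d → (E ⊖ A₂) ∋ a ∼ d ⊎ (E ⊖ A₂) ∋ b ∼ d
      result (inj₁ ad) = inj₁ (H⇒H₂ ad za zd)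
      result (inj₂ bd) = inj₂ (H⇒H₂ bd zb zd)

  private
    heavy? : ∀ A → Dec (∃ λ x → ∃ λ y → (E ⊖ A) ∋ x ∼ y × deg E x ≤ deg A x)
    heavy? A = any? λ x → any? λ y → (E ⊖ A) ∋? x ∼ y ×-dec deg E x ≤? deg A x

    stray? : ∀ A → Dec (∃ λ x → ∃ λ y → ((E ⊖ A) ∋ x ∼ y × ¬ E ∋ x ∼ y) × ¬ Anchored E A x)
    stray? A = any? λ x → any? λ y → ((E ⊖ A) ∋? x ∼ y ×-dec ¬? (E ∋? x ∼ y)) ×-dec ¬? (anchored? A x)

  -- Both repairs remove at least one edge of the edited graph and add none, so `vol (E ⊖ A)`
  -- decreases while the solution does not grow.
  normalise : ∀ A → NoPaw (E ⊖ A) → Acc _<_ (vol (E ⊖ A)) →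
              ∃ λ A′ → ∣ A′ ∣ ≤ ∣ A ∣ × NoPaw (E ⊖ A′) × Normal E A′
  normalise A noPaw (acc smaller) with heavy? A | stray? A
  ... | yes (v , y , vy , le) | _ =
    let A′ , ≤A₂ , rest = normalise A₂ (NoPaw-restrict noPaw H₂⇒H H⇒H₂)
          (smaller (vol-mono-< (proj₁ ∘ H₂⇒H) (λ h → proj₂ (H₂⇒H h) refl) vy))
    in A′ , ≤-trans ≤A₂ (cheaper le) , rest
    where open Isolate A v
  ... | no _ | yes (x , y , (xy , ¬e) , ¬zx) =
    let A′ , ≤A₂ , rest = normalise A₂ noPaw₂
          (smaller (vol-mono-< H₂⊆H (λ h → ¬e (H₂⇒E h ¬zx)) xy))
    in A′ , ≤-trans ≤A₂ (∣∣-mono {A = A₂} {A} A₂⊆A) , rest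
    where open Forget A noPaw
  ... | no ¬heavy | no ¬stray = A , ≤-refl , noPaw , record
    { light    = λ {x} {y} h → ≰⇒> λ le → ¬heavy (x , y , h , le)
    ; anchored = λ {x} {y} h ¬e → decidable-stable (anchored? A x) λ ¬z → ¬stray (x , y , (h , ¬e) , ¬z)
    }

-- The reduction rules

infix  8 _~_ _≈_ _≼_ _at_
infixr 7 _and_
infixr 6 _or_
infixr 5 _implies_

-- First-order formulas over graphs in de Bruijn style, with a counting
-- quantifier `many` whose threshold is fixed by the interpretation.
data Formula : ℕ → Set where
  _~_ _≈_ _≼_          : ∀ {m} → Fin m → Fin m → Formula m
  not                  : ∀ {m} → Formula m → Formula m
  _and_ _or_ _implies_ : ∀ {m} → Formula m → Formula m → Formula m
  some every many      : ∀ {m} → Formula (suc m) → Formula m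
  _at_                 : ∀ {m} → Formula 1 → Fin m → Formula m

module Semantics {n} (E : PairSet n) (K : ℕ) where

  Sat  : ∀ {m} → Formula m → Vec (Fin n) m → Set
  sat? : ∀ {m} (φ : Formula m) ρ → Dec (Sat φ ρ)

  Sat (x ~ y)       ρ = E ∋ lookup ρ x ∼ lookup ρ y
  Sat (x ≈ y)       ρ = lookup ρ x ≡ lookup ρ y
  Sat (x ≼ y)       ρ = toℕ (lookup ρ x) ≤ toℕ (lookup ρ y)
  Sat (not φ)       ρ = ¬ Sat φ ρ
  Sat (φ and ψ)     ρ = Sat φ ρ × Sat ψ ρ
  Sat (φ or ψ)      ρ = Sat φ ρ ⊎ Sat ψ ρ
  Sat (φ implies ψ) ρ = Sat φ ρ → Sat ψ ρ
  Sat (some φ)      ρ = ∃ λ x → Sat φ (x ∷ ρ)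
  Sat (every φ)     ρ = ∀ x → Sat φ (x ∷ ρ)
  Sat (many φ)      ρ = K ≤ count λ x → sat? φ (x ∷ ρ)
  Sat (φ at x)      ρ = Sat φ (lookup ρ x ∷ [])

  sat? (x ~ y)       ρ = E ∋? lookup ρ x ∼ lookup ρ y
  sat? (x ≈ y)       ρ = lookup ρ x ≟ᶠ lookup ρ y
  sat? (x ≼ y)       ρ = toℕ (lookup ρ x) ≤? toℕ (lookup ρ y)
  sat? (not φ)       ρ = ¬? (sat? φ ρ)
  sat? (φ and ψ)     ρ = sat? φ ρ ×-dec sat? ψ ρ
  sat? (φ or ψ)      ρ = sat? φ ρ ⊎-dec sat? ψ ρ
  sat? (φ implies ψ) ρ = sat? φ ρ →-dec sat? ψ ρ
  sat? (some φ)      ρ = any? λ x → sat? φ (x ∷ ρ)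
  sat? (every φ)     ρ = all? λ x → sat? φ (x ∷ ρ)
  sat? (many φ)      ρ = K ≤? count λ x → sat? φ (x ∷ ρ)
  sat? (φ at x)      ρ = sat? φ (lookup ρ x ∷ [])

nonisolated : ∀ {m} → Fin m → Formula m
nonisolated v = some (suc v ~ 0F)

twins : ∀ {m} → Fin m → Fin m → Formula m
twins v u = every ((suc v ~ 0F implies suc u ~ 0F) and (suc u ~ 0F implies suc v ~ 0F))

-- Adjacency after isolating v.
adjacent₀ : ∀ {m} → Fin m → Fin m → Fin m → Formula m
adjacent₀ v x y = x ~ y and not (x ≈ v) and not (y ≈ v)

twins₀ : ∀ {m} → Fin m → Fin m → Fin m → Formula m
twins₀ v x y = every ((adjacent₀ (suc v) (suc x) 0F implies adjacent₀ (suc v) (suc y) 0F) and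
                      (adjacent₀ (suc v) (suc y) 0F implies adjacent₀ (suc v) (suc x) 0F))

inside : ∀ {m} → Fin m → Fin m → Formula m
inside v u = every (suc u ~ 0F implies (suc v ~ 0F or twins (suc v) 0F))

near : ∀ {m} → Fin m → Fin m → Formula m
near v z = v ~ z or some (suc v ~ 0F and 0F ~ suc z)

otherTwin : ∀ {m} → Fin m → Fin m → Formula m
otherTwin v u = not (u ≈ v) and twins v u

manyTwins : ∀ {m} → Fin m → Formula m
manyTwins v = many (otherTwin (suc v) 0F)

-- N(v) contains many vertices a, b and w that behave like single parts of a
-- complete multipartite component consisting of N(v) and the twins of v.
thirdPart : ∀ {m} → Fin m → Fin m → Fin m → Fin m → Formula m
thirdPart v a b w = v ~ w and a ~ w and b ~ w

secondPart : ∀ {m} → Fin m → Fin m → Fin m → Formula m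
secondPart v a b = v ~ b and a ~ b and inside v b and
  every (suc v ~ 0F implies (suc a ~ 0F or suc b ~ 0F)) and
  many (thirdPart (suc v) (suc a) (suc b) 0F)

firstPart : ∀ {m} → Fin m → Fin m → Formula m
firstPart v a = v ~ a and inside v a and many (secondPart (suc v) (suc a) 0F)

-- The three counting quantifiers are nested because witnesses are chosen in turn: which candidates
-- for the second part qualify depends on the untouched vertex found for the first.
manyParts : ∀ {m} → Fin m → Formula m
manyParts v = many (firstPart (suc v) 0F)

nearClosed : ∀ {m} → Fin m → Formula m
nearClosed v = every (every (near (suc (suc v)) 1F implies 1F ~ 0F implies near (suc (suc v)) 0F))

nearPawFree : ∀ {m} → Fin m → Formula m
nearPawFree v = every (every (every (every
  (near (suc (suc (suc (suc v)))) 1F implies 3F ~ 2F implies 2F ~ 1F implies 3F ~ 1F implies 1F ~ 0F implies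
   not (0F ≈ 3F) implies not (0F ≈ 2F) implies (3F ~ 0F or 2F ~ 0F)))))

-- If `p` lay in a triangle of the solution, two nonadjacent neighbours of `p` would share a part
-- and have equal neighbourhoods there. If both are untouched, they are then twins in the input
-- without `v`; a separated untouched pair refutes this.
separated : ∀ {m} → Fin m → Fin m → Fin m → Fin m → Formula m
separated v p x y = adjacent₀ v p y and not (adjacent₀ v x y) and not (twins₀ v x y)

-- Once v is isolated, no cheap solution puts a safe p into a triangle:
-- otherwise nearly all neighbours of p would lie in one part.
safe : ∀ {m} → Fin m → Fin m → Formula m
safe v p = many (adjacent₀ (suc v) (suc p) 0F and many (separated (suc (suc v)) (suc (suc p)) 1F 0F))

-- p reaches a triangle by a walk of length at most i through unsafe vertices.
reaches : ∀ {m} → ℕ → Fin m → Fin m → Formula m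
reaches zero v p = not (safe v p) and
  some (not (safe (suc v) 0F) and adjacent₀ (suc v) (suc p) 0F and
    some (adjacent₀ (suc (suc v)) (suc (suc p)) 0F and adjacent₀ (suc (suc v)) 1F 0F))
reaches (suc i) v p = not (safe v p) and
  (reaches i v p or some (adjacent₀ (suc v) (suc p) 0F and reaches i (suc v) 0F))

common : ∀ {m} → Fin m → Fin m → Fin m → Fin m → Formula m
common v p q w = not (w ≈ v) and p ~ w and q ~ w

-- An edge between neighbours of `v` must not survive, as it would close a triangle with `v`. If it
-- did survive, an untouched common neighbour would put its ends into a triangle avoiding `v`, which
-- the second clause excludes. The 3 is the length of the walks of `short-walk`.
harmless : ∀ {m} → Fin m → Formula m
harmless v =
  every (every (suc (suc v) ~ 1F implies suc (suc v) ~ 0F implies 1F ~ 0F implies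
    many (common (suc (suc (suc v))) 2F 1F 0F))) and
  every (suc v ~ 0F implies not (reaches 3 (suc v) 0F))

-- `nonisolated` makes every deletion progress, measured by the number of nonisolated vertices.
-- Without it the twin rule would apply again and again to a large set of isolated vertices.
deletable : ∀ {m} → Fin m → Formula m
deletable v = nonisolated v and
  (manyTwins v or manyParts v or (nearClosed v and nearPawFree v) or harmless v)

-- The meaning of `reaches`, freed from the ambient valuation.
module Reachability {n} (E : PairSet n) (K : ℕ) where

  open Semantics E K

  Exposed : Fin n → Fin n → Set
  Exposed v p = ¬ Sat (safe 0F 1F) (v ∷ p ∷ [])

  Adjacent₀ : Fin n → Fin n → Fin n → Set
  Adjacent₀ v x y = E ∋ x ∼ y × x ≢ v × y ≢ v

  Reaches : ℕ → Fin n → Fin n → Set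
  Reaches zero v p = Exposed v p × ∃ λ q → Exposed v q × Adjacent₀ v p q × ∃ λ r → Adjacent₀ v p r × Adjacent₀ v q r
  Reaches (suc i) v p = Exposed v p × (Reaches i v p ⊎ ∃ λ q → Adjacent₀ v p q × Reaches i v q)

  reaches⁺ : ∀ {m} i {x y} {ρ : Vec (Fin n) m} → Reaches i (lookup ρ x) (lookup ρ y) → Sat (reaches i x y) ρ
  reaches⁺ zero    r                         = r
  reaches⁺ (suc i) (s , inj₁ r)              = s , inj₁ (reaches⁺ i r)
  reaches⁺ (suc i) (s , inj₂ (q , pq , r))   = s , inj₂ (q , pq , reaches⁺ i r)

  reaches⁻ : ∀ {m} i {x y} {ρ : Vec (Fin n) m} → Sat (reaches i x y) ρ → Reaches i (lookup ρ x) (lookup ρ y)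
  reaches⁻ zero    r                         = r
  reaches⁻ (suc i) (s , inj₁ r)              = s , inj₁ (reaches⁻ i r)
  reaches⁻ (suc i) (s , inj₂ (q , pq , r))   = s , inj₂ (q , pq , reaches⁻ i r)

-- Soundness of the reduction rules

threshold : ℕ → ℕ
threshold k = suc (k + k)

isolate : ∀ {n} → Fin n → PairSet n → PairSet n
isolate v E = pairs (λ x y → E ∋? x ∼ y ×-dec ¬? (x ≟ᶠ v) ×-dec ¬? (y ≟ᶠ v))
                    (λ { (e , p , q) → ∼-sym e , q , p }) (∼-irrefl ∘ proj₁)

module _ {n} {E : PairSet n} {v : Fin n} where

  isolate⁺ : ∀ {x y} → E ∋ x ∼ y × x ≢ v × y ≢ v → isolate v E ∋ x ∼ y
  isolate⁺ = pairs⁺ _ _ _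

  isolate⁻ : ∀ {x y} → isolate v E ∋ x ∼ y → E ∋ x ∼ y × x ≢ v × y ≢ v
  isolate⁻ = pairs⁻ _ _ _

untouched-member : ∀ {n k} {A : PairSet n} {P : Fin n → Set} (P? : Decidable P) → ∣ A ∣ ≤ k →
                   threshold k ≤ count P? → ∃ λ x → P x × ¬ Touched A x
untouched-member {A = A} P? ∣A∣≤k large = count-exceeds P? (touched? A)
  (≤-trans (s≤s (≤-trans (count-touched A) (+-mono-≤ ∣A∣≤k ∣A∣≤k))) large)

module _ {n} {E A : PairSet n} {x} (¬t : ¬ Touched A x) where

  untouched⇒H : ∀ {y} → E ∋ x ∼ y → (E ⊖ A) ∋ x ∼ y
  untouched⇒H e = ⊖-keep e λ a → ¬t (_ , a)

  untouched⇒E : ∀ {y} → (E ⊖ A) ∋ x ∼ y → E ∋ x ∼ y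
  untouched⇒E h = ⊖-old h λ a → ¬t (_ , a)

pigeonhole : ∀ {n} {P Q R : Fin n → Set} (P? : Decidable P) (Q? : Decidable Q) (R? : Decidable R) →
             (∀ {x} → P x → R x) → (∀ {x} → Q x → R x) →
             count R? < count P? + count Q? → ∃ λ x → P x × Q x
pigeonhole P? Q? R? P⊆R Q⊆R lt with any? (λ x → P? x ×-dec Q? x)
... | yes w = w
... | no ¬w = contradiction (≤-trans (≤-reflexive (sym (∑-distrib-+ (λ x → bit (does (P? x))) (λ x → bit (does (Q? x)))))) (sum-mono bound)) (<⇒≱ lt)
  where
  bound : ∀ x → bit (does (P? x)) + bit (does (Q? x)) ≤ bit (does (R? x))
  bound x with P? x | Q? x
  ... | yes p | yes q = contradiction (x , p , q) ¬w
  ... | yes p | no _  = ≤-reflexive (sym (bit-yes (R? x) (P⊆R p)))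
  ... | no _  | yes q = ≤-reflexive (sym (bit-yes (R? x) (Q⊆R q)))
  ... | no _  | no _  = z≤n

module Majority {n} {E A : PairSet n} (normal : Normal E A) where

  private
    H = E ⊖ A

  -- Deleted edges count both in the edits and in the input edges at `x`, so lightness says that
  -- fewer pairs are added at `x` than input edges are kept. `degrees` expresses this without
  -- subtraction, by a case check for each pair.
  majority : ∀ {x y} → H ∋ x ∼ y → deg H x < count (kept? E A x) + count (kept? E A x)
  majority {x} xy = +-cancelˡ-< (deg A x) _ _ (begin-strict
    deg A x + deg H x                                             ≡⟨ +-comm (deg A x) _ ⟩
    deg H x + deg A x                                             <⟨ +-monoʳ-< (deg H x) (Normal.light normal xy) ⟩
    deg H x + deg E x                                             ≡⟨ degrees ⟩
    deg A x + (count (kept? E A x) + count (kept? E A x))         ∎)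
    where
    open ≤-Reasoning
    identity : ∀ e a → bit (e xor a) + bit e ≡ bit a + (bit (e ∧ (e xor a)) + bit (e ∧ (e xor a)))
    identity true  true  = refl
    identity true  false = refl
    identity false true  = refl
    identity false false = refl
    degrees : deg H x + deg E x ≡ deg A x + (count (kept? E A x) + count (kept? E A x))
    degrees = trans (sym (∑-distrib-+ (λ y → bit (has H x y)) (λ y → bit (has E x y))))
      (trans (sum-cong-≗ λ y → identity (has E x y) (has A x y))
      (trans (∑-distrib-+ (λ y → bit (has A x y)) _) (cong (deg A x +_) (∑-distrib-+ (λ y → bit (does (kept? E A x y))) _))))

  module _ (noPaw : NoPaw H) where

    open Multipartite noPaw

    -- Both majorities lie in the common neighbourhood, so they meet.
    common-kept : ∀ {x y z w} → H ∋ x ∼ z → H ∋ y ∼ w →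
                  (∀ {u} → Kept E A x u → H ∋ y ∼ u) → (∀ {u} → Kept E A y u → H ∋ x ∼ u) →
                  ∃ λ u → Kept E A x u × Kept E A y u
    common-kept {x} {y} xz yw x⊆y y⊆x = pigeonhole (kept? E A x) (kept? E A y) both?
      (λ f → proj₂ f , x⊆y f) (λ f → y⊆x f , proj₂ f)
      (half≤ {p = count (kept? E A x)} {count (kept? E A y)} (both≤ proj₁) (both≤ proj₂) (majority xz) (majority yw))
      where
      both? : Decidable λ u → H ∋ x ∼ u × H ∋ y ∼ u
      both? u = H ∋? x ∼ u ×-dec H ∋? y ∼ u
      both≤ : ∀ {z} → (∀ {u} → H ∋ x ∼ u × H ∋ y ∼ u → H ∋ z ∼ u) → count both? ≤ deg H z
      both≤ {z} = count-mono both? (H ∋? z ∼_)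
      half≤ : ∀ {r s t p q} → r ≤ s → r ≤ t → s < p + p → t < q + q → r < p + q
      half≤ {r} {s} {t} {p} {q} r≤s r≤t s<2p t<2q with r <? p + q
      ... | yes lt = lt
      ... | no ¬lt = contradiction (+-mono-≤ (≮⇒≥ ¬lt) (≮⇒≥ ¬lt)) (<⇒≱ (begin-strict
        r + r              ≤⟨ +-mono-≤ r≤s r≤t ⟩
        s + t              <⟨ +-mono-< s<2p t<2q ⟩
        p + p + (q + q)    ≡⟨ shuffle p q ⟩
        p + q + (p + q)    ∎))
        where
        open ≤-Reasoning
        shuffle : ∀ p q → p + p + (q + q) ≡ p + q + (p + q)
        shuffle = solve-∀

    same-part-kept : ∀ {p x y} → InTriangle H p → H ∋ p ∼ x → H ∋ p ∼ y → ¬ H ∋ x ∼ y →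
                     ∃ λ u → Kept E A x u × Kept E A y u
    same-part-kept tri px py ¬xy = common-kept (∼-sym px) (∼-sym py)
      (same-part tri px py ¬xy ∘ proj₂) (same-part tri py px (¬xy ∘ ∼-sym) ∘ proj₂)

    Step : Fin n → Fin n → Set
    Step x y = x ≡ y ⊎ Kept E A x y

    kept-sym : ∀ {x y} → Kept E A x y → Kept E A y x
    kept-sym (e , h) = ∼-sym e , ∼-sym h

    -- If a kept neighbour `u` of `x` misses `y`, then `u` and `y` share a part and so have a common
    -- kept neighbour; symmetrically for a kept neighbour of `y` that misses `x`. Otherwise all kept
    -- neighbours of either are neighbours of both, and the two majorities meet. Idle steps give all
    -- walks the same length.
    short-walk : ∀ {x y} → InTriangle H x → H ∋ x ∼ y → ∃ λ u → ∃ λ w → Step x u × Step u w × Step w y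
    short-walk {x} {y} tri xy
      with any? (λ u → kept? E A x u ×-dec ¬? (H ∋? y ∼ u))
         | any? (λ u → kept? E A y u ×-dec ¬? (H ∋? x ∼ u))
    ... | yes (u , xu , ¬yu) | _ =
      let c , uc , yc = same-part-kept tri (proj₂ xu) xy (¬yu ∘ ∼-sym)
      in u , c , inj₂ xu , inj₂ uc , inj₂ (kept-sym yc)
    ... | no _ | yes (u , yu , ¬xu) =
      let c , xc , uc = same-part-kept (triangle-step tri xy) (∼-sym xy) (proj₂ yu) ¬xu
      in c , u , inj₂ xc , inj₂ (kept-sym uc) , inj₂ (kept-sym yu)
    ... | no ¬a | no ¬b =
      let c , xc , yc = common-kept xy (∼-sym xy)
            (λ {u} f → decidable-stable (H ∋? y ∼ u) λ ¬h → ¬a (u , f , ¬h))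
            (λ {u} f → decidable-stable (H ∋? x ∼ u) λ ¬h → ¬b (u , f , ¬h))
      in c , y , inj₂ xc , inj₂ (kept-sym yc) , inj₁ refl

Solvable : ∀ {n} → PairSet n → ℕ → Set
Solvable {n} E k = Σ[ A ∈ PairSet n ] ∣ A ∣ ≤ k × NoPaw (E ⊖ A)

-- Withdrawing all edits at `Q` restores the input neighbourhoods of its vertices. This is how `v`
-- regains its edges when it must do so together with its twins or with its whole component.
module Drop {n} {A : PairSet n} {Q : Fin n → Set} (Q? : Decidable Q) where

  private
    R? : ∀ x y → Dec (A ∋ x ∼ y × ¬ Q x × ¬ Q y)
    R? x y = A ∋? x ∼ y ×-dec ¬? (Q? x) ×-dec ¬? (Q? y)

    R-sym : ∀ {x y} → A ∋ x ∼ y × ¬ Q x × ¬ Q y → A ∋ y ∼ x × ¬ Q y × ¬ Q x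
    R-sym (a , p , q) = ∼-sym a , q , p

  rest : PairSet n
  rest = pairs R? R-sym (∼-irrefl ∘ proj₁)

  rest⁺ : ∀ {x y} → A ∋ x ∼ y → ¬ Q x → ¬ Q y → rest ∋ x ∼ y
  rest⁺ a p q = pairs⁺ R? R-sym (∼-irrefl ∘ proj₁) (a , p , q)

  rest⁻ : ∀ {x y} → rest ∋ x ∼ y → A ∋ x ∼ y × ¬ Q x × ¬ Q y
  rest⁻ = pairs⁻ R? R-sym (∼-irrefl ∘ proj₁)

  ∣rest∣≤ : ∣ rest ∣ ≤ ∣ A ∣
  ∣rest∣≤ = ∣∣-mono {A = rest} {A} (proj₁ ∘ rest⁻)

  untouched : ∀ {x} → Q x → ¬ Touched rest x
  untouched q (_ , r) = proj₁ (proj₂ (rest⁻ r)) q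

module Soundness {n} {E : PairSet n} {v : Fin n} {k : ℕ} {A : PairSet n} (∣A∣≤k : ∣ A ∣ ≤ k)
                 (noPaw : NoPaw (isolate v E ⊖ A)) (normal : Normal (isolate v E) A) where

  open Semantics E (threshold k)
  open Reachability E (threshold k)
  open Multipartite noPaw

  private
    E₀ = isolate v E
    H  = E₀ ⊖ A
    H⁺ = E ⊖ A

  member : ∀ {m} (φ : Formula (suc m)) {ρ} → Sat (many φ) ρ → ∃ λ x → Sat φ (x ∷ ρ) × ¬ Touched A x
  member φ {ρ} = untouched-member {A = A} (λ x → sat? φ (x ∷ ρ)) ∣A∣≤k

  -- An edge at `v` would, by lightness, demand a positive degree of `v` in the input of the
  -- solution, where `v` is isolated.
  v-isolated : ∀ {x} → ¬ H ∋ v ∼ x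
  v-isolated h = n≮0 (subst (deg A v <_) (sum-zero λ y → bit-no (E₀ ∋? v ∼ y) λ e → proj₁ (proj₂ (isolate⁻ {E = E} e)) refl)
                            (Normal.light normal h))

  H⇒≢ : ∀ {x y} → H ∋ x ∼ y → x ≢ v × y ≢ v
  H⇒≢ h = (λ { refl → v-isolated h }) , (λ { refl → v-isolated (∼-sym h) })

  v-untouched : ¬ Touched A v
  v-untouched (x , a) = v-isolated (⊖-add (λ e → proj₁ (proj₂ (isolate⁻ {E = E} e)) refl) a)

  H⇒H⁺ : ∀ {x y} → H ∋ x ∼ y → H⁺ ∋ x ∼ y
  H⇒H⁺ h with ⊖-cases h
  ... | inj₁ (e , ¬a) = ⊖-keep (proj₁ (isolate⁻ {E = E} e)) ¬a
  ... | inj₂ (¬e , a) = ⊖-add (λ e → ¬e (isolate⁺ (e , H⇒≢ h))) a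

  H⁺⇒H : ∀ {x y} → H⁺ ∋ x ∼ y → x ≢ v → y ≢ v → H ∋ x ∼ y
  H⁺⇒H h x≢v y≢v with ⊖-cases h
  ... | inj₁ (e , ¬a) = ⊖-keep (isolate⁺ (e , x≢v , y≢v)) ¬a
  ... | inj₂ (¬e , a) = ⊖-add (¬e ∘ proj₁ ∘ isolate⁻) a

  untouchedE⇒H : ∀ {x y} → ¬ Touched A x → E ∋ x ∼ y → x ≢ v → y ≢ v → H ∋ x ∼ y
  untouchedE⇒H ¬t e x≢v y≢v = untouched⇒H ¬t (isolate⁺ (e , x≢v , y≢v))

  untouchedH⇒E : ∀ {x y} → ¬ Touched A x → H ∋ x ∼ y → E ∋ x ∼ y
  untouchedH⇒E ¬t h = proj₁ (isolate⁻ {E = E} (untouched⇒E ¬t h))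

  -- An untouched twin u of v serves as a template for v.
  module Twins {u} (u≢v : u ≢ v) (twin : Sat (twins 0F 1F) (v ∷ u ∷ [])) (¬tu : ¬ Touched A u) where

    private
      r : Fin n → Fin n
      r x with x ≟ᶠ v
      ... | yes _ = u
      ... | no _  = x

    forth : ∀ {x y} → H⁺ ∋ x ∼ y → H ∋ r x ∼ r y
    forth {x} {y} h with x ≟ᶠ v | y ≟ᶠ v
    ... | yes refl | yes refl = contradiction h ∼-irrefl
    ... | no x≢v   | no y≢v   = H⁺⇒H h x≢v y≢v
    ... | yes refl | no y≢v   = untouchedE⇒H ¬tu (proj₁ (twin y) (untouched⇒E v-untouched h)) u≢v y≢v
    ... | no x≢v   | yes refl = ∼-sym (untouchedE⇒H ¬tu (proj₁ (twin x) (untouched⇒E v-untouched (∼-sym h))) u≢v x≢v)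

    back : ∀ {x y} → H ∋ r x ∼ r y → H⁺ ∋ x ∼ y
    back {x} {y} h with x ≟ᶠ v | y ≟ᶠ v
    ... | yes refl | yes refl = contradiction h ∼-irrefl
    ... | no _     | no _     = H⇒H⁺ h
    ... | yes refl | no y≢v   = untouched⇒H v-untouched (proj₂ (twin y) (untouchedH⇒E ¬tu h))
    ... | no x≢v   | yes refl = ∼-sym (untouched⇒H v-untouched (proj₂ (twin x) (untouchedH⇒E ¬tu (∼-sym h))))

    solution : NoPaw H⁺
    solution {a} {b} {c} {d} ab bc ac cd d≢a d≢b with r d ≟ᶠ r a | r d ≟ᶠ r b
    -- Distinct vertices with one image under `r` are `u` and `v`, so `d` inherits from `a` the edge
    -- to `b`.
    ... | yes eq | _      = inj₂ (back (subst (H ∋ r b ∼_) (sym eq) (forth (∼-sym ab))))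
    ... | no _   | yes eq = inj₁ (back (subst (H ∋ r a ∼_) (sym eq) (forth ab)))
    ... | no ≢a  | no ≢b  with noPaw (forth ab) (forth bc) (forth ac) (forth cd) ≢a ≢b
    ...   | inj₁ ad = inj₁ (back ad)
    ...   | inj₂ bd = inj₂ (back bd)

  manyTwins-sound : Sat (manyTwins 0F) (v ∷ []) → Solvable E k
  manyTwins-sound large =
    let u , (u≢v , twin) , ¬tu = member (otherTwin 1F 0F) {v ∷ []} large
    in A , ∣A∣≤k , Twins.solution u≢v twin ¬tu

  module Dropped {Q : Fin n → Set} (Q? : Decidable Q) (Qv : Q v) where

    open Drop {A = A} Q?

    H₂ : PairSet n
    H₂ = E ⊖ rest

    H₂⇒E : ∀ {x y} → Q x → H₂ ∋ x ∼ y → E ∋ x ∼ y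
    H₂⇒E q = untouched⇒E (untouched q)

    E⇒H₂ : ∀ {x y} → Q x → E ∋ x ∼ y → H₂ ∋ x ∼ y
    E⇒H₂ q = untouched⇒H (untouched q)

    ≢v : ∀ {x} → ¬ Q x → x ≢ v
    ≢v ¬q refl = ¬q Qv

    H₂⇒H : ∀ {x y} → ¬ Q x → ¬ Q y → H₂ ∋ x ∼ y → H ∋ x ∼ y
    H₂⇒H ¬p ¬q h with ⊖-cases h
    ... | inj₁ (e , ¬r) = ⊖-keep (isolate⁺ (e , ≢v ¬p , ≢v ¬q)) λ a → ¬r (rest⁺ a ¬p ¬q)
    ... | inj₂ (¬e , r) = ⊖-add (¬e ∘ proj₁ ∘ isolate⁻) (proj₁ (rest⁻ r))

    H⇒H₂ : ∀ {x y} → ¬ Q x → ¬ Q y → H ∋ x ∼ y → H₂ ∋ x ∼ y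
    H⇒H₂ ¬p ¬q h with ⊖-cases h
    ... | inj₁ (e , ¬a) = ⊖-keep (proj₁ (isolate⁻ {E = E} e)) (¬a ∘ proj₁ ∘ rest⁻)
    ... | inj₂ (¬e , a) = ⊖-add (λ e → ¬e (isolate⁺ (e , ≢v ¬p , ≢v ¬q))) (rest⁺ a ¬p ¬q)

  module Near (closed : Sat (nearClosed 0F) (v ∷ [])) (pawFree : Sat (nearPawFree 0F) (v ∷ []))
              (Qv : Sat (near 0F 1F) (v ∷ v ∷ [])) where

    Q : Fin n → Set
    Q x = Sat (near 0F 1F) (v ∷ x ∷ [])

    open Dropped {Q} (λ x → sat? (near 0F 1F) (v ∷ x ∷ [])) Qv

    -- Edits across the border of `Q` are withdrawn too, so `Q` is a union of components of `H₂`. A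
    -- triangle with its pendant edge lies either inside, where `H₂` is the input, or outside, where
    -- it is `H`.
    Q-step : ∀ {x y} → Q x → H₂ ∋ x ∼ y → Q y
    Q-step {x} {y} q h = closed x y q (H₂⇒E q h)

    solution : NoPaw H₂
    solution {a} {b} {c} {d} ab bc ac cd d≢a d≢b with sat? (near 0F 1F) (v ∷ c ∷ [])
    ... | yes qc = result (pawFree a b c d qc (H₂⇒E qa ab) (H₂⇒E qb bc) (H₂⇒E qa ac) (H₂⇒E qc cd) d≢a d≢b)
      where
      qa = Q-step qc (∼-sym ac)
      qb = Q-step qc (∼-sym bc)
      result : E ∋ a ∼ d ⊎ E ∋ b ∼ d → H₂ ∋ a ∼ d ⊎ H₂ ∋ b ∼ d
      result (inj₁ ad) = inj₁ (E⇒H₂ qa ad)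
      result (inj₂ bd) = inj₂ (E⇒H₂ qb bd)
    ... | no ¬qc = result (noPaw (H₂⇒H ¬qa ¬qb ab) (H₂⇒H ¬qb ¬qc bc) (H₂⇒H ¬qa ¬qc ac) (H₂⇒H ¬qc ¬qd cd) d≢a d≢b)
      where
      ¬qa = λ q → ¬qc (Q-step q ac)
      ¬qb = λ q → ¬qc (Q-step q bc)
      ¬qd = λ q → ¬qc (Q-step q (∼-sym cd))
      result : H ∋ a ∼ d ⊎ H ∋ b ∼ d → H₂ ∋ a ∼ d ⊎ H₂ ∋ b ∼ d
      result (inj₁ ad) = inj₁ (H⇒H₂ ¬qa ¬qd ad)
      result (inj₂ bd) = inj₂ (H⇒H₂ ¬qb ¬qd bd)

  near-sound : Sat (nonisolated 0F) (v ∷ []) → Sat (nearClosed 0F and nearPawFree 0F) (v ∷ []) → Solvable E k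
  near-sound (w , vw) (closed , pawFree) = rest , ≤-trans ∣rest∣≤ ∣A∣≤k , solution
    where
    open Near closed pawFree (inj₂ (w , vw , ∼-sym vw))
    open Drop {A = A} (λ x → sat? (near 0F 1F) (v ∷ x ∷ []))

  -- The twins of v form a part that can be added to, without edits, a complete
  -- multipartite component with vertex set N(v).
  module Parts {u₁ u₂ u₃}
    (vu₁ : E ∋ v ∼ u₁) (vu₂ : E ∋ v ∼ u₂) (vu₃ : E ∋ v ∼ u₃)
    (u₁u₂ : E ∋ u₁ ∼ u₂) (u₁u₃ : E ∋ u₁ ∼ u₃) (u₂u₃ : E ∋ u₂ ∼ u₃)
    (in₁ : Sat (inside 0F 1F) (v ∷ u₁ ∷ [])) (in₂ : Sat (inside 0F 1F) (v ∷ u₂ ∷ []))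
    (cover : ∀ z → E ∋ v ∼ z → E ∋ u₁ ∼ z ⊎ E ∋ u₂ ∼ z)
    (¬t₁ : ¬ Touched A u₁) (¬t₂ : ¬ Touched A u₂) where

    P N : Fin n → Set
    P x = Sat (twins 0F 1F) (v ∷ x ∷ [])
    N x = E ∋ v ∼ x

    P? : Decidable P
    P? x = sat? (twins 0F 1F) (v ∷ x ∷ [])

    open Dropped {P} P? (λ z → (λ e → e) , (λ e → e))

    P⇒N : ∀ {x y} → P x → H₂ ∋ x ∼ y → N y
    P⇒N {y = y} px h = proj₂ (px y) (H₂⇒E px h)

    N⇒P : ∀ {x y} → P x → N y → H₂ ∋ x ∼ y
    N⇒P {y = y} px ny = E⇒H₂ px (proj₁ (px y) ny)

    N⇒¬P : ∀ {x} → N x → ¬ P x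
    N⇒¬P {x} nx px = ∼-irrefl (proj₁ (px x) nx)

    ≢v′ : ∀ {x} → N x → x ≢ v
    ≢v′ nx refl = ∼-irrefl nx

    h₁₂ : H ∋ u₁ ∼ u₂
    h₁₂ = untouchedE⇒H ¬t₁ u₁u₂ (≢v′ vu₁) (≢v′ vu₂)

    tri₁ : InTriangle H u₁
    tri₁ = u₂ , u₃ , h₁₂ , untouchedE⇒H ¬t₂ u₂u₃ (≢v′ vu₂) (≢v′ vu₃) , untouchedE⇒H ¬t₁ u₁u₃ (≢v′ vu₁) (≢v′ vu₃)

    tri₂ : InTriangle H u₂
    tri₂ = triangle-step tri₁ h₁₂

    N-linked : ∀ {x} → N x → H ∋ u₁ ∼ x ⊎ H ∋ u₂ ∼ x
    N-linked {x} nx with cover x nx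
    ... | inj₁ e = inj₁ (untouchedE⇒H ¬t₁ e (≢v′ vu₁) (≢v′ nx))
    ... | inj₂ e = inj₂ (untouchedE⇒H ¬t₂ e (≢v′ vu₂) (≢v′ nx))

    linked⇒N : ∀ {x} → ¬ P x → H ∋ u₁ ∼ x ⊎ H ∋ u₂ ∼ x → N x
    linked⇒N {x} ¬px (inj₁ h) with in₁ x (untouchedH⇒E ¬t₁ h)
    ... | inj₁ nx = nx
    ... | inj₂ px = contradiction px ¬px
    linked⇒N {x} ¬px (inj₂ h) with in₂ x (untouchedH⇒E ¬t₂ h)
    ... | inj₁ nx = nx
    ... | inj₂ px = contradiction px ¬px

    linked-step : ∀ {a b x y} → InTriangle H a → H ∋ a ∼ b → H ∋ a ∼ x → H ∋ x ∼ y → H ∋ a ∼ y ⊎ H ∋ b ∼ y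
    linked-step {a} {b} {x} {y} tri ab ax xy with H ∋? a ∼ y
    ... | yes ay = inj₁ ay
    ... | no ¬ay = inj₂ (∼-sym (same-part (triangle-step tri ax) (∼-sym ax) xy ¬ay ab))

    N-step : ∀ {x y} → N x → ¬ P y → H ∋ x ∼ y → N y
    N-step nx ¬py xy with N-linked nx
    ... | inj₁ h = linked⇒N ¬py (linked-step tri₁ h₁₂ h xy)
    ... | inj₂ h = linked⇒N ¬py (swap (linked-step tri₂ (∼-sym h₁₂) h xy))
      where
      swap : ∀ {A B : Set} → A ⊎ B → B ⊎ A
      swap (inj₁ a) = inj₂ a
      swap (inj₂ b) = inj₁ b

    -- Transitivity of nonadjacency on the neighbourhood of `v`, in contrapositive form. It rules
    -- out paws whose vertex of degree three is a twin of `v`, because the other three vertices are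
    -- then neighbours of `v`.
    N-split : ∀ {x y z} → N x → N y → N z → H ∋ x ∼ y → H ∋ x ∼ z ⊎ H ∋ y ∼ z
    N-split {x} {y} {z} nx ny nz xy with H ∋? x ∼ z
    ... | yes xz = inj₁ xz
    ... | no ¬xz = inj₂ (∼-sym (partner (N-linked nx) (N-linked nz)))
      where
      partner : H ∋ u₁ ∼ x ⊎ H ∋ u₂ ∼ x → H ∋ u₁ ∼ z ⊎ H ∋ u₂ ∼ z → H ∋ z ∼ y
      partner (inj₁ p) (inj₁ q) = same-part tri₁ p q ¬xz xy
      partner (inj₂ p) (inj₂ q) = same-part tri₂ p q ¬xz xy
      partner (inj₁ p) (inj₂ q) = same-part-linked tri₁ (∼-sym p) (∼-sym q) h₁₂ ¬xz xy
      partner (inj₂ p) (inj₁ q) = same-part-linked tri₂ (∼-sym p) (∼-sym q) (∼-sym h₁₂) ¬xz xy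

    -- Here `c` is a neighbour of `v`. The pendant vertex `d` is either a twin of `v`, and sees `b`,
    -- or a neighbour of `v` by `N-step`, and sees the twin `a`.
    spread : ∀ {a c d} → P a → ¬ P c → H₂ ∋ a ∼ c → H₂ ∋ c ∼ d →
             ∀ {b} → N b → H₂ ∋ a ∼ d ⊎ H₂ ∋ b ∼ d
    spread {d = d} pa ¬pc ac cd nb with P? d
    ... | yes pd = inj₂ (∼-sym (N⇒P pd nb))
    ... | no ¬pd = inj₁ (N⇒P pa (N-step (P⇒N pa ac) ¬pd (H₂⇒H ¬pc ¬pd cd)))

    solution : NoPaw H₂
    solution {a} {b} {c} {d} ab bc ac cd d≢a d≢b with P? c
    ... | yes pc = result (N-split na nb nd (H₂⇒H (N⇒¬P na) (N⇒¬P nb) ab))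
      where
      na = P⇒N pc (∼-sym ac)
      nb = P⇒N pc (∼-sym bc)
      nd = P⇒N pc cd
      result : H ∋ a ∼ d ⊎ H ∋ b ∼ d → H₂ ∋ a ∼ d ⊎ H₂ ∋ b ∼ d
      result (inj₁ h) = inj₁ (H⇒H₂ (N⇒¬P na) (N⇒¬P nd) h)
      result (inj₂ h) = inj₂ (H⇒H₂ (N⇒¬P nb) (N⇒¬P nd) h)
    ... | no ¬pc with P? a | P? b
    ...   | yes pa | _      = spread pa ¬pc ac cd (P⇒N pa ab)
    ...   | no _   | yes pb with spread pb ¬pc bc cd (P⇒N pb (∼-sym ab))
    ...     | inj₁ bd = inj₂ bd
    ...     | inj₂ ad = inj₁ ad
    solution {a} {b} {c} {d} ab bc ac cd d≢a d≢b | no ¬pc | no ¬pa | no ¬pb with P? d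
    ...   | yes pd = inj₁ (∼-sym (N⇒P pd (N-step (P⇒N pd (∼-sym cd)) ¬pa (∼-sym (H₂⇒H ¬pa ¬pc ac)))))
    ...   | no ¬pd with noPaw (H₂⇒H ¬pa ¬pb ab) (H₂⇒H ¬pb ¬pc bc) (H₂⇒H ¬pa ¬pc ac) (H₂⇒H ¬pc ¬pd cd) d≢a d≢b
    ...     | inj₁ ad = inj₁ (H⇒H₂ ¬pa ¬pd ad)
    ...     | inj₂ bd = inj₂ (H⇒H₂ ¬pb ¬pd bd)

  manyParts-sound : Sat (manyParts 0F) (v ∷ []) → Solvable E k
  manyParts-sound large₁ =
    let u₁ , (vu₁ , in₁ , large₂) , ¬t₁ = member (firstPart 1F 0F) {v ∷ []} large₁
        u₂ , (vu₂ , u₁u₂ , in₂ , cover , large₃) , ¬t₂ = member (secondPart 2F 1F 0F) {u₁ ∷ v ∷ []} large₂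
        u₃ , (vu₃ , u₁u₃ , u₂u₃) , _ = member (thirdPart 3F 2F 1F 0F) {u₂ ∷ u₁ ∷ v ∷ []} large₃
        open Parts vu₁ vu₂ vu₃ u₁u₂ u₁u₃ u₂u₃ in₁ in₂ cover ¬t₁ ¬t₂
        open Drop {A = A} P?
    in rest , ≤-trans ∣rest∣≤ ∣A∣≤k , solution

  module Harmless (crowded : ∀ p q → E ∋ v ∼ p → E ∋ v ∼ q → E ∋ p ∼ q →
                             ∃ λ w → (w ≢ v × E ∋ p ∼ w × E ∋ q ∼ w) × ¬ Touched A w)
                  (unreached : ∀ p → E ∋ v ∼ p → ¬ Sat (reaches 3 0F 1F) (v ∷ p ∷ [])) where

    open Majority normal
    open Forget E₀ A noPaw using (anchor-step)

    unsafe : ∀ {p} → InTriangle H p → ¬ Sat (safe 0F 1F) (v ∷ p ∷ [])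
    unsafe {p} tri large =
      let x , (px , large₂) , ¬tx = member (adjacent₀ 1F 2F 0F and many (separated 2F 3F 1F 0F)) {v ∷ p ∷ []} large
          y , (py , ¬xy , ¬twin) , ¬ty = member (separated 2F 3F 1F 0F) {x ∷ v ∷ p ∷ []} large₂
          hpx = ∼-sym (untouched⇒H ¬tx (∼-sym (isolate⁺ px)))
          hpy = ∼-sym (untouched⇒H ¬ty (∼-sym (isolate⁺ py)))
          ¬hxy = λ h → ¬xy (isolate⁻ {E = E} (untouched⇒E ¬tx h))
      in ¬twin λ z → (λ e → isolate⁻ {E = E} (untouched⇒E ¬ty (same-part tri hpx hpy ¬hxy (untouched⇒H ¬tx (isolate⁺ e)))))
                   , (λ e → isolate⁻ {E = E} (untouched⇒E ¬tx (same-part tri hpy hpx (¬hxy ∘ ∼-sym) (untouched⇒H ¬ty (isolate⁺ e)))))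

    -- An added side is anchored by normality, and anchors travel along edges; a triangle without
    -- added sides is itself a surviving one.
    triangle⇒anchored : ∀ {x} → InTriangle H x → Anchored E₀ A x
    triangle⇒anchored {x} (y , z , xy , yz , xz) with E₀ ∋? x ∼ y | E₀ ∋? y ∼ z | E₀ ∋? x ∼ z
    ... | no ¬e | _     | _     = Normal.anchored normal xy ¬e
    ... | yes _ | no ¬e | _     = anchor-step (Normal.anchored normal yz ¬e) (∼-sym xy)
    ... | yes _ | yes _ | no ¬e = Normal.anchored normal xz ¬e
    ... | yes e | yes f | yes g = y , x , z , (∼-sym e , ∼-sym xy) , (g , xz) , (f , yz) , xy

    step-triangle : ∀ {x y} → InTriangle H x → Step noPaw x y → InTriangle H y
    step-triangle tri (inj₁ refl)    = tri
    step-triangle tri (inj₂ (_ , h)) = triangle-step tri h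

    step-reaches : ∀ i {x y} → InTriangle H x → Step noPaw x y → Reaches i v y → Reaches (suc i) v x
    step-reaches i tri (inj₁ refl)    r = unsafe tri , inj₁ r
    step-reaches i tri (inj₂ (e , _)) r = unsafe tri , inj₂ (_ , isolate⁻ {E = E} e , r)

    triangle⇒reaches : ∀ {x} → InTriangle H x → Reaches 3 v x
    triangle⇒reaches {x} tri =
      let a , b , c , (eab , ab) , (ebc , bc) , (eac , ac) , xa = triangle⇒anchored tri
          tri-a = b , c , ab , bc , ac
          u , w , xu , uw , wa = short-walk noPaw tri xa
          tri-u = step-triangle tri xu
          tri-w = step-triangle tri-u uw
          start : Reaches 0 v a
          start = unsafe tri-a , b , unsafe (triangle-step tri-a ab) , isolate⁻ {E = E} eab , c ,
                  isolate⁻ {E = E} eac , isolate⁻ {E = E} ebc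
      in step-reaches 2 tri xu (step-reaches 1 tri-u uw (step-reaches 0 tri-w wa start))

    outside : ∀ {p} → E ∋ v ∼ p → ¬ InTriangle H p
    outside {p} vp tri = unreached p vp (reaches⁺ 3 {0F} {1F} {v ∷ p ∷ []} (triangle⇒reaches tri))

    -- Such an edge would put `p` into a triangle in either case: an added edge is anchored by
    -- normality, and an input edge has an untouched common neighbour of its ends.
    ¬triangle : ∀ {p q} → E ∋ v ∼ p → E ∋ v ∼ q → ¬ H ∋ p ∼ q
    ¬triangle {p} {q} vp vq pq with E ∋? p ∼ q
    ... | no ¬e = outside vp (let a , b , c , (_ , ab) , (_ , bc) , (_ , ac) , pa = Normal.anchored normal pq (¬e ∘ proj₁ ∘ isolate⁻)
                              in triangle-step (b , c , ab , bc , ac) (∼-sym pa))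
    ... | yes e =
      let w , (w≢v , pw , qw) , ¬tw = crowded p q vp vq e
          p≢v , q≢v = H⇒≢ pq
      in outside vp (q , w , pq , ∼-sym (untouchedE⇒H ¬tw (∼-sym qw) w≢v q≢v) , ∼-sym (untouchedE⇒H ¬tw (∼-sym pw) w≢v p≢v))

    -- With `v` as a corner of the triangle, the other two corners are neighbours of `v` joined in
    -- `H`; with `v` as the pendant vertex, its neighbour `c` lies in a triangle of `H`. Both are
    -- excluded.
    solution : NoPaw H⁺
    solution {a} {b} {c} {d} ab bc ac cd d≢a d≢b with a ≟ᶠ v | b ≟ᶠ v | c ≟ᶠ v
    ... | yes refl | _ | _ = contradiction (H⁺⇒H bc (∼⇒≢ (∼-sym ab)) (∼⇒≢ (∼-sym ac)))
                                           (¬triangle (untouched⇒E v-untouched ab) (untouched⇒E v-untouched ac))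
    ... | no _ | yes refl | _ = contradiction (H⁺⇒H ac (∼⇒≢ ab) (∼⇒≢ (∼-sym bc)))
                                              (¬triangle (untouched⇒E v-untouched (∼-sym ab)) (untouched⇒E v-untouched bc))
    ... | no _ | no _ | yes refl = contradiction (H⁺⇒H ab (∼⇒≢ ac) (∼⇒≢ bc))
                                                 (¬triangle (untouched⇒E v-untouched (∼-sym ac)) (untouched⇒E v-untouched (∼-sym bc)))
    ... | no a≢v | no b≢v | no c≢v with d ≟ᶠ v
    ...   | yes refl = contradiction (a , b , ∼-sym (H⁺⇒H ac a≢v c≢v) , H⁺⇒H ab a≢v b≢v , ∼-sym (H⁺⇒H bc b≢v c≢v))
                                     (outside (untouched⇒E v-untouched (∼-sym cd)))
    ...   | no d≢v with noPaw (H⁺⇒H ab a≢v b≢v) (H⁺⇒H bc b≢v c≢v) (H⁺⇒H ac a≢v c≢v) (H⁺⇒H cd c≢v d≢v) d≢a d≢b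
    ...     | inj₁ ad = inj₁ (H⇒H⁺ ad)
    ...     | inj₂ bd = inj₂ (H⇒H⁺ bd)

  harmless-sound : Sat (harmless 0F) (v ∷ []) → Solvable E k
  harmless-sound (crowded , unreached) = A , ∣A∣≤k , Harmless.solution
    (λ p q vp vq pq → member (common 3F 2F 1F 0F) {q ∷ p ∷ v ∷ []} (crowded p q vp vq pq))
    (λ p vp r → unreached p vp (reaches⁺ 3 {1F} {0F} {p ∷ v ∷ []} (reaches⁻ 3 {0F} {1F} {v ∷ p ∷ []} r)))

  deletable-sound : Sat (deletable 0F) (v ∷ []) → Solvable E k
  deletable-sound (_   , inj₁ t)               = manyTwins-sound t
  deletable-sound (_   , inj₂ (inj₁ p))        = manyParts-sound p
  deletable-sound (iso , inj₂ (inj₂ (inj₁ c))) = near-sound iso c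
  deletable-sound (_   , inj₂ (inj₂ (inj₂ h))) = harmless-sound h

isolate-sound : ∀ {n} {E : PairSet n} {v k} → Semantics.Sat E (threshold k) (deletable 0F) (v ∷ []) →
                Solvable (isolate v E) k → Solvable E k
isolate-sound {E = E} {v} del (A , ∣A∣≤k , noPaw) =
  let A′ , ≤A , noPaw′ , normal = normalise (isolate v E) A noPaw (<-wellFounded _)
  in Soundness.deletable-sound {E = E} (≤-trans ≤A ∣A∣≤k) noPaw′ normal del

isolate-complete : ∀ {n} {E : PairSet n} {v k} → Solvable E k → Solvable (isolate v E) k
isolate-complete {E = E} {v} (A , ∣A∣≤k , noPaw) = rest , ≤-trans ∣rest∣≤ ∣A∣≤k , NoPaw-restrict noPaw to from
  where
  open Drop {A = A} (_≟ᶠ v)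
  to : ∀ {x y} → (isolate v E ⊖ rest) ∋ x ∼ y → (E ⊖ A) ∋ x ∼ y × x ≢ v
  to h with ⊖-cases h
  ... | inj₁ (e , ¬r) = let e′ , x≢v , y≢v = isolate⁻ {E = E} e in ⊖-keep e′ (λ a → ¬r (rest⁺ a x≢v y≢v)) , x≢v
  ... | inj₂ (¬e , r) = let a , x≢v , y≢v = rest⁻ r in ⊖-add (λ e → ¬e (isolate⁺ (e , x≢v , y≢v))) a , x≢v
  from : ∀ {x y} → (E ⊖ A) ∋ x ∼ y → x ≢ v → y ≢ v → (isolate v E ⊖ rest) ∋ x ∼ y
  from h x≢v y≢v with ⊖-cases h
  ... | inj₁ (e , ¬a) = ⊖-keep (isolate⁺ (e , x≢v , y≢v)) (¬a ∘ proj₁ ∘ rest⁻)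
  ... | inj₂ (¬e , a) = ⊖-add (¬e ∘ proj₁ ∘ isolate⁻) (rest⁺ a x≢v y≢v)

-- Irreducible instances

module Irreducible {n} {E : PairSet n} {k : ℕ} {A : PairSet n} (∣A∣≤k : ∣ A ∣ ≤ k) (noPaw : NoPaw (E ⊖ A))
                   (irreducible : ∀ v → ¬ Semantics.Sat E (threshold k) (deletable 0F) (v ∷ [])) where

  open Semantics E (threshold k)
  open Reachability E (threshold k)
  open Multipartite noPaw

  private
    K = threshold k
    H = E ⊖ A

  S : Fin n → Set
  S = Touched A

  S? : Decidable S
  S? = touched? A

  ∣S∣≤2k : count S? ≤ k + k
  ∣S∣≤2k = ≤-trans (count-touched A) (+-mono-≤ ∣A∣≤k ∣A∣≤k)

  Twin : Fin n → Fin n → Set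
  Twin x y = Sat (twins 0F 1F) (x ∷ y ∷ [])

  few-twins : ∀ {x y} → E ∋ x ∼ y → count (λ u → sat? (otherTwin 1F 0F) (u ∷ x ∷ [])) < K
  few-twins {x} {y} e = ≰⇒> λ large → irreducible x ((y , e) , inj₁ large)

  twin-class≤ : {Q : Fin n → Set} (Q? : Decidable Q) → (∀ {x} → Q x → ∃ λ z → E ∋ x ∼ z) →
                (∀ {x y} → Q x → Q y → Twin x y) → count Q? ≤ K
  twin-class≤ Q? iso twin = count-pivot Q? λ x q → ≤-<-trans
    (count-mono (λ y → ¬? (y ≟ᶠ x) ×-dec Q? y) (λ u → sat? (otherTwin 1F 0F) (u ∷ x ∷ [])) (λ (y≢x , q′) → y≢x , twin q q′))
    (few-twins (proj₂ (iso q)))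

  -- A common neighbour confines the relation to one component. It is reflexive on the nonisolated
  -- vertices of `H`, which `inside-part` exploits.
  SamePart : Fin n → Fin n → Set
  SamePart x y = ¬ H ∋ x ∼ y × ∃ λ p → H ∋ p ∼ x × H ∋ p ∼ y

  samePart? : ∀ x y → Dec (SamePart x y)
  samePart? x y = ¬? (H ∋? x ∼ y) ×-dec any? λ p → H ∋? p ∼ x ×-dec H ∋? p ∼ y

  samePart-sym : ∀ {x y} → SamePart x y → SamePart y x
  samePart-sym (¬xy , p , px , py) = ¬xy ∘ ∼-sym , p , py , px

  samePart-nbr : ∀ {x y z} → InTriangle H x → SamePart x y → H ∋ x ∼ z → H ∋ y ∼ z
  samePart-nbr tri (¬xy , p , px , py) = same-part (triangle-step tri (∼-sym px)) px py ¬xy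

  samePart-triangle : ∀ {x y} → InTriangle H x → SamePart x y → InTriangle H y
  samePart-triangle tri (_ , p , px , py) = triangle-step (triangle-step tri (∼-sym px)) py

  samePart-twin : ∀ {s x y} → InTriangle H s → ¬ S x → ¬ S y → SamePart s x → SamePart s y → Twin x y
  samePart-twin {s} tri ¬sx ¬sy sx sy z =
    (λ e → untouched⇒E ¬sy (via sx sy (untouched⇒H ¬sx e))) , (λ e → untouched⇒E ¬sx (via sy sx (untouched⇒H ¬sy e)))
    where
    via : ∀ {x y} → SamePart s x → SamePart s y → H ∋ x ∼ z → H ∋ y ∼ z
    via p q h = samePart-nbr tri q (samePart-nbr (samePart-triangle tri p) (samePart-sym p) h)

  Part : Fin n → Fin n → Set
  Part s x = (InTriangle H s × ¬ S x) × SamePart s x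

  part? : ∀ s → Decidable (Part s)
  part? s x = (inTriangle? H s ×-dec ¬? (S? x)) ×-dec samePart? s x

  part≤ : ∀ s → count (part? s) ≤ K
  part≤ s = twin-class≤ (part? s)
    (λ ((_ , ¬sx) , _ , p , _ , px) → p , untouched⇒E ¬sx (∼-sym px))
    (λ ((tri , ¬sx) , x) ((_ , ¬sy) , y) → samePart-twin tri ¬sx ¬sy x y)

  -- The part of such a vertex contains no touched vertex at all, so all its members are twins of
  -- the vertex in the input; this is what `inside` asks for.
  Free : Fin n → Set
  Free x = (¬ S x × InTriangle H x) × (∀ s → S s → ¬ SamePart s x)

  free? : Decidable Free
  free? x = (¬? (S? x) ×-dec inTriangle? H x) ×-dec all? λ s → S? s →-dec ¬? (samePart? s x)

  module Crowd (s : Fin n) where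

    W : Fin n → Set
    W x = Free x × H ∋ s ∼ x

    W? : Decidable W
    W? x = free? x ×-dec H ∋? s ∼ x

    thin : {P : Fin n → Set} (P? : Decidable P) → (∀ {x} → P x → W x) → ∀ {x} → W x →
           count P? ≤ count (λ y → P? y ×-dec H ∋? x ∼ y) + K
    thin P? P⊆W {x} (((_ , tri) , _) , sx) = ≤-trans
      (count-∪ P? (λ y → P? y ×-dec H ∋? x ∼ y) (part? x) split)
      (+-monoʳ-≤ _ (part≤ x))
      where
      split : ∀ {y} → _ → (_ × H ∋ x ∼ y) ⊎ Part x y
      split {y} p with H ∋? x ∼ y
      ... | yes h = inj₁ (p , h)
      ... | no ¬h with P⊆W p
      ...   | ((¬sy , _) , _) , sy = inj₂ ((tri , ¬sy) , ¬h , s , sx , sy)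

    inside-part : ∀ {v a} → W v → W a → H ∋ v ∼ a → Sat (inside 0F 1F) (v ∷ a ∷ [])
    inside-part {v} {a} (((¬sv , tri) , avoids) , _) (((¬sa , _) , _) , _) va z az with H ∋? v ∼ z
    ... | yes vz = inj₁ (untouched⇒E ¬sv vz)
    ... | no ¬vz = inj₂ (samePart-twin tri ¬sv ¬sz (∼-irrefl , a , ∼-sym va , ∼-sym va) vz)
      where
      vz : SamePart v z
      vz = ¬vz , a , ∼-sym va , untouched⇒H ¬sa az
      ¬sz : ¬ S z
      ¬sz sz = avoids z sz (samePart-sym vz)

    -- Each vertex chosen discards only the candidates in its own part, at most `K` of them. Three
    -- choices, `v`, `a` and `b`, reduce `4 * K` to `K`, so every quantifier still finds its `K`
    -- witnesses.
    crowd : ∀ {v} → W v → 4 * K ≤ count W? → Sat (manyParts 0F) (v ∷ [])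
    crowd {v} wv@(((¬sv , tri) , _) , _) large = ≤-trans (m≤m+n K _) (≤-trans 3K≤ (count-mono P₁? (λ a → sat? (firstPart 1F 0F) (a ∷ v ∷ [])) first))
      where
      drop : ∀ r {m m′} → K + r ≤ m → m ≤ m′ + K → r ≤ m′
      drop r le le′ = +-cancelʳ-≤ K r _ (≤-trans (≤-reflexive (+-comm r K)) (≤-trans le le′))
      P₁? : Decidable λ a → W a × H ∋ v ∼ a
      P₁? a = W? a ×-dec H ∋? v ∼ a
      3K≤ : 3 * K ≤ count P₁?
      3K≤ = drop (3 * K) large (thin W? (λ w → w) wv)
      first : ∀ {a} → W a × H ∋ v ∼ a → Sat (firstPart 1F 0F) (a ∷ v ∷ [])
      first {a} (wa@(((¬sa , tri-a) , _) , _) , va) = untouched⇒E ¬sv va , inside-part wv wa va ,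
        ≤-trans (m≤m+n K _) (≤-trans 2K≤ (count-mono P₂? (λ b → sat? (secondPart 2F 1F 0F) (b ∷ a ∷ v ∷ [])) second))
        where
        P₂? : Decidable λ b → (W b × H ∋ v ∼ b) × H ∋ a ∼ b
        P₂? b = P₁? b ×-dec H ∋? a ∼ b
        2K≤ : 2 * K ≤ count P₂?
        2K≤ = drop (2 * K) 3K≤ (thin P₁? proj₁ wa)
        second : ∀ {b} → (W b × H ∋ v ∼ b) × H ∋ a ∼ b → Sat (secondPart 2F 1F 0F) (b ∷ a ∷ v ∷ [])
        second {b} ((wb@(((¬sb , _) , _) , _) , vb) , ab) =
          untouched⇒E ¬sv vb , untouched⇒E ¬sa ab , inside-part wv wb vb , cover ,
          ≤-trans (m≤m+n K _) (≤-trans (drop (1 * K) 2K≤ (thin P₂? (proj₁ ∘ proj₁) wb))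
            (count-mono P₃? (λ c → sat? (thirdPart 3F 2F 1F 0F) (c ∷ b ∷ a ∷ v ∷ [])) third))
          where
          P₃? : Decidable λ c → ((W c × H ∋ v ∼ c) × H ∋ a ∼ c) × H ∋ b ∼ c
          P₃? c = P₂? c ×-dec H ∋? b ∼ c
          third : ∀ {c} → ((W c × H ∋ v ∼ c) × H ∋ a ∼ c) × H ∋ b ∼ c → Sat (thirdPart 3F 2F 1F 0F) (c ∷ b ∷ a ∷ v ∷ [])
          third (((_ , vc) , ac) , bc) = untouched⇒E ¬sv vc , untouched⇒E ¬sa ac , untouched⇒E ¬sb bc
          cover : ∀ z → E ∋ v ∼ z → E ∋ a ∼ z ⊎ E ∋ b ∼ z
          cover z vz with H ∋? a ∼ z
          ... | yes az = inj₁ (untouched⇒E ¬sa az)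
          -- `a` and `z` share the neighbour `v` and hence a part, so the neighbour `b` of `a` sees
          -- `z`.
          ... | no ¬az = inj₂ (untouched⇒E ¬sb (∼-sym
            (samePart-nbr tri-a (¬az , v , va , untouched⇒H ¬sv vz) ab)))

    crowd≤ : count W? ≤ 4 * K
    crowd≤ with 4 * K ≤? count W?
    ... | no ¬large = <⇒≤ (≰⇒> ¬large)
    ... | yes large with count-inhabited W? (≤-trans (s≤s z≤n) large)
    ...   | v , wv@(((¬sv , _) , _) , sv) =
      contradiction ((s , untouched⇒E ¬sv (∼-sym sv)) , inj₂ (inj₁ (crowd wv large))) (irreducible v)

  -- A complete multipartite component of the solution that avoids S is a
  -- component of the input.
  module Apart {v} (¬sv : ¬ S v) (tri : InTriangle H v) (¬part : ∀ s → S s → ¬ SamePart s v)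
               (¬nbr : ∀ s → S s → ¬ H ∋ v ∼ s) where

    Near : Fin n → Set
    Near x = Sat (near 0F 1F) (v ∷ x ∷ [])

    near-cases : ∀ {x} → Near x → H ∋ v ∼ x ⊎ SamePart v x
    near-cases (inj₁ e) = inj₁ (untouched⇒H ¬sv e)
    near-cases {x} (inj₂ (w , vw , wx)) with H ∋? v ∼ x
    ... | yes h = inj₁ h
    ... | no ¬h = inj₂ (¬h , w , ∼-sym hvw , untouched⇒H (λ sw → ¬nbr w sw hvw) wx)
      where hvw = untouched⇒H ¬sv vw

    near-untouched : ∀ {x} → Near x → ¬ S x
    near-untouched {x} q sx with near-cases q
    ... | inj₁ h = ¬nbr x sx h
    ... | inj₂ p = ¬part x sx (samePart-sym p)

    near-step : ∀ {x y} → Near x → H ∋ x ∼ y → Near y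
    near-step {x} q xy with near-cases q
    ... | inj₁ vx = inj₂ (x , untouched⇒E ¬sv vx , untouched⇒E (near-untouched q) xy)
    ... | inj₂ p  = inj₁ (untouched⇒E ¬sv (samePart-nbr (samePart-triangle tri p) (samePart-sym p) xy))

    closed : Sat (nearClosed 0F) (v ∷ [])
    closed x y q e = near-step q (untouched⇒H (near-untouched q) e)

    pawFree : Sat (nearPawFree 0F) (v ∷ [])
    pawFree a b c d q ab bc ac cd d≢a d≢b = result
      (noPaw (untouched⇒H ¬sa ab) (∼-sym cb) (∼-sym ca) (untouched⇒H ¬sc cd) d≢a d≢b)
      where
      ¬sc = near-untouched q
      ca  = untouched⇒H ¬sc (∼-sym ac)
      cb  = untouched⇒H ¬sc (∼-sym bc)
      ¬sa = near-untouched (near-step q ca)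
      ¬sb = near-untouched (near-step q cb)
      result : H ∋ a ∼ d ⊎ H ∋ b ∼ d → E ∋ a ∼ d ⊎ E ∋ b ∼ d
      result (inj₁ h) = inj₁ (untouched⇒E ¬sa h)
      result (inj₂ h) = inj₂ (untouched⇒E ¬sb h)

    absurd : ⊥
    absurd = irreducible v ((proj₁ tri , untouched⇒E ¬sv (proj₁ (proj₂ (proj₂ tri)))) ,
                            inj₂ (inj₂ (inj₁ (closed , pawFree))))

  -- For a deleted edge `pq`, these are the common neighbours at which the first clause of
  -- `harmless` fails. Each of them has all the others among its few further common neighbours of
  -- `p` and `q`, whence `thin≤`.
  Thin : Fin n → Fin n → Fin n → Set
  Thin p q x = (E ∋ x ∼ p × E ∋ x ∼ q) × ¬ Sat (many (common 3F 2F 1F 0F)) (q ∷ p ∷ x ∷ [])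

  thin? : ∀ p q → Decidable (Thin p q)
  thin? p q x = (E ∋? x ∼ p ×-dec E ∋? x ∼ q) ×-dec ¬? (sat? (many (common 3F 2F 1F 0F)) (q ∷ p ∷ x ∷ []))

  thin≤ : ∀ p q → count (thin? p q) ≤ K
  thin≤ p q = count-pivot (thin? p q) λ x (_ , few) → ≤-<-trans
    (count-mono (λ y → ¬? (y ≟ᶠ x) ×-dec thin? p q y) (λ y → sat? (common 3F 2F 1F 0F) (y ∷ q ∷ p ∷ x ∷ []))
      (λ (y≢x , (yp , yq) , _) → y≢x , ∼-sym yp , ∼-sym yq))
    (≰⇒> few)

  Low : Fin n → Set
  Low p = deg H p < 4 * K

  -- Of `4 * K` neighbours in `H`, at most `K` are touched or equal to `v`. The remaining `3 * K`
  -- are pairwise nonadjacent in the input, since `p` is in no triangle of `H`, and at most `2 * K`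
  -- of them are `twins₀` of a given one. Each is thus separated from at least `K` others, which
  -- makes `p` safe.
  unsafe⇒low : ∀ {v p} → p ≢ v → ¬ InTriangle H p → Exposed v p → Low p
  unsafe⇒low {v} {p} p≢v ¬tri unsafe = ≰⇒> λ large → unsafe (≤-trans (m≤m+n K _)
    (≤-trans (3K≤ large) (count-mono W? (λ x → sat? (adjacent₀ 1F 2F 0F and many (separated 2F 3F 1F 0F)) (x ∷ v ∷ p ∷ []))
      λ w → nbr w , spread (3K≤ large) w)))
    where
    W : Fin n → Set
    W x = H ∋ p ∼ x × ¬ S x × x ≢ v
    W? : Decidable W
    W? x = H ∋? p ∼ x ×-dec ¬? (S? x) ×-dec ¬? (x ≟ᶠ v)
    nbr : ∀ {x} → W x → Adjacent₀ v p x
    nbr (px , ¬sx , x≢v) = ∼-sym (untouched⇒E ¬sx (∼-sym px)) , p≢v , x≢v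
    nearly : deg H p ≤ K + count W?
    nearly = ≤-trans (count-∪ (H ∋? p ∼_) (λ x → S? x ⊎-dec x ≟ᶠ v) W? split)
      (+-monoˡ-≤ (count W?) (≤-trans (count-∪ (λ x → S? x ⊎-dec x ≟ᶠ v) S? (_≟ᶠ v) (λ z → z))
        (≤-trans (+-mono-≤ ∣S∣≤2k (≤-reflexive (count-singleton v))) (≤-reflexive (+-comm (k + k) 1)))))
      where
      split : ∀ {x} → H ∋ p ∼ x → (S x ⊎ x ≡ v) ⊎ W x
      split {x} h with S? x | x ≟ᶠ v
      ... | yes s | _      = inj₁ (inj₁ s)
      ... | no _  | yes eq = inj₁ (inj₂ eq)
      ... | no ¬s | no ≢v  = inj₂ (h , ¬s , ≢v)
    3K≤ : 4 * K ≤ deg H p → 3 * K ≤ count W?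
    3K≤ large = +-cancelˡ-≤ K _ _ (≤-trans large nearly)
    TwinOf : Fin n → Fin n → Set
    TwinOf x y = W y × Sat (twins₀ 0F 1F 2F) (v ∷ x ∷ y ∷ [])
    twinOf? : ∀ x → Decidable (TwinOf x)
    twinOf? x y = W? y ×-dec sat? (twins₀ 0F 1F 2F) (v ∷ x ∷ y ∷ [])
    twinOf : ∀ {x y y′} → TwinOf x y → TwinOf x y′ → (E ∋ y ∼ v → E ∋ y′ ∼ v) → ∀ z → E ∋ y ∼ z → E ∋ y′ ∼ z
    twinOf ((_ , _ , y≢v) , t) (_ , t′) via z e with z ≟ᶠ v
    ... | yes refl = via e
    ... | no z≢v   = proj₁ (proj₁ (t′ z) (proj₂ (t z) (e , y≢v , z≢v)))
    iso : ∀ {x y} → TwinOf x y → ∃ λ z → E ∋ y ∼ z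
    iso ((py , ¬sy , _) , _) = p , untouched⇒E ¬sy (∼-sym py)
    -- `twins₀` ignores `v`, so agreement about `v` splits these vertices into two classes of
    -- genuine twins.
    twins≤ : ∀ x → count (twinOf? x) ≤ K + K
    twins≤ x = ≤-trans (count-∪ (twinOf? x) (λ y → twinOf? x y ×-dec E ∋? y ∼ v) (λ y → twinOf? x y ×-dec ¬? (E ∋? y ∼ v)) split)
      (+-mono-≤
        (twin-class≤ (λ y → twinOf? x y ×-dec E ∋? y ∼ v) (iso ∘ proj₁)
          (λ (t , e) (t′ , e′) z → twinOf t t′ (λ _ → e′) z , twinOf t′ t (λ _ → e) z))
        (twin-class≤ (λ y → twinOf? x y ×-dec ¬? (E ∋? y ∼ v)) (iso ∘ proj₁)
          (λ (t , ¬e) (t′ , ¬e′) z → twinOf t t′ (λ e → contradiction e ¬e) z , twinOf t′ t (λ e′ → contradiction e′ ¬e′) z)))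
      where
      split : ∀ {y} → TwinOf x y → (TwinOf x y × E ∋ y ∼ v) ⊎ (TwinOf x y × ¬ E ∋ y ∼ v)
      split {y} t with E ∋? y ∼ v
      ... | yes e = inj₁ (t , e)
      ... | no ¬e = inj₂ (t , ¬e)
    spread : 3 * K ≤ count W? → ∀ {x} → W x → Sat (many (separated 2F 3F 1F 0F)) (x ∷ v ∷ p ∷ [])
    spread large {x} (px , ¬sx , _) = +-cancelʳ-≤ (K + K) K _ (≤-trans (≤-reflexive (three K)) (≤-trans large
      (≤-trans (count-∪ W? (λ y → sat? (separated 2F 3F 1F 0F) (y ∷ x ∷ v ∷ p ∷ [])) (twinOf? x) split)
               (+-monoʳ-≤ _ (twins≤ x)))))
      where
      three : ∀ m → m + (m + m) ≡ 3 * m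
      three = solve-∀
      split : ∀ {y} → W y → Sat (separated 2F 3F 1F 0F) (y ∷ x ∷ v ∷ p ∷ []) ⊎ TwinOf x y
      split {y} wy with sat? (twins₀ 0F 1F 2F) (v ∷ x ∷ y ∷ [])
      ... | yes t = inj₂ (wy , t)
      ... | no ¬t = inj₁ (nbr wy , (λ (xy , _) → ¬tri (x , y , px , untouched⇒H ¬sx xy , proj₁ wy)) , ¬t)

  Hop : Fin n → Fin n → Set
  Hop p x = x ≡ p ⊎ Low p × H ∋ p ∼ x

  hop? : ∀ p → Decidable (Hop p)
  hop? p x = x ≟ᶠ p ⊎-dec (deg H p <? 4 * K) ×-dec H ∋? p ∼ x

  hop≤ : ∀ p → count (hop? p) ≤ 4 * K
  hop≤ p with deg H p <? 4 * K in low
  -- `Low` is a strict bound, which leaves room for `p` itself.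
  ... | yes lt = ≤-trans (count-∪ (hop? p) (_≟ᶠ p) (H ∋? p ∼_) (λ { (inj₁ eq) → inj₁ eq ; (inj₂ (_ , h)) → inj₂ h }))
                         (≤-trans (+-monoˡ-≤ (deg H p) (≤-reflexive (count-singleton p))) lt)
  ... | no ¬lt = ≤-trans (count-mono (hop? p) (_≟ᶠ p) (λ { (inj₁ eq) → eq ; (inj₂ (lt , _)) → contradiction lt ¬lt }))
                         (≤-trans (≤-reflexive (count-singleton p)) (s≤s z≤n))

  Ball : ℕ → Fin n → Set
  Ball zero    x = S x
  Ball (suc i) x = ∃ λ p → Ball i p × Hop p x

  ball? : ∀ i → Decidable (Ball i)
  ball? zero    x = S? x
  ball? (suc i) x = any? λ p → ball? i p ×-dec hop? p x

  ball≤ : ∀ i → count (ball? i) ≤ (k + k) * (4 * K) ^ i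
  ball≤ zero    = ≤-trans ∣S∣≤2k (≤-reflexive (sym (*-identityʳ (k + k))))
  ball≤ (suc i) = ≤-trans (count-⋃ (ball? (suc i)) (ball? i) hop? (λ p _ → hop≤ p) (λ b → b))
    (≤-trans (*-monoˡ-≤ (4 * K) (ball≤ i)) (≤-reflexive (shift (k + k) ((4 * K) ^ i) (4 * K))))
    where
    shift : ∀ a b c → a * b * c ≡ a * (c * b)
    shift = solve-∀

  ball-centre : ∀ i {x} → S x → Ball i x
  ball-centre zero    s = s
  ball-centre (suc i) s = _ , ball-centre i s , inj₁ refl

  reaches-unsafe : ∀ i {v p} → Reaches i v p → Exposed v p
  reaches-unsafe zero    = proj₁
  reaches-unsafe (suc i) = proj₁

  -- Touched vertices lie in every ball. At level zero the input triangle `p q t` cannot survive,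
  -- and the edges at the untouched `p` do, so `qt` was deleted and `q` is touched. Being unsafe,
  -- `q` is low, and `p` is one hop away; for this hop `reaches` requires `q` to be unsafe too. Each
  -- further step of the walk is again a hop through an unsafe, hence low, vertex.
  reaches-ball : ∀ i {v p} → p ≢ v → ¬ InTriangle H p → Reaches i v p → Ball (suc i) p
  reaches-ball i {v} {p} p≢v ¬tri r with S? p
  ... | yes s = ball-centre (suc i) s
  reaches-ball zero {v} {p} p≢v ¬tri (_ , q , unsafe , (pq , _ , q≢v) , t , (pt , _) , (qt , _)) | no ¬s =
    q , (t , ⊖-deleted qt λ h → ¬tri (q , t , hpq , h , untouched⇒H ¬s pt)) ,
    inj₂ (unsafe⇒low q≢v (λ tri → ¬tri (triangle-step tri (∼-sym hpq))) unsafe , ∼-sym hpq)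
    where hpq = untouched⇒H ¬s pq
  reaches-ball (suc i) p≢v ¬tri (_ , inj₁ r) | no ¬s = _ , reaches-ball i p≢v ¬tri r , inj₁ refl
  reaches-ball (suc i) {v} {p} p≢v ¬tri (_ , inj₂ (q , (pq , _ , q≢v) , r)) | no ¬s =
    q , reaches-ball i q≢v ¬tri-q r , inj₂ (unsafe⇒low q≢v ¬tri-q (reaches-unsafe i r) , ∼-sym hpq)
    where
    hpq = untouched⇒H ¬s pq
    ¬tri-q : ¬ InTriangle H q
    ¬tri-q tri = ¬tri (triangle-step tri (∼-sym hpq))

  AlongPart AlongCrowd AlongEdge : Fin n → Set
  AlongPart  x = ∃ λ s → S s × Part s x
  AlongCrowd x = ∃ λ s → S s × Crowd.W s x
  AlongEdge  x = ∃ λ p → S p × ∃ λ q → S q × Thin p q x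

  alongPart? : Decidable AlongPart
  alongPart? x = any? λ s → S? s ×-dec part? s x

  alongCrowd? : Decidable AlongCrowd
  alongCrowd? x = any? λ s → S? s ×-dec Crowd.W? s x

  alongEdge? : Decidable AlongEdge
  alongEdge? x = any? λ p → S? p ×-dec any? λ q → S? q ×-dec thin? p q x

  alive? : Decidable λ v → Sat (nonisolated 0F) (v ∷ [])
  alive? v = sat? (nonisolated 0F) (v ∷ [])

  classify : ∀ {v} → Sat (nonisolated 0F) (v ∷ []) → S v ⊎ AlongPart v ⊎ AlongCrowd v ⊎ AlongEdge v ⊎ Ball 5 v
  classify {v} iso with S? v
  ... | yes s = inj₁ s
  ... | no ¬s with inTriangle? H v
  ...   | yes tri with alongPart? v | alongCrowd? v
  ...     | yes a | _     = inj₂ (inj₁ a)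
  ...     | no _  | yes a = inj₂ (inj₂ (inj₁ a))
  ...     | no ¬a | no ¬c = ⊥-elim (Apart.absurd ¬s tri ¬part λ s ts vs →
                              ¬c (s , ts , ((¬s , tri) , ¬part) , ∼-sym vs))
    where
    ¬part : ∀ s → S s → ¬ SamePart s v
    ¬part s ts p = ¬a (s , ts , (samePart-triangle tri (samePart-sym p) , ¬s) , p)
  classify {v} iso | no ¬s | no ¬tri with alongEdge? v | ball? 5 v
  ...     | yes a | _     = inj₂ (inj₂ (inj₂ (inj₁ a)))
  ...     | no _  | yes b = inj₂ (inj₂ (inj₂ (inj₂ b)))
  ...     | no ¬a | no ¬b = contradiction (iso , inj₂ (inj₂ (inj₂ (crowded , unreached)))) (irreducible v)
    where
    crowded : ∀ p q → E ∋ v ∼ p → E ∋ v ∼ q → E ∋ p ∼ q → Sat (many (common 3F 2F 1F 0F)) (q ∷ p ∷ v ∷ [])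
    crowded p q vp vq pq = decidable-stable (sat? (many (common 3F 2F 1F 0F)) (q ∷ p ∷ v ∷ [])) λ few →
      let a = ⊖-deleted pq λ h → ¬tri (p , q , untouched⇒H ¬s vp , h , untouched⇒H ¬s vq)
      in ¬a (p , (q , a) , q , (p , ∼-sym a) , (vp , vq) , few)
    unreached : ∀ p → E ∋ v ∼ p → ¬ Sat (reaches 3 1F 0F) (p ∷ v ∷ [])
    -- `reaches-ball 3` places `p` in `Ball 4`; the hop from the low vertex `p` to `v` makes it
    -- five.
    unreached p vp sat = ¬b (p , reaches-ball 3 p≢v ¬tri-p r , inj₂ (unsafe⇒low p≢v ¬tri-p (reaches-unsafe 3 r) , ∼-sym hvp))
      where
      hvp = untouched⇒H ¬s vp
      p≢v = ∼⇒≢ (∼-sym vp)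
      r : Reaches 3 v p
      r = reaches⁻ 3 {1F} {0F} {p ∷ v ∷ []} sat
      ¬tri-p : ¬ InTriangle H p
      ¬tri-p tri = ¬tri (triangle-step tri (∼-sym hvp))

  alive≤ : count alive? ≤ (k + k) + ((k + k) * K + ((k + k) * (4 * K) + ((k + k) * ((k + k) * K) + (k + k) * (4 * K) ^ 5)))
  alive≤ =
    count-∪ alive? S? rest₁? classify ⟨ ≤-trans ⟩ +-mono-≤ ∣S∣≤2k (
    count-∪ rest₁? alongPart? rest₂? (λ z → z) ⟨ ≤-trans ⟩ +-mono-≤
      (count-⋃ alongPart? S? part? (λ s _ → part≤ s) (λ z → z) ⟨ ≤-trans ⟩ *-monoˡ-≤ K ∣S∣≤2k) (
    count-∪ rest₂? alongCrowd? rest₃? (λ z → z) ⟨ ≤-trans ⟩ +-mono-≤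
      (count-⋃ alongCrowd? S? Crowd.W? (λ s _ → Crowd.crowd≤ s) (λ z → z) ⟨ ≤-trans ⟩ *-monoˡ-≤ (4 * K) ∣S∣≤2k) (
    count-∪ rest₃? alongEdge? (ball? 5) (λ z → z) ⟨ ≤-trans ⟩ +-mono-≤
      (count-⋃ alongEdge? S? edge? (λ p _ →
         count-⋃ (edge? p) S? (thin? p) (λ q _ → thin≤ p q) (λ z → z) ⟨ ≤-trans ⟩ *-monoˡ-≤ K ∣S∣≤2k) (λ z → z)
       ⟨ ≤-trans ⟩ *-monoˡ-≤ ((k + k) * K) ∣S∣≤2k)
      (ball≤ 5))))
    where
    edge? : ∀ p → Decidable λ x → ∃ λ q → S q × Thin p q x
    edge? p x = any? λ q → S? q ×-dec thin? p q x
    rest₃? : Decidable λ x → AlongEdge x ⊎ Ball 5 x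
    rest₃? x = alongEdge? x ⊎-dec ball? 5 x
    rest₂? : Decidable λ x → AlongCrowd x ⊎ AlongEdge x ⊎ Ball 5 x
    rest₂? x = alongCrowd? x ⊎-dec rest₃? x
    rest₁? : Decidable λ x → AlongPart x ⊎ AlongCrowd x ⊎ AlongEdge x ⊎ Ball 5 x
    rest₁? x = alongPart? x ⊎-dec rest₂? x

-- Half of it, `8 * suc k`, dominates `4 * threshold k`; the last doubling pays, in the sixth power,
-- for adding five terms. It is written with doublings because programs have addition as a primitive
-- but not multiplication.
side : ℕ → ℕ
side k = 2 * (2 * (2 * (2 * suc k)))

^-distribʳ-* : ∀ i m n → (m * n) ^ i ≡ m ^ i * n ^ i
^-distribʳ-* zero    m n = refl
^-distribʳ-* (suc i) m n = trans (cong (m * n *_) (^-distribʳ-* i m n)) (interchange m n (m ^ i) (n ^ i))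
  where
  interchange : ∀ a b c d → a * b * (c * d) ≡ a * c * (b * d)
  interchange = solve-∀

-- With d = side k / 2 every one of the five terms is at most d ^ 6.
five-terms : ∀ k → (k + k) + ((k + k) * threshold k + ((k + k) * (4 * threshold k) +
               ((k + k) * ((k + k) * threshold k) + (k + k) * (4 * threshold k) ^ 5))) ≤ side k ^ 6
five-terms k = begin
  s + (s * t + (s * u + (s * (s * t) + s * u ^ 5)))
    ≤⟨ +-mono-≤ s≤d (+-mono-≤ (*-mono-≤ s≤d t≤d) (+-mono-≤ (*-mono-≤ s≤d u≤d)
       (+-mono-≤ (*-mono-≤ s≤d (*-mono-≤ s≤d t≤d)) (*-mono-≤ s≤d (^-monoˡ-≤ 5 u≤d))))) ⟩
  d + (d * d + (d * d + (d * (d * d) + d ^ 6)))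
    ≤⟨ +-mono-≤ (power 1 d≡) (+-mono-≤ (power 2 dd≡) (+-mono-≤ (power 2 dd≡) (+-mono-≤ (power 3 ddd≡) ≤-refl))) ⟩
  d ^ 6 + (d ^ 6 + (d ^ 6 + (d ^ 6 + d ^ 6)))
    ≤⟨ m≤m+n _ (59 * d ^ 6) ⟩
  d ^ 6 + (d ^ 6 + (d ^ 6 + (d ^ 6 + d ^ 6))) + 59 * d ^ 6
    ≡⟨ sixty-four (d ^ 6) ⟩
  2 ^ 6 * d ^ 6
    ≡⟨ sym (^-distribʳ-* 6 2 d) ⟩
  (2 * d) ^ 6 ∎
  where
  open ≤-Reasoning
  s t u d : ℕ
  s = k + k
  t = threshold k
  u = 4 * t
  d = 2 * (2 * (2 * suc k))
  sixty-four : ∀ m → m + (m + (m + (m + m))) + 59 * m ≡ 64 * m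
  sixty-four = solve-∀
  u≤d : u ≤ d
  u≤d = ≤-trans (m≤m+n u 4) (≤-reflexive (identity k))
    where
    identity : ∀ k → 4 * suc (k + k) + 4 ≡ 2 * (2 * (2 * suc k))
    identity = solve-∀
  t≤d : t ≤ d
  t≤d = ≤-trans (m≤m+n t _) u≤d
  s≤d : s ≤ d
  s≤d = ≤-trans (n≤1+n s) t≤d
  d≡ : d ≡ d ^ 1
  d≡ = sym (*-identityʳ d)
  dd≡ : d * d ≡ d ^ 2
  dd≡ = cong (d *_) d≡
  ddd≡ : d * (d * d) ≡ d ^ 3
  ddd≡ = cong (d *_) dd≡
  power : ∀ i {m} {i≤6 : T (i ≤ᵇ 6)} → m ≡ d ^ i → m ≤ d ^ 6
  power i {i≤6 = i≤6} refl = ^-monoʳ-≤ d (≤ᵇ⇒≤ i 6 i≤6)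

irreducible-order : ∀ {n} {E : PairSet n} {k} → (∀ v → ¬ Semantics.Sat E (threshold k) (deletable 0F) (v ∷ [])) →
                    Solvable E k → count (λ v → Semantics.sat? E (threshold k) (nonisolated 0F) (v ∷ [])) ≤ side k ^ 6
irreducible-order {k = k} irreducible (A , ∣A∣≤k , noPaw) =
  ≤-trans (Irreducible.alive≤ ∣A∣≤k noPaw irreducible) (five-terms k)

-- The kernel

lookup-injective : ∀ {B : Set} {xs : List B} → Unique xs → ∀ {i j} → List.lookup xs i ≡ List.lookup xs j → i ≡ j
lookup-injective (_ AllPairs.∷ _)  {zero}  {zero}  _  = refl
lookup-injective (_ AllPairs.∷ u)  {suc i} {suc j} eq = cong suc (lookup-injective u eq)
lookup-injective (x∉ AllPairs.∷ _) {zero}  {suc j} eq = contradiction eq (All.lookup x∉ (∈-lookup j))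
lookup-injective (x∉ AllPairs.∷ _) {suc i} {zero}  eq = contradiction (sym eq) (All.lookup x∉ (∈-lookup i))

module _ {m n} (φ : Fin m → Fin n) (f : Fin n → ℕ) where

  private
    fibre : Fin n → ℕ
    fibre x = count λ i → φ i ≟ᶠ x

  -- This reduces comparisons of sums along `φ` to fibre sizes: at most one for an injection, at
  -- least one on the support of `f` for a cover.
  sum-fibres : sum (λ x → fibre x * f x) ≡ sum (f ∘ φ)
  sum-fibres = begin
    sum (λ x → fibre x * f x)                                 ≡⟨ sum-cong-≗ (λ x → *-distribʳ-sum (f x) (λ i → bit (does (φ i ≟ᶠ x)))) ⟩
    sum (λ x → sum λ i → bit (does (φ i ≟ᶠ x)) * f x)         ≡⟨ ∑-comm (λ x i → bit (does (φ i ≟ᶠ x)) * f x) ⟩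
    sum (λ i → sum λ x → bit (does (φ i ≟ᶠ x)) * f x)         ≡⟨ sum-cong-≗ term ⟩
    sum (f ∘ φ)                                               ∎
    where
    open ≡-Reasoning
    term : ∀ i → sum (λ x → bit (does (φ i ≟ᶠ x)) * f x) ≡ f (φ i)
    term i = trans (sum-single (φ i) λ x x≢ → cong (_* f x) (bit-no (φ i ≟ᶠ x) (x≢ ∘ sym)))
                 (trans (cong (_* f (φ i)) (bit-yes (φ i ≟ᶠ φ i) refl)) (+-identityʳ _))

  sum-injection : (∀ {i j} → φ i ≡ φ j → i ≡ j) → sum (f ∘ φ) ≤ sum f
  sum-injection inj = ≤-trans (≤-reflexive (sym sum-fibres)) (sum-mono λ x →
    ≤-trans (*-monoˡ-≤ (f x) (fibre≤1 x)) (≤-reflexive (+-identityʳ (f x))))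
    where
    fibre≤1 : ∀ x → fibre x ≤ 1
    fibre≤1 x = count-pivot (λ i → φ i ≟ᶠ x) λ i p → s≤s (≤-reflexive (sum-zero λ j →
      bit-no (¬? (j ≟ᶠ i) ×-dec φ j ≟ᶠ x) λ (j≢i , q) → j≢i (inj (trans q (sym p)))))

  sum-cover : (∀ {x} → 0 < f x → ∃ λ i → φ i ≡ x) → sum f ≤ sum (f ∘ φ)
  sum-cover cover = ≤-trans (sum-mono bound) (≤-reflexive sum-fibres)
    where
    bound : ∀ x → f x ≤ fibre x * f x
    bound x with f x in eq
    ... | zero  = z≤n
    ... | suc m with cover {x} (subst (0 <_) (sym eq) z<s)
    ...   | i , p = ≤-trans (≤-reflexive (sym (+-identityʳ (suc m))))
      (*-monoˡ-≤ (suc m) (≤-trans (≤-reflexive (sym (bit-yes (φ i ≟ᶠ x) p))) (f≤sum (λ i → bit (does (φ i ≟ᶠ x))) i)))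

restrict : ∀ {m n} (φ : Fin m → Fin n) → PairSet n → PairSet m
restrict φ E = record
  { has    = λ i j → has E (φ i) (φ j)
  ; sym    = λ i j → PairSet.sym E (φ i) (φ j)
  ; irrefl = λ i → PairSet.irrefl E (φ i)
  }

restrict⁻ : ∀ {m n} {φ : Fin m → Fin n} {E} {i j} → restrict φ E ∋ i ∼ j → E ∋ φ i ∼ φ j
restrict⁻ (edge e) = edge e

restrict⁺ : ∀ {m n} {φ : Fin m → Fin n} {E} {i j} → E ∋ φ i ∼ φ j → restrict φ E ∋ i ∼ j
restrict⁺ (edge e) = edge e

module _ {m n} {φ : Fin m → Fin n} (inj : ∀ {i j} → φ i ≡ φ j → i ≡ j) {E : PairSet n} where

  restrict-solvable : ∀ {k} → Solvable E k → Solvable (restrict φ E) k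
  restrict-solvable (A , ∣A∣≤k , noPaw) = restrict φ A , ≤-trans fewer ∣A∣≤k , noPaw′
    where
    fewer : ∣ restrict φ A ∣ ≤ ∣ A ∣
    fewer = ∣∣-mono-vol {A = restrict φ A} {A} (≤-trans
      (sum-mono λ i → sum-injection φ (λ y → bit (has A (φ i) y)) inj)
      (sum-injection φ (deg A) inj))
    up : ∀ {i j} → (restrict φ E ⊖ restrict φ A) ∋ i ∼ j → (E ⊖ A) ∋ φ i ∼ φ j
    up (edge h) = edge h
    noPaw′ : NoPaw (restrict φ E ⊖ restrict φ A)
    noPaw′ ab bc ac cd d≢a d≢b with noPaw (up ab) (up bc) (up ac) (up cd) (d≢a ∘ inj) (d≢b ∘ inj)
    ... | inj₁ (edge h) = inj₁ (edge h)
    ... | inj₂ (edge h) = inj₂ (edge h)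

  module Extend (cover : ∀ {x y} → E ∋ x ∼ y → ∃ λ i → φ i ≡ x) (B : PairSet m) where

    R : Fin n → Fin n → Set
    R x y = ∃ λ i → ∃ λ j → φ i ≡ x × φ j ≡ y × B ∋ i ∼ j

    R? : ∀ x y → Dec (R x y)
    R? x y = any? λ i → any? λ j → φ i ≟ᶠ x ×-dec φ j ≟ᶠ y ×-dec B ∋? i ∼ j

    R-sym : ∀ {x y} → R x y → R y x
    R-sym (i , j , p , q , b) = j , i , q , p , ∼-sym b

    R-irrefl : ∀ {x} → ¬ R x x
    R-irrefl (i , j , p , q , b) = ∼⇒≢ b (inj (trans p (sym q)))

    A : PairSet n
    A = pairs R? R-sym R-irrefl

    A⁺ : ∀ {i j} → B ∋ i ∼ j → A ∋ φ i ∼ φ j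
    A⁺ b = pairs⁺ R? R-sym R-irrefl (_ , _ , refl , refl , b)

    A⁻ : ∀ {i j} → A ∋ φ i ∼ φ j → B ∋ i ∼ j
    A⁻ a with pairs⁻ R? R-sym R-irrefl a
    ... | i , j , p , q , b = subst₂ (B ∋_∼_) (inj p) (inj q) b

    A-cover : ∀ {x y} → A ∋ x ∼ y → ∃ λ i → φ i ≡ x
    A-cover a with pairs⁻ R? R-sym R-irrefl a
    ... | i , _ , p , _ = i , p

    positive : ∀ {x y} → 0 < bit (has A x y) → A ∋ x ∼ y
    positive {x} {y} lt with A ∋? x ∼ y
    ... | yes a = a
    ... | no ¬a = contradiction (bit-no (A ∋? x ∼ y) ¬a) (>⇒≢ lt)

    ∣A∣≤∣B∣ : ∣ A ∣ ≤ ∣ B ∣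
    ∣A∣≤∣B∣ = ∣∣-mono-vol {A = A} {B} (≤-trans
      (sum-cover φ (deg A) λ {x} lt → A-cover (proj₂ (count-inhabited (A ∋? x ∼_) lt)))
      (sum-mono λ i → ≤-trans
        (sum-cover φ (λ y → bit (has A (φ i) y)) λ lt → A-cover (∼-sym (positive lt)))
        (sum-mono λ j → bit-mono (A ∋? φ i ∼ φ j) (B ∋? i ∼ j) A⁻)))

    H-cover : ∀ {x y} → (E ⊖ A) ∋ x ∼ y → ∃ λ i → φ i ≡ x
    H-cover h with ⊖-cases h
    ... | inj₁ (e , _) = cover e
    ... | inj₂ (_ , a) = A-cover a

    down : ∀ {i j} → (E ⊖ A) ∋ φ i ∼ φ j → (restrict φ E ⊖ B) ∋ i ∼ j
    down h with ⊖-cases h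
    ... | inj₁ (e , ¬a) = ⊖-keep (restrict⁺ e) (¬a ∘ A⁺)
    ... | inj₂ (¬e , a) = ⊖-add (¬e ∘ restrict⁻) (A⁻ a)

    up : ∀ {i j} → (restrict φ E ⊖ B) ∋ i ∼ j → (E ⊖ A) ∋ φ i ∼ φ j
    up h with ⊖-cases h
    ... | inj₁ (e , ¬b) = ⊖-keep (restrict⁻ e) (¬b ∘ A⁻)
    ... | inj₂ (¬e , b) = ⊖-add (¬e ∘ restrict⁺) (A⁺ b)

    -- All four vertices are ends of edges of the edited graph and so have preimages under `φ`; the
    -- discarded vertices stay isolated.
    noPaw : NoPaw (restrict φ E ⊖ B) → NoPaw (E ⊖ A)
    noPaw np ab bc ac cd d≢a d≢b
      with H-cover ab | H-cover bc | H-cover cd | H-cover (∼-sym cd)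
    ... | a , refl | b , refl | c , refl | d , refl
      with np (down ab) (down bc) (down ac) (down cd) (d≢a ∘ cong φ) (d≢b ∘ cong φ)
    ...   | inj₁ ad = inj₁ (up ad)
    ...   | inj₂ bd = inj₂ (up bd)

  extend-solvable : (∀ {x y} → E ∋ x ∼ y → ∃ λ i → φ i ≡ x) → ∀ {k} → Solvable (restrict φ E) k → Solvable E k
  extend-solvable cover (B , ∣B∣≤k , np) = A , ≤-trans ∣A∣≤∣B∣ ∣B∣≤k , noPaw np
    where open Extend cover B

least : ∀ {n} {P : Fin n → Set} → Decidable P → ∃ P → ∃ λ x → P x × ∀ y → P y → toℕ x ≤ toℕ y
least {suc n} P? (x , p) with P? zero
... | yes p₀ = zero , p₀ , λ _ _ → z≤n
... | no ¬p₀ with x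
...   | zero   = contradiction p ¬p₀
...   | suc x′ with least (P? ∘ suc) (x′ , p)
...     | y , q , y≤ = suc y , q , λ { zero p₀ → contradiction p₀ ¬p₀ ; (suc z) r → s≤s (y≤ z r) }

-- One round of deletion, described by a formula

opaque

  -- Outside this block the formula is accessible only through the two lemmas below, so that
  -- reasoning about `chosen` and `survives` does not expand it.
  deletion : Formula 1
  deletion = deletable 0F

  deletion⇔ : ∀ {n} {E : PairSet n} {K v} → Semantics.Sat E K deletion (v ∷ []) ⇔ Semantics.Sat E K (deletable 0F) (v ∷ [])
  deletion⇔ = mk⇔ (λ s → s) (λ s → s)

  deletion-alive : ∀ {n} {E : PairSet n} {K v} → Semantics.Sat E K deletion (v ∷ []) → Semantics.Sat E K (nonisolated 0F) (v ∷ [])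
  deletion-alive = proj₁

-- Soundness covers one deletion at a time, so the order of the vertices is used to single one out
-- within the formula. This makes a whole round a first-order interpretation, namely `survives`;
-- `at` applies a formula of one variable under quantifiers without renaming.
chosen : Formula 1
chosen = deletion and every (deletion at 0F implies 1F ≼ 0F)

survives : Formula 2
survives = 0F ~ 1F and not (chosen at 0F) and not (chosen at 1F)

module _ {n : ℕ} (k : ℕ) where

  private
    module Sem (E : PairSet n) = Semantics E (threshold k)

  Deletable : PairSet n → Fin n → Set
  Deletable E v = Sem.Sat E deletion (v ∷ [])

  deletable? : ∀ E → Decidable (Deletable E)
  deletable? E v = Sem.sat? E deletion (v ∷ [])

  Chosen : PairSet n → Fin n → Set
  Chosen E v = Deletable E v × ∀ u → Deletable E u → toℕ v ≤ toℕ u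

  chosen? : ∀ E → Decidable (Chosen E)
  chosen? E v = Sem.sat? E chosen (v ∷ [])

  Alive : PairSet n → Fin n → Set
  Alive E v = Sem.Sat E (nonisolated 0F) (v ∷ [])

  alive? : ∀ E → Decidable (Alive E)
  alive? E v = Sem.sat? E (nonisolated 0F) (v ∷ [])

  reduce : PairSet n → PairSet n
  reduce E with any? (chosen? E)
  ... | yes (v , _) = isolate v E
  ... | no _        = E

  reduce-survives : ∀ E x y → has (reduce E) x y ≡ does (Sem.sat? E survives (x ∷ y ∷ []))
  reduce-survives E x y with any? (chosen? E)
  ... | no ¬c = does-⇔ (mk⇔ (λ e → e , (λ c → ¬c (x , c)) , (λ c → ¬c (y , c))) proj₁)
                        (E ∋? x ∼ y) (Sem.sat? E survives (x ∷ y ∷ []))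
  ... | yes (v , c) = does-⇔ (mk⇔ (λ (e , x≢v , y≢v) → e , x≢v ∘ only , y≢v ∘ only)
                                   (λ (e , ¬cx , ¬cy) → e , (λ { refl → ¬cx c }) , (λ { refl → ¬cy c })))
                        (E ∋? x ∼ y ×-dec ¬? (x ≟ᶠ v) ×-dec ¬? (y ≟ᶠ v)) (Sem.sat? E survives (x ∷ y ∷ []))
    where
    only : ∀ {u} → Chosen E u → u ≡ v
    only {u} (du , u≤) = toℕ-injective (≤-antisym (u≤ v (proj₁ c)) (proj₂ c u du))

  reduce-solvable : ∀ E → Solvable (reduce E) k ⇔ Solvable E k
  reduce-solvable E with any? (chosen? E)
  ... | no _              = mk⇔ (λ s → s) (λ s → s)
  ... | yes (v , del , _) = mk⇔ (isolate-sound {E = E} {v} (Equivalence.to deletion⇔ del)) (isolate-complete {E = E} {v})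

  alive-count : PairSet n → ℕ
  alive-count E = count (alive? E)

  reduce-progress : ∀ E → (reduce E ≡ E × ∀ v → ¬ Deletable E v) ⊎ alive-count (reduce E) < alive-count E
  reduce-progress E with any? (chosen? E)
  ... | no ¬c         = inj₁ (refl , λ v d → ¬c (least (deletable? E) (v , d)))
  ... | yes (v , del , _) = inj₂ (count-mono-< (alive? (isolate v E)) (alive? E)
    (λ (y , e) → y , proj₁ (isolate⁻ {E = E} e)) (λ (y , e) → proj₁ (proj₂ (isolate⁻ {E = E} e)) refl) (deletion-alive del))

  reduces : ℕ → PairSet n → PairSet n
  reduces zero    E = E
  reduces (suc i) E = reduces i (reduce E)

  reduces-solvable : ∀ i E → Solvable (reduces i E) k ⇔ Solvable E k
  reduces-solvable zero    E = mk⇔ (λ s → s) (λ s → s)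
  reduces-solvable (suc i) E = mk⇔ (to (reduce-solvable E) ∘ to (reduces-solvable i (reduce E)))
                                   (from (reduces-solvable i (reduce E)) ∘ from (reduce-solvable E))
    where open Equivalence

  reduces-fixed : ∀ i {E} → reduce E ≡ E → reduces i E ≡ E
  reduces-fixed zero    eq = refl
  reduces-fixed (suc i) {E} eq = trans (cong (reduces i) eq) (reduces-fixed i eq)

  -- A round either finds nothing to delete, and so do all later ones, or lowers the number of
  -- nonisolated vertices. When none is left nothing is deletable, as deletable vertices are
  -- nonisolated.
  reduces-irreducible : ∀ i E → alive-count E ≤ i → ∀ v → ¬ Deletable (reduces i E) v
  reduces-irreducible zero    E le v d = n≮0 (≤-trans (≤-reflexive (sym (bit-yes (alive? E v) (deletion-alive d))))
                                               (≤-trans (f≤sum (λ v → bit (does (alive? E v))) v) le))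
  reduces-irreducible (suc i) E le with reduce-progress E
  ... | inj₂ lt = reduces-irreducible i (reduce E) (≤-pred (≤-trans lt le))
  ... | inj₁ (eq , irr) = subst (λ F → ∀ v → ¬ Deletable F v) (sym (reduces-fixed (suc i) eq)) irr

-- min (side k) n takes part instead of side k so that the bound can be computed
-- in polynomial time although k is given in binary.
cap : ℕ → ℕ → ℕ
cap k n = (side k ⊓ n) ^ 6

n≤n^6 : ∀ n → n ≤ n ^ 6
n≤n^6 zero    = z≤n
n≤n^6 (suc n) = ≤-trans (≤-reflexive (sym (*-identityʳ (suc n)))) (^-monoʳ-≤ (suc n) {1} {6} (s≤s z≤n))

module Kernel {n} (E : PairSet n) (k : ℕ) where

  core : PairSet n
  core = reduces k n E

  survivors : List (Fin n)
  survivors = filter (alive? k core) (allFin n)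

  φ : Fin (length survivors) → Fin n
  φ = List.lookup survivors

  φ-injective : ∀ {i j} → φ i ≡ φ j → i ≡ j
  φ-injective = lookup-injective (Unique.filter⁺ (alive? k core) (Unique.allFin⁺ n))

  φ-cover : ∀ {x y} → core ∋ x ∼ y → ∃ λ i → φ i ≡ x
  φ-cover {x} {y} e = index x∈ , sym (lookup-index x∈)
    where x∈ = ∈-filter⁺ (alive? k core) (∈-allFin x) (y , e)

  size≡ : length survivors ≡ count (alive? k core)
  size≡ = length-filter-tabulate (alive? k core) (λ x → x)

  solvable : Solvable (restrict φ core) k ⇔ Solvable E k
  solvable = mk⇔ (Equivalence.to (reduces-solvable k n E) ∘ extend-solvable φ-injective φ-cover)
                 (restrict-solvable φ-injective ∘ Equivalence.from (reduces-solvable k n E))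

  -- Truncation never rejects a yes-instance: for `n ≤ side k` the cap is `n ^ 6`, which the number
  -- of survivors cannot exceed, and otherwise it is the bound for irreducible yes-instances.
  unsolvable : ¬ length survivors ≤ cap k n → ¬ Solvable E k
  unsolvable big s with n ≤? side k
  ... | yes n≤ = big (≤-trans (≤-trans (≤-reflexive size≡) (count≤n (alive? k core)))
                   (subst (λ z → n ≤ z ^ 6) (sym (m≥n⇒m⊓n≡n n≤)) (n≤n^6 n)))
  ... | no n≰  = big (≤-trans (≤-reflexive size≡)
                   (subst (λ z → count (alive? k core) ≤ z ^ 6) (sym (m≤n⇒m⊓n≡m (<⇒≤ (≰⇒> n≰))))
                     (irreducible-order {E = core} {k}
                       (λ v → reduces-irreducible k n E (count≤n (alive? k E)) v ∘ Equivalence.from deletion⇔)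
                       (Equivalence.from (reduces-solvable k n E) s))))

solvable⇔editable : ∀ {n} {E : PairSet n} {k} → Solvable E k ⇔ Editable ⟪ graph n E , k ⟫
solvable⇔editable = mk⇔ (λ (A , le , np) → A , le , NoPaw⇒PawFree np) (λ (A , le , pf) → A , le , PawFree⇒NoPaw pf)

verdict : ∀ {P : Set} → Dec P → Instance → Instance
verdict (yes _) I = I
verdict (no _)  I = ⟪ paw , 0 ⟫

kernel : Instance → Instance
kernel ⟪ graph n E , k ⟫ = verdict (length (Kernel.survivors E k) ≤? cap k n)
                                   ⟪ graph _ (restrict (Kernel.φ E k) (Kernel.core E k)) , k ⟫

paw-uneditable : ¬ Editable ⟪ paw , 0 ⟫
paw-uneditable (A , none , pawFree) = pawFree record
  { embed = λ i → i ; injective = λ eq → eq ; preserves = λ i j → sym (unchanged i j) }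
  where
  empty : ∀ i j → has A i j ≡ false
  empty i j with A ∋? i ∼ j
  ... | no ¬a = dec-false (A ∋? i ∼ j) ¬a
  ... | yes a = contradiction
    (≤-trans (≤-trans (≤-reflexive (sym (bit-yes (touched? A i) (j , a)))) (f≤sum (λ i → bit (does (touched? A i))) i))
      (≤-trans (count-touched A) (+-mono-≤ none none))) (<⇒≱ z<s)
  unchanged : ∀ i j → adj paw i j xor has A i j ≡ adj paw i j
  unchanged i j rewrite empty i j with adj paw i j
  ... | true  = refl
  ... | false = refl

kernel-budget : ∀ I → budget (kernel I) ≤ budget I
kernel-budget ⟪ graph n E , k ⟫ with length (Kernel.survivors E k) ≤? cap k n
... | yes _ = ≤-refl
... | no _  = z≤n

kernel-equivalent : ∀ I → Editable (kernel I) ⇔ Editable I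
kernel-equivalent ⟪ graph n E , k ⟫ with length (Kernel.survivors E k) ≤? cap k n
... | yes _  = mk⇔ (to solvable⇔editable ∘ to (Kernel.solvable E k) ∘ from solvable⇔editable)
                   (to solvable⇔editable ∘ from (Kernel.solvable E k) ∘ from solvable⇔editable)
  where open Equivalence
... | no big = mk⇔ (λ e → contradiction e paw-uneditable)
                   (λ e → contradiction (Equivalence.from solvable⇔editable e) (Kernel.unsolvable E k big))

kernel-order : ∀ I → order (input (kernel I)) ≤ side (budget I) ^ 6
kernel-order ⟪ graph n E , k ⟫ with length (Kernel.survivors E k) ≤? cap k n
... | yes small = ≤-trans small (^-monoˡ-≤ 6 (m⊓n≤m (side k) n))
... | no _      = ≤-trans (m≤m+n 4 12) (≤-trans (m≤m*n 16 (suc k)) (≤-trans (≤-reflexive (sixteen k)) (n≤n^6 (side k))))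
  where
  sixteen : ∀ k → 16 * suc k ≡ 2 * (2 * (2 * (2 * suc k)))
  sixteen = solve-∀

order-growth : (λ k → side k ^ 6) ∈O (λ k → k ^ 6)
-- At `k = 0` the bound is positive while `k ^ 6` vanishes; from `k = 1` on, `16 * suc k` is at most
-- `32 * k`.
order-growth = 32 ^ 6 , 1 , λ { (suc k) _ → bound k }
  where
  double : ∀ k → 2 * (2 * (2 * (2 * suc (suc k)))) + 16 * k ≡ 32 * suc k
  double = solve-∀
  bound : ∀ k → side (suc k) ^ 6 ≤ 32 ^ 6 * suc k ^ 6
  bound k = ≤-trans (^-monoˡ-≤ 6 {side (suc k)} {32 * suc k} (≤-trans (m≤m+n _ (16 * k)) (≤-reflexive (double k))))
                    (≤-reflexive (^-distribʳ-* 6 32 (suc k)))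

-- Feasible functions

infixl 6 _⊕_
infixl 7 _⊗_

-- Polynomials as syntax: they are monotone and closed under the substitution `_⊚_`, which
-- composition of programs requires, and a single monomial can be read off at the end.
data Bound : Set where
  var     : Bound
  con     : ℕ → Bound
  _⊕_ _⊗_ : Bound → Bound → Bound

eval : Bound → ℕ → ℕ
eval var     s = s
eval (con c) s = c
eval (p ⊕ q) s = eval p s + eval q s
eval (p ⊗ q) s = eval p s * eval q s

eval-mono : ∀ p {s t} → s ≤ t → eval p s ≤ eval p t
eval-mono var     le = le
eval-mono (con c) le = ≤-refl
eval-mono (p ⊕ q) le = +-mono-≤ (eval-mono p le) (eval-mono q le)
eval-mono (p ⊗ q) le = *-mono-≤ (eval-mono p le) (eval-mono q le)

_⊚_ : Bound → Bound → Bound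
var     ⊚ r = r
con c   ⊚ r = con c
(p ⊕ q) ⊚ r = p ⊚ r ⊕ q ⊚ r
(p ⊗ q) ⊚ r = p ⊚ r ⊗ q ⊚ r

eval-⊚ : ∀ p r s → eval (p ⊚ r) s ≡ eval p (eval r s)
eval-⊚ var     r s = refl
eval-⊚ (con c) r s = refl
eval-⊚ (p ⊕ q) r s = cong₂ _+_ (eval-⊚ p r s) (eval-⊚ q r s)
eval-⊚ (p ⊗ q) r s = cong₂ _*_ (eval-⊚ p r s) (eval-⊚ q r s)

coefficient exponent : Bound → ℕ
coefficient var     = 1
coefficient (con c) = c
coefficient (p ⊕ q) = coefficient p + coefficient q
coefficient (p ⊗ q) = coefficient p * coefficient q
exponent var     = 1
exponent (con c) = 0
-- A sum in place of the maximum is harmless, since arguments are at least one and only some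
-- exponent is wanted.
exponent (p ⊕ q) = exponent p + exponent q
exponent (p ⊗ q) = exponent p + exponent q

eval-monomial : ∀ p s → eval p (suc s) ≤ coefficient p * suc s ^ exponent p
eval-monomial var     s = ≤-reflexive (sym (trans (+-identityʳ _) (*-identityʳ (suc s))))
eval-monomial (con c) s = ≤-reflexive (sym (*-identityʳ c))
eval-monomial (p ⊕ q) s = ≤-trans
  (+-mono-≤ (≤-trans (eval-monomial p s) (*-monoʳ-≤ (coefficient p) (^-monoʳ-≤ (suc s) (m≤m+n (exponent p) (exponent q)))))
            (≤-trans (eval-monomial q s) (*-monoʳ-≤ (coefficient q) (^-monoʳ-≤ (suc s) (m≤n+m (exponent q) (exponent p))))))
  (≤-reflexive (sym (*-distribʳ-+ (suc s ^ (exponent p + exponent q)) (coefficient p) (coefficient q))))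
eval-monomial (p ⊗ q) s = ≤-trans (*-mono-≤ (eval-monomial p s) (eval-monomial q s)) (≤-reflexive
  (trans (interchange (coefficient p) (suc s ^ exponent p) (coefficient q) (suc s ^ exponent q))
         (cong (coefficient p * coefficient q *_) (sym (^-distribˡ-+-* (suc s) (exponent p) (exponent q))))))
  where
  interchange : ∀ a b c d → a * b * (c * d) ≡ a * c * (b * d)
  interchange = solve-∀

size≥1 : ∀ a (x : ⟦ a ⟧) → 1 ≤ size {a} x
size≥1 Ty.unit  x        = ≤-refl
size≥1 nat      x        = s≤s z≤n
size≥1 (a `× b) (x , y)  = ≤-trans (size≥1 a x) (m≤m+n _ _)
size≥1 (a `⊎ b) (inj₁ x) = s≤s z≤n
size≥1 (a `⊎ b) (inj₂ y) = s≤s z≤n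
size≥1 (list a) []       = ≤-refl
size≥1 (list a) (x ∷ xs) = s≤s z≤n

log₂-double : ∀ {m} n → m ≤ n + n → ⌊log₂ m ⌋ ≤ suc ⌊log₂ n ⌋
log₂-double zero    z≤n = z≤n
log₂-double (suc n) le  = ≤-trans (⌊log₂⌋-mono-≤ (≤-trans le (≤-reflexive (cong (suc n +_) (sym (+-identityʳ (suc n)))))))
                                  (≤-reflexive (⌊log₂[2*b]⌋≡1+⌊log₂b⌋ (suc n)))

log₂-+ : ∀ m n → ⌊log₂ (m + n) ⌋ ≤ suc (⌊log₂ m ⌋ + ⌊log₂ n ⌋)
log₂-+ m n with ≤-total m n
... | inj₁ m≤n = ≤-trans (log₂-double n (+-monoˡ-≤ n m≤n)) (s≤s (m≤n+m _ _))
... | inj₂ n≤m = ≤-trans (log₂-double m (+-monoʳ-≤ m n≤m)) (s≤s (m≤m+n _ _))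

size-suc : ∀ n → size {nat} (suc n) ≤ suc (size {nat} n)
size-suc n = s≤s (log₂-+ 1 n)

size-+ : ∀ m n → size {nat} (m + n) ≤ size {nat} m + size {nat} n
size-+ m n = ≤-trans (s≤s (log₂-+ m n)) (≤-reflexive (cong suc (sym (+-suc _ _))))

size-mono : ∀ {m n} → m ≤ n → size {nat} m ≤ size {nat} n
size-mono m≤n = s≤s (⌊log₂⌋-mono-≤ m≤n)

op-size : ∀ {a b} (o : Op a b) x → size {b} (runOp o x) ≤ suc (size {a} x)
op-size Op.id      x            = n≤1+n _
op-size Op.unit    x            = s≤s z≤n
op-size Op.fst     (x , y)      = ≤-trans (m≤m+n _ _) (n≤1+n _)
op-size Op.snd     (x , y)      = ≤-trans (m≤n+m _ _) (n≤1+n _)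
op-size Op.inl     x            = ≤-refl
op-size Op.inr     x            = ≤-refl
op-size Op.distrib (inj₁ x , z) = n≤1+n _
op-size Op.distrib (inj₂ y , z) = n≤1+n _
op-size Op.nil     x            = s≤s z≤n
op-size Op.cons    (x , xs)     = ≤-refl
op-size Op.uncons  []           = ≤-refl
op-size Op.uncons  (x ∷ xs)     = n≤1+n _
op-size Op.zero    x            = s≤s z≤n
op-size Op.suc     n            = size-suc n
op-size Op.add     (m , n)      = ≤-trans (size-+ m n) (n≤1+n _)
op-size Op.monus   (m , n)      = ≤-trans (size-mono (m∸n≤m m n)) (≤-trans (m≤m+n _ _) (n≤1+n _))
op-size Op.leq     (m , n) with does (m ≤? n)
... | true  = s≤s (s≤s z≤n)
... | false = s≤s (s≤s z≤n)

-- New values arise only from operations, which enlarge their input by at most one and are charged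
-- for it. A time bound therefore doubles as the size bound that the next program needs.
output-size : ∀ {a b} {p : a ⇒ b} {x y t} → p ∣ x ⇓ y [ t ] → size {b} y ≤ t
output-size (op⇓ {o = o} {x})   = op-size o x
output-size (seq⇓ {t = t} _ q)  = ≤-trans (output-size q) (m≤n+m _ t)
output-size (pair⇓ {a} {x = x} {t = t} {u} p q) =
  ≤-trans (+-mono-≤ (output-size p) (output-size q)) (m≤n+m (t + u) (suc (size {a} x)))
output-size (inj₁⇓ {a} {x = x} {t = t} p) = ≤-trans (output-size p) (m≤n+m t (suc (suc (size {a} x))))
output-size (inj₂⇓ {b = b} {x = x} {t = t} p) = ≤-trans (output-size p) (m≤n+m t (suc (suc (size {b} x))))
output-size (stop⇓ {a} {x = x} {t = t} p) =
  ≤-trans (≤-pred (≤-trans (output-size p) (n≤1+n t))) (m≤n+m t (suc (size {a} x)))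
output-size (next⇓ {a} {x = x} {t = t} {u} p q) =
  ≤-trans (output-size q) (≤-trans (m≤n+m u t) (m≤n+m (t + u) (suc (size {a} x))))

record Feasible (a b : Ty) (f : ⟦ a ⟧ → ⟦ b ⟧) : Set where
  field
    program : a ⇒ b
    time    : ⟦ a ⟧ → ℕ
    runs    : ∀ x → program ∣ x ⇓ f x [ time x ]
    bound   : Bound
    bounded : ∀ x → time x ≤ eval bound (size {a} x)

  size≤ : ∀ x → size {b} (f x) ≤ eval bound (size {a} x)
  size≤ x = ≤-trans (output-size (runs x)) (bounded x)

open Feasible

module _ {a b : Ty} where

  transport : ∀ {f g : ⟦ a ⟧ → ⟦ b ⟧} → (∀ x → f x ≡ g x) → Feasible a b f → Feasible a b g
  transport eq F = record
    { program = program F ; time = time F ; runs = λ x → subst (λ y → program F ∣ x ⇓ y [ time F x ]) (eq x) (runs F x)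
    ; bound = bound F ; bounded = bounded F }

  basic : (o : Op a b) → Feasible a b (runOp o)
  basic o = record
    { program = op o ; time = λ x → suc (size {a} x) ; runs = λ x → op⇓
    ; bound = con 1 ⊕ var ; bounded = λ x → ≤-refl }

infixl 4 _▹_

_▹_ : ∀ {a b c f g} → Feasible a b f → Feasible b c g → Feasible a c (λ x → g (f x))
_▹_ {f = f} F G = record
  { program = program F ⨾ program G
  ; time    = λ x → time F x + time G (f x)
  ; runs    = λ x → seq⇓ (runs F x) (runs G (f x))
  ; bound   = bound F ⊕ bound G ⊚ bound F
  ; bounded = λ x → +-mono-≤ (bounded F x) (≤-trans (bounded G (f x))
      (≤-trans (eval-mono (bound G) (size≤ F x)) (≤-reflexive (sym (eval-⊚ (bound G) (bound F) _)))))
  }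

⟨_,_⟩ : ∀ {a b c f g} → Feasible a b f → Feasible a c g → Feasible a (b `× c) (λ x → f x , g x)
⟨_,_⟩ {a} F G = record
  { program = pair (program F) (program G)
  ; time    = λ x → suc (size {a} x) + (time F x + time G x)
  ; runs    = λ x → pair⇓ (runs F x) (runs G x)
  ; bound   = con 1 ⊕ var ⊕ (bound F ⊕ bound G)
  ; bounded = λ x → +-monoʳ-≤ (suc (size {a} x)) (+-mono-≤ (bounded F x) (bounded G x))
  }

branch : ∀ {a b c f g} → Feasible a c f → Feasible b c g → Feasible (a `⊎ b) c [ f , g ]′
branch {a} {b} {f = f} {g} F G = record
  { program = case (program F) (program G)
  ; time    = time′
  ; runs    = λ { (inj₁ x) → inj₁⇓ (runs F x) ; (inj₂ y) → inj₂⇓ (runs G y) }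
  ; bound   = con 1 ⊕ var ⊕ (bound F ⊕ bound G)
  ; bounded = λ
      { (inj₁ x) → +-monoʳ-≤ (suc (size {a `⊎ b} (inj₁ x))) (≤-trans (bounded F x) (≤-trans (eval-mono (bound F) (n≤1+n _)) (m≤m+n _ _)))
      ; (inj₂ y) → +-monoʳ-≤ (suc (size {a `⊎ b} (inj₂ y))) (≤-trans (bounded G y) (≤-trans (eval-mono (bound G) (n≤1+n _)) (m≤n+m _ _))) }
  }
  where
  time′ : ⟦ a `⊎ b ⟧ → ℕ
  time′ (inj₁ x) = suc (size {a `⊎ b} (inj₁ x)) + time F x
  time′ (inj₂ y) = suc (size {a `⊎ b} (inj₂ y)) + time G y

length≤size : ∀ {a} (xs : List ⟦ a ⟧) → length xs ≤ size {list a} xs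
length≤size         []       = z≤n
length≤size {a} (x ∷ xs) = s≤s (≤-trans (length≤size {a} xs) (m≤n+m _ (size {a} x)))

-- A left fold is feasible as soon as each step enlarges the state by an amount
-- that does not depend on the state.
module Fold {c a s : Ty} {g : ⟦ c `× (a `× s) ⟧ → ⟦ s ⟧} (G : Feasible (c `× (a `× s)) s g) (growth : Bound)
            (grows : ∀ (γ : ⟦ c ⟧) (x : ⟦ a ⟧) (σ : ⟦ s ⟧) → size {s} (g (γ , x , σ)) ≤ size {s} σ + eval growth (size {c} γ + size {a} x)) where

  private
    X : Ty
    X = (c `× s) `× list a

  result : ⟦ X ⟧ → ⟦ s ⟧
  result ((γ , σ) , xs) = foldl (λ σ x → g (γ , x , σ)) σ xs

  next : Feasible ((a `× list a) `× (c `× s)) (X `⊎ s) _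
  next = ⟨ ⟨ basic Op.snd ▹ basic Op.fst
           , ⟨ basic Op.snd ▹ basic Op.fst , ⟨ basic Op.fst ▹ basic Op.fst , basic Op.snd ▹ basic Op.snd ⟩ ⟩ ▹ G ⟩
         , basic Op.fst ▹ basic Op.snd ⟩ ▹ basic Op.inl

  body : Feasible X (X `⊎ s) _
  body = ⟨ basic Op.snd ▹ basic Op.uncons , basic Op.fst ⟩ ▹ basic Op.distrib
         ▹ branch (basic Op.snd ▹ basic Op.snd ▹ basic Op.inr) next

  loopTime : ⟦ c ⟧ → ⟦ s ⟧ → List ⟦ a ⟧ → ℕ
  loopTime γ σ []       = suc (size {X} ((γ , σ) , [])) + time body ((γ , σ) , [])
  loopTime γ σ (x ∷ xs) = suc (size {X} ((γ , σ) , x ∷ xs)) +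
                          (time body ((γ , σ) , x ∷ xs) + loopTime γ (g (γ , x , σ)) xs)

  loop⇓ : ∀ γ σ (xs : List ⟦ a ⟧) → loop (program body) ∣ ((γ , σ) , xs) ⇓ result ((γ , σ) , xs) [ loopTime γ σ xs ]
  loop⇓ γ σ []       = stop⇓ (runs body ((γ , σ) , []))
  loop⇓ γ σ (x ∷ xs) = next⇓ (runs body ((γ , σ) , x ∷ xs)) (loop⇓ γ (g (γ , x , σ)) xs)

  -- `y` bounds the context and the elements, on which the growth of a step depends. `z` bounds
  -- every state to come: besides the present sizes it reserves `eval growth y` for each remaining
  -- element, so the reserve shrinks as the state grows.
  loopTime≤ : ∀ γ σ (xs : List ⟦ a ⟧) {y z} → size {c} γ + size {list a} xs ≤ y →
              size {c} γ + size {s} σ + size {list a} xs + length xs * eval growth y ≤ z →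
              loopTime γ σ xs ≤ suc (length xs) * (suc z + eval (bound body) z)
  loopTime≤ γ σ [] {y} {z} _ le = ≤-trans (+-mono-≤ (s≤s fits) (≤-trans (bounded body ((γ , σ) , [])) (eval-mono (bound body) fits)))
    (≤-reflexive (sym (+-identityʳ _)))
    where
    fits : size {X} ((γ , σ) , []) ≤ z
    fits = ≤-trans (m≤m+n _ 0) le
  loopTime≤ γ σ (x ∷ xs) {y} {z} small le = begin
    suc (size {X} state) + (time body state + loopTime γ σ′ xs)     ≡⟨ sym (+-assoc (suc (size {X} state)) _ _) ⟩
    suc (size {X} state) + time body state + loopTime γ σ′ xs
      ≤⟨ +-mono-≤ (+-mono-≤ (s≤s fits) (≤-trans (bounded body state) (eval-mono (bound body) fits)))
                  (loopTime≤ γ σ′ xs small′ le′) ⟩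
    suc (suc (length xs)) * (suc z + eval (bound body) z)           ∎
    where
    open ≤-Reasoning
    state = (γ , σ) , x ∷ xs
    σ′    = g (γ , x , σ)
    fits : size {X} state ≤ z
    fits = ≤-trans (m≤m+n _ _) le
    small′ : size {c} γ + size {list a} xs ≤ y
    small′ = ≤-trans (+-monoʳ-≤ (size {c} γ) (≤-trans (m≤n+m _ (size {a} x)) (n≤1+n _))) small
    σ′≤ : size {s} σ′ ≤ size {s} σ + eval growth y
    σ′≤ = ≤-trans (grows γ x σ) (+-monoʳ-≤ (size {s} σ) (eval-mono growth
      (≤-trans (+-monoʳ-≤ (size {c} γ) (≤-trans (m≤m+n (size {a} x) _) (n≤1+n _))) small)))
    le′ : size {c} γ + size {s} σ′ + size {list a} xs + length xs * eval growth y ≤ z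
    le′ = begin
      size {c} γ + size {s} σ′ + size {list a} xs + length xs * eval growth y
        ≤⟨ +-monoˡ-≤ _ (+-mono-≤ (+-monoʳ-≤ (size {c} γ) σ′≤) (≤-trans (m≤n+m _ (size {a} x)) (n≤1+n _))) ⟩
      size {c} γ + (size {s} σ + eval growth y) + size {list a} (x ∷ xs) + length xs * eval growth y
        ≡⟨ shuffle (size {c} γ) (size {s} σ) (eval growth y) (size {list a} (x ∷ xs)) (length xs * eval growth y) ⟩
      size {c} γ + size {s} σ + size {list a} (x ∷ xs) + suc (length xs) * eval growth y
        ≤⟨ le ⟩
      z ∎
      where
      shuffle : ∀ p q r t u → p + (q + r) + t + u ≡ p + q + t + (r + u)
      shuffle = solve-∀

  fold : Feasible X s result
  fold = record
    { program = loop (program body)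
    ; time    = λ ((γ , σ) , xs) → loopTime γ σ xs
    ; runs    = λ ((γ , σ) , xs) → loop⇓ γ σ xs
    ; bound   = (con 1 ⊕ var) ⊗ (con 1 ⊕ peak ⊕ bound body ⊚ peak)
    ; bounded = λ ((γ , σ) , xs) → bounded′ γ σ xs
    }
    where
    peak : Bound
    peak = var ⊕ var ⊗ growth
    bounded′ : ∀ γ σ xs → loopTime γ σ xs ≤
               eval ((con 1 ⊕ var) ⊗ (con 1 ⊕ peak ⊕ bound body ⊚ peak)) (size {X} ((γ , σ) , xs))
    bounded′ γ σ xs = begin
      loopTime γ σ xs
        ≤⟨ loopTime≤ γ σ xs {s₀} {z} (+-monoˡ-≤ (size {list a} xs) (m≤m+n (size {c} γ) (size {s} σ)))
                     (+-monoʳ-≤ s₀ (*-monoˡ-≤ (eval growth s₀) len≤)) ⟩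
      suc (length xs) * (suc z + eval (bound body) z)
        ≤⟨ *-monoˡ-≤ (suc z + eval (bound body) z) (s≤s len≤) ⟩
      suc s₀ * (suc z + eval (bound body) z)
        ≡⟨ cong (λ t → suc s₀ * (suc z + t)) (sym (eval-⊚ (bound body) peak s₀)) ⟩
      suc s₀ * (suc z + eval (bound body ⊚ peak) s₀) ∎
      where
      open ≤-Reasoning
      s₀ z : ℕ
      s₀ = size {X} ((γ , σ) , xs)
      z  = eval peak s₀
      len≤ : length xs ≤ s₀
      len≤ = ≤-trans (length≤size {a} xs) (m≤n+m (size {list a} xs) (size {c} γ + size {s} σ))

open Fold using (fold)

-- Feasible functions on lists and numbers

cond : ∀ {A : Set} → ⟦ bool ⟧ → A → A → A
cond (inj₁ _) x y = x
cond (inj₂ _) x y = y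

choose : ∀ {a b p f g} → Feasible a bool p → Feasible a b f → Feasible a b g →
         Feasible a b (λ x → cond (p x) (f x) (g x))
choose {a} {b} {p} {f} {g} P F G = transport (λ x → same (p x) x)
  (⟨ P , basic Op.id ⟩ ▹ basic Op.distrib ▹ branch (basic Op.snd ▹ F) (basic Op.snd ▹ G))
  where
  same : ∀ c x → [ f ∘ proj₂ , g ∘ proj₂ ]′ (runOp (Op.distrib {Ty.unit} {Ty.unit} {a}) (c , x)) ≡ cond c (f x) (g x)
  same (inj₁ _) x = refl
  same (inj₂ _) x = refl

mutual
  constant : ∀ {a} b (y : ⟦ b ⟧) → Feasible a b (λ _ → y)
  constant Ty.unit  y        = basic Op.unit
  constant nat      zero     = basic Op.zero
  constant nat      (suc n)  = constant nat n ▹ basic Op.suc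
  constant (b `× c) (x , y)  = ⟨ constant b x , constant c y ⟩
  constant (b `⊎ c) (inj₁ x) = constant b x ▹ basic Op.inl
  constant (b `⊎ c) (inj₂ y) = constant c y ▹ basic Op.inr
  constant (list b) ys       = constants b ys

  constants : ∀ {a} b (ys : List ⟦ b ⟧) → Feasible a (list b) (λ _ → ys)
  constants b []       = basic Op.nil
  constants b (y ∷ ys) = ⟨ constant b y , constants b ys ⟩ ▹ basic Op.cons

cond-size : ∀ a c {x y : ⟦ a ⟧} {z} → size {a} x ≤ z → size {a} y ≤ z → size {a} (cond c x y) ≤ z
cond-size a (inj₁ _) x≤ y≤ = x≤
cond-size a (inj₂ _) x≤ y≤ = y≤

countTrue : List ⟦ bool ⟧ → ℕ
countTrue = foldl (λ s b → cond b (suc s) s) 0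

countTrue-feasible : Feasible (list bool) nat countTrue
countTrue-feasible = ⟨ ⟨ basic Op.unit , basic Op.zero ⟩ , basic Op.id ⟩ ▹
  fold {Ty.unit} {bool} {nat}
       (choose (basic Op.snd ▹ basic Op.fst) (basic Op.snd ▹ basic Op.snd ▹ basic Op.suc) (basic Op.snd ▹ basic Op.snd))
       (con 1) (λ _ b s → cond-size nat b (≤-trans (size-suc s) (≤-reflexive (+-comm 1 _))) (m≤m+n _ 1))

countTrue-tabulate : ∀ {n} {P : Fin n → Set} (P? : Decidable P) →
                     countTrue (tabulate λ i → encodeBool (does (P? i))) ≡ count P?
countTrue-tabulate P? = go P? 0
  where
  go : ∀ {n} {P : Fin n → Set} (P? : Decidable P) s →
       foldl (λ s b → cond b (suc s) s) s (tabulate λ i → encodeBool (does (P? i))) ≡ s + count P?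
  go {zero}  P? s = sym (+-identityʳ s)
  go {suc n} P? s with does (P? zero)
  ... | true  = trans (go (P? ∘ suc) (suc s)) (sym (+-suc s _))
  ... | false = go (P? ∘ suc) s

module _ {c a b : Ty} (h : ⟦ c `× a ⟧ → ⟦ b ⟧) where

  -- Reverses the list; it is only applied to reversed lists.
  collect : ⟦ c ⟧ → List ⟦ a ⟧ → List ⟦ b ⟧
  collect γ = foldl (λ ys x → h (γ , x) ∷ ys) []

  collect-feasible : Feasible (c `× a) b h → Feasible (c `× list a) (list b) (λ (γ , xs) → collect γ xs)
  collect-feasible H = ⟨ ⟨ basic Op.fst , basic Op.nil ⟩ , basic Op.snd ⟩ ▹
    fold {c} {a} {list b}
         (⟨ ⟨ basic Op.fst , basic Op.snd ▹ basic Op.fst ⟩ ▹ H , basic Op.snd ▹ basic Op.snd ⟩ ▹ basic Op.cons)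
         (con 1 ⊕ bound H)
         (λ γ x ys → ≤-trans (s≤s (+-monoˡ-≤ (size {list b} ys) (size≤ H (γ , x))))
                              (≤-reflexive (+-comm (suc (eval (bound H) (size {c} γ + size {a} x))) (size {list b} ys))))

  collect-reverse : ∀ γ xs → collect γ (reverse xs) ≡ map (λ x → h (γ , x)) xs
  collect-reverse γ xs = trans (reverse-foldl (λ ys x → h (γ , x) ∷ ys) [] xs) (go xs)
    where
    go : ∀ xs → foldr (λ x ys → h (γ , x) ∷ ys) [] xs ≡ map (λ x → h (γ , x)) xs
    go []       = refl
    go (x ∷ xs) = cong (h (γ , x) ∷_) (go xs)

  collect-size : ∀ {m} → (∀ x → size {b} (h x) ≤ m) → ∀ γ xs → size {list b} (collect γ xs) ≤ suc (length xs * suc m)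
  collect-size {m} small γ xs = go xs []
    where
    go : ∀ xs ys → size {list b} (foldl (λ ys x → h (γ , x) ∷ ys) ys xs) ≤ size {list b} ys + length xs * suc m
    go []       ys = m≤m+n _ 0
    go (x ∷ xs) ys = ≤-trans (go xs (h (γ , x) ∷ ys)) (≤-trans
      (+-monoˡ-≤ (length xs * suc m) (s≤s (+-monoˡ-≤ (size {list b} ys) (small (γ , x)))))
      (≤-reflexive (shuffle m (size {list b} ys) (length xs * suc m))))
      where
      shuffle : ∀ p q r → suc (p + q) + r ≡ q + (suc p + r)
      shuffle = solve-∀

applyUpTo≡tabulate : ∀ {B : Set} (f : ℕ → B) n → applyUpTo f n ≡ tabulate {n = n} (f ∘ toℕ)
applyUpTo≡tabulate f zero    = refl
applyUpTo≡tabulate f (suc n) = cong (f 0 ∷_) (applyUpTo≡tabulate (f ∘ suc) n)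

-- Two reversals cancel: `collect` reverses, so vertices kept in descending order produce an
-- ascending table.
collect-downFrom : ∀ {c b} (h : ⟦ c `× nat ⟧ → ⟦ b ⟧) γ n →
                   collect {c} {nat} {b} h γ (downFrom n) ≡ tabulate {n = n} (λ i → h (γ , toℕ i))
collect-downFrom {c} {b} h γ n = begin
  collect {c} {nat} {b} h γ (downFrom n)          ≡⟨ cong (collect {c} {nat} {b} h γ) (sym (reverse-upTo n)) ⟩
  collect {c} {nat} {b} h γ (reverse (upTo n))    ≡⟨ collect-reverse {c} {nat} {b} h γ (upTo n) ⟩
  map (λ x → h (γ , x)) (upTo n)                  ≡⟨ map-upTo (λ x → h (γ , x)) n ⟩
  applyUpTo (λ x → h (γ , x)) n                   ≡⟨ applyUpTo≡tabulate (λ x → h (γ , x)) n ⟩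
  tabulate (λ i → h (γ , toℕ i))                  ∎
  where open ≡-Reasoning

leqᵇ : ℕ → ℕ → ⟦ bool ⟧
leqᵇ m n = encodeBool (does (m ≤? n))

leqᵇ-yes : ∀ {m n} {A : Set} {x y : A} → m ≤ n → cond (leqᵇ m n) x y ≡ x
leqᵇ-yes {m} {n} le = cong (λ b → cond (encodeBool b) _ _) (dec-true (m ≤? n) le)

leqᵇ-no : ∀ {m n} {A : Set} {x y : A} → ¬ m ≤ n → cond (leqᵇ m n) x y ≡ y
leqᵇ-no {m} {n} ≰ = cong (λ b → cond (encodeBool b) _ _) (dec-false (m ≤? n) ≰)

module _ (a : Ty) (d : ⟦ a ⟧) where

  private
    step : ℕ → ℕ × ⟦ a ⟧ → ⟦ a ⟧ → ℕ × ⟦ a ⟧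
    step t (i , r) x = suc i , cond (leqᵇ i t) x r

  -- Beyond the end this is the last entry, or d if there is none.
  pick : ℕ → List ⟦ a ⟧ → ⟦ a ⟧
  pick t xs = proj₂ (foldl (step t) (0 , d) xs)

  pick-feasible : Feasible (nat `× list a) a (λ (t , xs) → pick t xs)
  pick-feasible = ⟨ ⟨ basic Op.fst , ⟨ basic Op.zero , constant a d ⟩ ⟩ , basic Op.snd ⟩ ▹
    fold {nat} {a} {nat `× a}
         ⟨ counter ▹ basic Op.suc
         , choose (⟨ counter , basic Op.fst ⟩ ▹ basic Op.leq) (basic Op.snd ▹ basic Op.fst) (basic Op.snd ▹ basic Op.snd ▹ basic Op.snd) ⟩
         (con 1 ⊕ var)
         (λ t x (i , r) → ≤-trans
           (+-mono-≤ (size-suc i) (cond-size a (leqᵇ i t) {z = size {a} r + (size {nat} t + size {a} x)}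
             (≤-trans (m≤n+m (size {a} x) (size {nat} t)) (m≤n+m _ (size {a} r))) (m≤m+n (size {a} r) _)))
           (≤-reflexive (shuffle (size {nat} i) (size {a} r) (size {nat} t + size {a} x))))
    ▹ basic Op.snd
    where
    counter : Feasible (nat `× (a `× (nat `× a))) nat _
    counter = basic Op.snd ▹ basic Op.snd ▹ basic Op.fst
    shuffle : ∀ p q r → suc p + (q + r) ≡ p + q + (1 + r)
    shuffle = solve-∀

  pick-tabulate : ∀ {n} (f : Fin n → ⟦ a ⟧) j → pick (toℕ j) (tabulate f) ≡ f j
  pick-tabulate f j = hit f j 0 d
    where
    missed : ∀ t xs i r → t < i → proj₂ (foldl (step t) (i , r) xs) ≡ r
    missed t []       i r lt = refl
    missed t (x ∷ xs) i r lt = trans (missed t xs (suc i) _ (m≤n⇒m≤1+n lt)) (leqᵇ-no (<⇒≱ lt))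
    hit : ∀ {n} (f : Fin n → ⟦ a ⟧) j i r → proj₂ (foldl (step (i + toℕ j)) (i , r) (tabulate f)) ≡ f j
    hit f zero    i r = trans (missed (i + 0) (tabulate (f ∘ suc)) (suc i) _ (s≤s (≤-reflexive (+-identityʳ i)))) (leqᵇ-yes (m≤m+n i 0))
    hit f (suc j) i r = subst (λ t → proj₂ (foldl (step t) (i , r) (tabulate f)) ≡ f (suc j))
                              (sym (+-suc i (toℕ j))) (hit (f ∘ suc) j (suc i) _)

private
  add-step : ℕ → ℕ × ℕ → ℕ → ℕ × ℕ
  add-step m (r , s) _ = cond (leqᵇ 1 r) (r ∸ 1 , s + m) (r , s)

-- Repeated addition with the list as a clock. A fold runs once per element, so the factor `q` is
-- truncated at the length of the list; this is the minimum in `cap`.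
times : ℕ → ℕ → List ℕ → ℕ
times q m xs = proj₂ (foldl (add-step m) (q , 0) xs)

times-feasible : Feasible (nat `× (nat `× list nat)) nat (λ (q , m , xs) → times q m xs)
times-feasible = ⟨ ⟨ basic Op.snd ▹ basic Op.fst , ⟨ basic Op.fst , basic Op.zero ⟩ ⟩ , basic Op.snd ▹ basic Op.snd ⟩ ▹
  fold {nat} {nat} {nat `× nat}
       (choose (⟨ constant nat 1 , left ⟩ ▹ basic Op.leq)
               ⟨ ⟨ left , constant nat 1 ⟩ ▹ basic Op.monus , ⟨ done , basic Op.fst ⟩ ▹ basic Op.add ⟩
               (basic Op.snd ▹ basic Op.snd))
       var
       (λ m x (r , s) → cond-size (nat `× nat) (leqᵇ 1 r)
         (≤-trans (+-mono-≤ (size-mono (m∸n≤m r 1)) (size-+ s m))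
           (≤-trans (≤-reflexive (sym (+-assoc (size {nat} r) (size {nat} s) (size {nat} m))))
                    (+-monoʳ-≤ (size {nat} r + size {nat} s) (m≤m+n (size {nat} m) (size {nat} x)))))
         (m≤m+n (size {nat} r + size {nat} s) _))
  ▹ basic Op.snd
  where
  left done : Feasible (nat `× (nat `× (nat `× nat))) nat _
  left = basic Op.snd ▹ basic Op.snd ▹ basic Op.fst
  done = basic Op.snd ▹ basic Op.snd ▹ basic Op.snd

times≡ : ∀ q m xs → times q m xs ≡ (q ⊓ length xs) * m
times≡ q m xs = go q 0 xs
  where
  go : ∀ r s xs → proj₂ (foldl (add-step m) (r , s) xs) ≡ s + (r ⊓ length xs) * m
  go r       s []       = sym (trans (cong (λ z → s + z * m) (⊓-zeroʳ r)) (+-identityʳ s))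
  go zero    s (x ∷ xs) = go zero s xs
  go (suc r) s (x ∷ xs) = trans (go r (s + m) xs) (+-assoc s m _)

module _ {a : Ty} where

  count-up : List ⟦ a ⟧ → ℕ
  count-up = foldl (λ i _ → suc i) 0

  count-up-feasible : Feasible (list a) nat count-up
  count-up-feasible = ⟨ ⟨ basic Op.unit , basic Op.zero ⟩ , basic Op.id ⟩ ▹
    fold {Ty.unit} {a} {nat} (basic Op.snd ▹ basic Op.snd ▹ basic Op.suc) (con 1)
         (λ _ _ i → ≤-trans (size-suc i) (≤-reflexive (+-comm 1 _)))

  count-up≡length : ∀ xs → count-up xs ≡ length xs
  count-up≡length xs = go 0 xs
    where
    go : ∀ i (xs : List ⟦ a ⟧) → foldl (λ i _ → suc i) i xs ≡ i + length xs
    go i []       = sym (+-identityʳ i)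
    go i (x ∷ xs) = trans (go (suc i) xs) (sym (+-suc i (length xs)))

  private
    index-step : ℕ → ℕ × List ℕ → ⟦ a ⟧ → ℕ × List ℕ
    index-step N (i , ys) _ = suc i , (N ∸ (N ∸ i)) ∷ ys

  -- Pushing i in the form N ∸ (N ∸ i) bounds its size in terms of N alone.
  positions : ℕ → List ⟦ a ⟧ → List ℕ
  positions N xs = proj₂ (foldl (index-step N) (0 , []) xs)

  positions-feasible : Feasible (nat `× list a) (list nat) (λ (N , xs) → positions N xs)
  positions-feasible = ⟨ ⟨ basic Op.fst , ⟨ basic Op.zero , basic Op.nil ⟩ ⟩ , basic Op.snd ⟩ ▹
    fold {nat} {a} {nat `× list nat}
         ⟨ counter ▹ basic Op.suc
         , ⟨ ⟨ basic Op.fst , ⟨ basic Op.fst , counter ⟩ ▹ basic Op.monus ⟩ ▹ basic Op.monus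
           , basic Op.snd ▹ basic Op.snd ▹ basic Op.snd ⟩ ▹ basic Op.cons ⟩
         (con 2 ⊕ var)
         (λ N x (i , ys) → ≤-trans
           (+-mono-≤ (size-suc i) (s≤s (+-monoˡ-≤ (size {list nat} ys)
             (≤-trans (size-mono (m∸n≤m N (N ∸ i))) (m≤m+n (size {nat} N) (size {a} x))))))
           (≤-reflexive (shuffle (size {nat} i) (size {nat} N + size {a} x) (size {list nat} ys))))
    ▹ basic Op.snd
    where
    counter : Feasible (nat `× (a `× (nat `× list nat))) nat _
    counter = basic Op.snd ▹ basic Op.snd ▹ basic Op.fst
    shuffle : ∀ p q r → suc p + suc (q + r) ≡ p + r + (2 + q)
    shuffle = solve-∀

  positions≡downFrom : ∀ xs → positions (length xs) xs ≡ downFrom (length xs)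
  positions≡downFrom xs = go 0 xs ≤-refl
    where
    N = length xs
    go : ∀ i (ys : List ⟦ a ⟧) → i + length ys ≤ N →
         proj₂ (foldl (index-step N) (i , downFrom i) ys) ≡ downFrom (i + length ys)
    go i []       le = cong downFrom (sym (+-identityʳ i))
    go i (y ∷ ys) le rewrite m∸[m∸n]≡n (≤-trans (m≤m+n i (suc (length ys))) le) | +-suc i (length ys) = go (suc i) ys le

-- Evaluation of formulas

Env : ℕ → Ty
Env zero    = Ty.unit
Env (suc m) = nat `× Env m

-- An adjacency matrix, the threshold of `many`, and the vertices in descending
-- order.
Context : Ty
Context = list (list bool) `× (nat `× list nat)

value : ∀ {m} → Fin m → ⟦ Env m ⟧ → ℕ
value zero    (x , _) = x
value (suc i) (_ , e) = value i e

value-feasible : ∀ {m} (i : Fin m) → Feasible (Env m) nat (value i)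
value-feasible zero    = basic Op.fst
value-feasible (suc i) = basic Op.snd ▹ value-feasible i

module _ {m : ℕ} (h : ⟦ Context `× Env (suc m) ⟧ → ⟦ bool ⟧) where

  private
    curried : ⟦ (Context `× Env m) `× nat ⟧ → ⟦ bool ⟧
    curried ((γ , e) , x) = h (γ , x , e)

  -- All quantifiers compile to this count: `some` and `many` compare it with a lower threshold, and
  -- `every` demands that there are no counterexamples.
  holding : ⟦ Context `× Env m ⟧ → ℕ
  holding ((M , K , vs) , e) = countTrue (collect {Context `× Env m} {nat} {bool} curried ((M , K , vs) , e) vs)

  holding-feasible : Feasible (Context `× Env (suc m)) bool h → Feasible (Context `× Env m) nat holding
  holding-feasible H = ⟨ basic Op.id , basic Op.fst ▹ basic Op.snd ▹ basic Op.snd ⟩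
    ▹ collect-feasible {Context `× Env m} {nat} {bool} curried
        (⟨ basic Op.fst ▹ basic Op.fst , ⟨ basic Op.snd , basic Op.fst ▹ basic Op.snd ⟩ ⟩ ▹ H)
    ▹ countTrue-feasible

yes! no! : ⟦ bool ⟧
yes! = encodeBool true
no!  = encodeBool false

run : ∀ {m} → Formula m → ⟦ Context `× Env m ⟧ → ⟦ bool ⟧
run (x ~ y)       ((M , _) , e)     = pick bool no! (value y e) (pick (list bool) [] (value x e) M)
run (x ≈ y)       (γ , e)           = cond (leqᵇ (value x e) (value y e)) (leqᵇ (value y e) (value x e)) no!
run (x ≼ y)       (γ , e)           = leqᵇ (value x e) (value y e)
run (not φ)       s                 = cond (run φ s) no! yes!
run (φ and ψ)     s                 = cond (run φ s) (run ψ s) no!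
run (φ or ψ)      s                 = cond (run φ s) yes! (run ψ s)
run (φ implies ψ) s                 = cond (run φ s) (run ψ s) yes!
run (some φ)      s                 = leqᵇ 1 (holding (run φ) s)
run (every φ)     s                 = leqᵇ (holding (λ s → cond (run φ s) no! yes!) s) 0
run (many φ)      ((M , K , vs) , e) = leqᵇ K (holding (run φ) ((M , K , vs) , e))
run (φ at x)      (γ , e)           = run φ (γ , value x e , tt)

variable-feasible : ∀ {m} (i : Fin m) → Feasible (Context `× Env m) nat (λ (γ , e) → value i e)
variable-feasible i = basic Op.snd ▹ value-feasible i

run-feasible : ∀ {m} (φ : Formula m) → Feasible (Context `× Env m) bool (run φ)
run-feasible (x ~ y) =
  ⟨ variable-feasible y , ⟨ variable-feasible x , basic Op.fst ▹ basic Op.fst ⟩ ▹ pick-feasible (list bool) [] ⟩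
  ▹ pick-feasible bool no!
run-feasible (x ≈ y) = choose (⟨ variable-feasible x , variable-feasible y ⟩ ▹ basic Op.leq)
                              (⟨ variable-feasible y , variable-feasible x ⟩ ▹ basic Op.leq) (constant bool no!)
run-feasible (x ≼ y)       = ⟨ variable-feasible x , variable-feasible y ⟩ ▹ basic Op.leq
run-feasible (not φ)       = choose (run-feasible φ) (constant bool no!) (constant bool yes!)
run-feasible (φ and ψ)     = choose (run-feasible φ) (run-feasible ψ) (constant bool no!)
run-feasible (φ or ψ)      = choose (run-feasible φ) (constant bool yes!) (run-feasible ψ)
run-feasible (φ implies ψ) = choose (run-feasible φ) (run-feasible ψ) (constant bool yes!)
run-feasible (some φ)      = ⟨ constant nat 1 , holding-feasible (run φ) (run-feasible φ) ⟩ ▹ basic Op.leq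
run-feasible (every φ)     =
  ⟨ holding-feasible (λ s → cond (run φ s) no! yes!) (choose (run-feasible φ) (constant bool no!) (constant bool yes!))
  , constant nat 0 ⟩ ▹ basic Op.leq
run-feasible (many φ)      =
  ⟨ basic Op.fst ▹ basic Op.snd ▹ basic Op.fst , holding-feasible (run φ) (run-feasible φ) ⟩ ▹ basic Op.leq
run-feasible (φ at x)      = ⟨ basic Op.fst , ⟨ variable-feasible x , basic Op.unit ⟩ ⟩ ▹ run-feasible φ

valuation : ∀ {m n} → Vec (Fin n) m → ⟦ Env m ⟧
valuation []      = tt
valuation (x ∷ ρ) = toℕ x , valuation ρ

value-valuation : ∀ {m n} (i : Fin m) (ρ : Vec (Fin n) m) → value i (valuation ρ) ≡ toℕ (lookup ρ i)
value-valuation zero    (x ∷ ρ) = refl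
value-valuation (suc i) (x ∷ ρ) = value-valuation i ρ

matrix : ∀ {n} → PairSet n → List (List ⟦ bool ⟧)
matrix {n} E = tabulate λ i → tabulate λ j → encodeBool (has E i j)

context : ∀ {n} → PairSet n → ℕ → ⟦ Context ⟧
context {n} E K = matrix E , K , downFrom n

negated : ∀ {A : Set} (a? : Dec A) {c} → c ≡ encodeBool (does a?) → cond c no! yes! ≡ encodeBool (does (¬? a?))
negated (yes _) refl = refl
negated (no _)  refl = refl

module _ {n} (E : PairSet n) (K : ℕ) where

  open Semantics E K

  holding≡count : ∀ {m} (h : ⟦ Context `× Env (suc m) ⟧ → ⟦ bool ⟧) {P : Fin n → Set} (P? : Decidable P) (ρ : Vec (Fin n) m) →
                  (∀ x → h (context E K , valuation (x ∷ ρ)) ≡ encodeBool (does (P? x))) →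
                  holding h (context E K , valuation ρ) ≡ count P?
  holding≡count {m} h P? ρ correct = trans (cong countTrue (trans
    (collect-downFrom {Context `× Env m} {bool} (λ ((γ , e) , x) → h (γ , x , e)) (context E K , valuation ρ) n)
    (tabulate-cong correct)))
    (countTrue-tabulate P?)

  run-correct : ∀ {m} (φ : Formula m) ρ → run φ (context E K , valuation ρ) ≡ encodeBool (does (sat? φ ρ))
  run-correct (x ~ y) ρ rewrite value-valuation x ρ | value-valuation y ρ
    | pick-tabulate (list bool) [] (λ i → tabulate λ j → encodeBool (has E i j)) (lookup ρ x)
    = pick-tabulate bool no! (λ j → encodeBool (has E (lookup ρ x) j)) (lookup ρ y)
  run-correct (x ≼ y) ρ rewrite value-valuation x ρ | value-valuation y ρ = refl
  run-correct (x ≈ y) ρ rewrite value-valuation x ρ | value-valuation y ρ = both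
    where
    i = lookup ρ x
    j = lookup ρ y
    both : cond (leqᵇ (toℕ i) (toℕ j)) (leqᵇ (toℕ j) (toℕ i)) no! ≡ encodeBool (does (i ≟ᶠ j))
    both with i ≟ᶠ j
    ... | yes i≡j = trans (leqᵇ-yes (≤-reflexive (cong toℕ i≡j)))
                          (cong encodeBool (dec-true (toℕ j ≤? toℕ i) (≤-reflexive (cong toℕ (sym i≡j)))))
    ... | no i≢j with toℕ i ≤? toℕ j
    ...   | no ≰  = leqᵇ-no ≰
    ...   | yes le = trans (leqᵇ-yes le)
      (cong encodeBool (dec-false (toℕ j ≤? toℕ i) λ ge → i≢j (toℕ-injective (≤-antisym le ge))))
  run-correct (not φ) ρ = negated (sat? φ ρ) (run-correct φ ρ)
  run-correct (φ and ψ) ρ rewrite run-correct φ ρ | run-correct ψ ρ with does (sat? φ ρ)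
  ... | true  = refl
  ... | false = refl
  run-correct (φ or ψ) ρ rewrite run-correct φ ρ | run-correct ψ ρ with does (sat? φ ρ)
  ... | true  = refl
  ... | false = refl
  run-correct (φ implies ψ) ρ rewrite run-correct φ ρ | run-correct ψ ρ with does (sat? φ ρ)
  ... | true  = refl
  ... | false = refl
  run-correct (some φ) ρ rewrite holding≡count (run φ) (λ x → sat? φ (x ∷ ρ)) ρ (λ x → run-correct φ (x ∷ ρ)) =
    cong encodeBool (does-⇔ (mk⇔ (count-inhabited P?) (λ (x , p) →
      ≤-trans (≤-reflexive (sym (bit-yes (P? x) p))) (f≤sum (λ x → bit (does (P? x))) x))) (1 ≤? count P?) (any? P?))
    where
    P? : Decidable λ x → Sat φ (x ∷ ρ)
    P? x = sat? φ (x ∷ ρ)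
  run-correct (every φ) ρ rewrite holding≡count (λ s → cond (run φ s) no! yes!) (λ x → ¬? (sat? φ (x ∷ ρ))) ρ
                                    (λ x → negated (sat? φ (x ∷ ρ)) (run-correct φ (x ∷ ρ))) =
    cong encodeBool (does-⇔ (mk⇔ (λ none x → decidable-stable (P? x) λ ¬p →
        <⇒≱ (≤-trans (≤-reflexive (sym (bit-yes (¬? (P? x)) ¬p))) (f≤sum (λ x → bit (does (¬? (P? x)))) x)) none)
      (λ all → ≤-reflexive (sum-zero λ x → bit-no (¬? (P? x)) λ ¬p → ¬p (all x)))) (count (λ x → ¬? (P? x)) ≤? 0) (all? P?))
    where
    P? : Decidable λ x → Sat φ (x ∷ ρ)
    P? x = sat? φ (x ∷ ρ)
  run-correct (many φ) ρ rewrite holding≡count (run φ) (λ x → sat? φ (x ∷ ρ)) ρ (λ x → run-correct φ (x ∷ ρ)) = refl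
  run-correct (φ at x) ρ rewrite value-valuation x ρ = run-correct φ (lookup ρ x ∷ [])

-- The kernel is computed in polynomial time

module _ (φ : Formula 2) where

  private
    entry : ⟦ ((Context `× list nat) `× nat) `× nat ⟧ → ⟦ bool ⟧
    entry (((γ , xs) , x) , y) = run φ (γ , x , y , tt)

    line : ⟦ (Context `× list nat) `× nat ⟧ → ⟦ list bool ⟧
    line ((γ , xs) , x) = collect {(Context `× list nat) `× nat} {nat} {bool} entry ((γ , xs) , x) xs

  -- The matrix of the relation φ on the reversal of a list of vertices.
  interpret : ⟦ Context `× list nat ⟧ → ⟦ list (list bool) ⟧
  interpret (γ , xs) = collect {Context `× list nat} {nat} {list bool} line (γ , xs) xs

  interpret-feasible : Feasible (Context `× list nat) (list (list bool)) interpret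
  interpret-feasible = ⟨ basic Op.id , basic Op.snd ⟩ ▹ collect-feasible {Context `× list nat} {nat} {list bool} line
    (⟨ basic Op.id , basic Op.fst ▹ basic Op.snd ⟩ ▹ collect-feasible {(Context `× list nat) `× nat} {nat} {bool} entry
      (⟨ basic Op.fst ▹ basic Op.fst ▹ basic Op.fst
       , ⟨ basic Op.fst ▹ basic Op.snd , ⟨ basic Op.snd , basic Op.unit ⟩ ⟩ ⟩ ▹ run-feasible φ))

  -- The bound depends on the number of vertices alone and not on the matrix in the context. This is
  -- what lets `iterate` be a fold whose state is the matrix: repeated rounds cannot make it grow
  -- beyond control.
  interpret-size : ∀ γ xs → size {list (list bool)} (interpret (γ , xs)) ≤ suc (length xs * suc (suc (length xs * 3)))
  interpret-size γ xs = collect-size′ γ xs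
    where
    bool-size : ∀ (b : ⟦ bool ⟧) → size {bool} b ≤ 2
    bool-size (inj₁ _) = ≤-refl
    bool-size (inj₂ _) = ≤-refl
    -- `collect-size` asks for a bound valid for all arguments; freezing the context at `(γ , xs)`
    -- makes it uniform without changing the result. Each entry costs 3, two for the bit and one for
    -- the list cell.
    line′ : ⟦ (Context `× list nat) `× nat ⟧ → ⟦ list bool ⟧
    line′ (_ , x) = line ((γ , xs) , x)
    line-size : ∀ s → size {list bool} (line′ s) ≤ suc (length xs * 3)
    line-size (_ , x) = collect-size {(Context `× list nat) `× nat} {nat} {bool} entry (bool-size ∘ entry) ((γ , xs) , x) xs
    collect-size′ : ∀ γ′ ys → size {list (list bool)} (collect {Context `× list nat} {nat} {list bool} line′ (γ′ , xs) ys)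
                    ≤ suc (length ys * suc (suc (length xs * 3)))
    collect-size′ γ′ ys = collect-size {Context `× list nat} {nat} {list bool} line′ line-size (γ′ , xs) ys

  module _ {n} (E : PairSet n) (K : ℕ) where

    open Semantics E K

    private
      bits : Fin n → Fin n → ⟦ bool ⟧
      bits x y = encodeBool (does (sat? φ (x ∷ y ∷ [])))

    interpret-reverse : ∀ (xs : List (Fin n)) → interpret (context E K , reverse (map toℕ xs)) ≡ map (λ x → map (bits x) xs) xs
    interpret-reverse xs = trans
      (collect-reverse {Context `× list nat} {nat} {list bool} line (context E K , reverse (map toℕ xs)) (map toℕ xs))
      (trans (sym (map-∘ xs)) (map-cong (λ x → trans
        (collect-reverse {(Context `× list nat) `× nat} {nat} {bool} entry ((context E K , reverse (map toℕ xs)) , toℕ x) (map toℕ xs))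
        (trans (sym (map-∘ xs)) (map-cong (λ y → run-correct E K φ (x ∷ y ∷ [])) xs))) xs))

map-lookup : ∀ {B C : Set} (f : B → C) (xs : List B) → tabulate (f ∘ List.lookup xs) ≡ map f xs
map-lookup f xs = trans (sym (map-tabulate (List.lookup xs) f)) (cong (map f) (tabulate-lookup xs))

matrix-restrict : ∀ {n} (E : PairSet n) xs →
                  matrix (restrict (List.lookup xs) E) ≡ map (λ x → map (λ y → encodeBool (has E x y)) xs) xs
matrix-restrict E xs = trans (tabulate-cong λ i → map-lookup (λ y → encodeBool (has E (List.lookup xs i) y)) xs)
                             (map-lookup (λ x → map (λ y → encodeBool (has E x y)) xs) xs)

upTo≡toℕ : ∀ n → upTo n ≡ map toℕ (allFin n)
upTo≡toℕ n = trans (applyUpTo≡tabulate (λ x → x) n) (sym (map-tabulate (λ i → i) toℕ))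

downFrom≡toℕ : ∀ n → downFrom n ≡ reverse (map toℕ (allFin n))
downFrom≡toℕ n = trans (sym (reverse-upTo n)) (cong reverse (upTo≡toℕ n))

interpret-all : ∀ {n} (φ : Formula 2) (E F : PairSet n) K →
                (∀ x y → has F x y ≡ does (Semantics.sat? E K φ (x ∷ y ∷ []))) →
                interpret φ (context E K , downFrom n) ≡ matrix F
interpret-all {n} φ E F K correct = begin
  interpret φ (context E K , downFrom n)                        ≡⟨ cong (λ vs → interpret φ (context E K , vs)) (downFrom≡toℕ n) ⟩
  interpret φ (context E K , reverse (map toℕ (allFin n)))      ≡⟨ interpret-reverse φ E K (allFin n) ⟩
  map (λ x → map (λ y → encodeBool (does (Semantics.sat? E K φ (x ∷ y ∷ [])))) (allFin n)) (allFin n)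
    ≡⟨ map-cong (λ x → map-cong (λ y → cong encodeBool (sym (correct x y))) (allFin n)) (allFin n) ⟩
  map (λ x → map (λ y → encodeBool (has F x y)) (allFin n)) (allFin n)
    ≡⟨ trans (map-tabulate (λ i → i) _) (tabulate-cong λ i → map-tabulate (λ j → j) _) ⟩
  matrix F ∎
  where open ≡-Reasoning

module _ (φ : Formula 2) where

  private
    again : ⟦ (nat `× list nat) `× (nat `× list (list bool)) ⟧ → ⟦ list (list bool) ⟧
    again ((K , vs) , x , M) = interpret φ ((M , K , vs) , vs)

  -- The list of vertices is the clock here: one round for each vertex, as many as
  -- `reduces-irreducible` requires.
  iterate : ⟦ Context ⟧ → ⟦ list (list bool) ⟧
  iterate (M , K , vs) = foldl (λ M x → again ((K , vs) , x , M)) M vs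

  iterate-feasible : Feasible Context (list (list bool)) iterate
  iterate-feasible = ⟨ ⟨ basic Op.snd , basic Op.fst ⟩ , basic Op.snd ▹ basic Op.snd ⟩ ▹
    fold {nat `× list nat} {nat} {list (list bool)}
         (⟨ ⟨ basic Op.snd ▹ basic Op.snd , basic Op.fst ⟩ , basic Op.fst ▹ basic Op.snd ⟩ ▹ interpret-feasible φ)
         growth grows
    where
    growth : Bound
    growth = con 1 ⊕ var ⊗ (con 2 ⊕ var ⊗ con 3)
    grows : ∀ γ x M → size {list (list bool)} (again (γ , x , M)) ≤
            size {list (list bool)} M + eval growth (size {nat `× list nat} γ + size {nat} x)
    grows (K , vs) x M = ≤-trans (interpret-size φ (M , K , vs) vs)
      (≤-trans (s≤s (*-mono-≤ len≤ (s≤s (s≤s (*-monoˡ-≤ 3 len≤)))))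
               (m≤n+m (eval growth s) (size {list (list bool)} M)))
      where
      s = size {nat `× list nat} (K , vs) + size {nat} x
      len≤ : length vs ≤ s
      len≤ = ≤-trans (length≤size {nat} vs) (≤-trans (m≤n+m _ (size {nat} K)) (m≤m+n _ (size {nat} x)))

iterate≡reduces : ∀ {n} k (E : PairSet n) → iterate survives (context E (threshold k)) ≡ matrix (reduces k n E)
iterate≡reduces {n} k E = trans (go (downFrom n) E) (cong (λ i → matrix (reduces k i E)) (length-downFrom n))
  where
  step : List (List ⟦ bool ⟧) → ℕ → List (List ⟦ bool ⟧)
  step M _ = interpret survives ((M , threshold k , downFrom n) , downFrom n)
  go : ∀ xs (F : PairSet n) → foldl step (matrix F) xs ≡ matrix (reduces k (length xs) F)
  go []       F = refl
  go (x ∷ xs) F = trans (cong (λ M → foldl step M xs) (interpret-all survives F (reduce k F) (threshold k) (reduce-survives k F)))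
                        (go xs (reduce k F))

module _ (φ : Formula 1) where

  -- The vertices satisfying φ, in the reverse of the order of the context.
  select : ⟦ Context ⟧ → ⟦ list nat ⟧
  select (M , K , vs) = foldl (λ xs x → cond (run φ ((M , K , vs) , x , tt)) (x ∷ xs) xs) [] vs

  select-feasible : Feasible Context (list nat) select
  select-feasible = ⟨ ⟨ basic Op.id , basic Op.nil ⟩ , basic Op.snd ▹ basic Op.snd ⟩ ▹
    fold {Context} {nat} {list nat}
         (choose (⟨ basic Op.fst , ⟨ basic Op.snd ▹ basic Op.fst , basic Op.unit ⟩ ⟩ ▹ run-feasible φ)
                 (basic Op.snd ▹ basic Op.cons) (basic Op.snd ▹ basic Op.snd))
         (con 1 ⊕ var)
         (λ γ x xs → cond-size (list nat) (run φ (γ , x , tt))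
           (≤-trans (s≤s (+-monoˡ-≤ (size {list nat} xs) (m≤n+m (size {nat} x) (size {Context} γ))))
                    (≤-reflexive (+-comm (suc (size {Context} γ + size {nat} x)) (size {list nat} xs))))
           (m≤m+n (size {list nat} xs) _))

  select≡filter : ∀ {n} (E : PairSet n) K → select (context E K) ≡ map toℕ (filter (λ x → Semantics.sat? E K φ (x ∷ [])) (allFin n))
  select≡filter {n} E K = trans (cong (foldl step []) (downFrom≡toℕ n)) (trans (reverse-foldl step [] (map toℕ (allFin n))) (go (allFin n)))
    where
    step : List ℕ → ℕ → List ℕ
    step xs x = cond (run φ (context E K , x , tt)) (x ∷ xs) xs
    go : ∀ xs → foldr (λ x xs → step xs x) [] (map toℕ xs) ≡ map toℕ (filter (λ x → Semantics.sat? E K φ (x ∷ [])) xs)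
    go [] = refl
    go (x ∷ xs) rewrite run-correct E K φ (x ∷ []) with does (Semantics.sat? E K φ (x ∷ []))
    ... | true  = cong (toℕ x ∷_) (go xs)
    ... | false = go xs

power : ℕ → ℕ → List ℕ → ℕ
power zero    q vs = 1
power (suc i) q vs = times q (power i q vs) vs

power-feasible : ∀ i → Feasible (nat `× list nat) nat (λ (q , vs) → power i q vs)
power-feasible zero    = constant nat 1
power-feasible (suc i) = ⟨ basic Op.fst , ⟨ power-feasible i , basic Op.snd ⟩ ⟩ ▹ times-feasible

power≡ : ∀ i q vs → power i q vs ≡ (q ⊓ length vs) ^ i
power≡ zero    q vs = refl
power≡ (suc i) q vs = trans (times≡ q (power i q vs) vs) (cong ((q ⊓ length vs) *_) (power≡ i q vs))

doubled : ∀ {a f} → Feasible a nat f → Feasible a nat (λ x → 2 * f x)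
doubled {f = f} F = transport (λ x → cong (f x +_) (sym (+-identityʳ (f x)))) (⟨ F , F ⟩ ▹ basic Op.add)

prepare : ⟦ list (list bool) `× nat ⟧ → ⟦ nat `× Context ⟧
prepare (M , k) = k , M , threshold k , positions {list bool} (count-up {list bool} M) M

prepare-feasible : Feasible (list (list bool) `× nat) (nat `× Context) prepare
prepare-feasible = ⟨ basic Op.snd , ⟨ basic Op.fst , ⟨ ⟨ basic Op.snd , basic Op.snd ⟩ ▹ basic Op.add ▹ basic Op.suc
  , ⟨ basic Op.fst ▹ count-up-feasible , basic Op.fst ⟩ ▹ positions-feasible ⟩ ⟩ ⟩

shrink : ⟦ nat `× Context ⟧ → ⟦ nat `× (Context `× list nat) ⟧
shrink (k , γ) = k , (iterate survives γ , proj₂ γ) , select (nonisolated 0F) (iterate survives γ , proj₂ γ)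

shrink-feasible : Feasible (nat `× Context) (nat `× (Context `× list nat)) shrink
shrink-feasible = ⟨ basic Op.fst , ⟨ core , core ▹ select-feasible (nonisolated 0F) ⟩ ⟩
  where
  core : Feasible (nat `× Context) Context (λ (k , γ) → iterate survives γ , proj₂ γ)
  core = basic Op.snd ▹ ⟨ iterate-feasible survives , basic Op.snd ⟩

no-instance : ⟦ list (list bool) `× nat ⟧
no-instance = encodeInstance ⟪ paw , 0 ⟫

answer : ⟦ nat `× (Context `× list nat) ⟧ → ⟦ list (list bool) `× nat ⟧
answer (k , (M , K , vs) , xs) = cond (leqᵇ (count-up {nat} xs) (power 6 (side k) vs))
  -- `collect` with the projection `proj₂` merely reverses the ascending list of survivors, to
  -- offset the reversal built into `interpret`.
  (interpret (0F ~ 1F) ((M , K , vs) , collect {Ty.unit} {nat} {nat} proj₂ tt xs) , k) no-instance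

answer-feasible : Feasible (nat `× (Context `× list nat)) (list (list bool) `× nat) answer
answer-feasible = choose
  (⟨ kept ▹ count-up-feasible , ⟨ bound′ , basic Op.snd ▹ basic Op.fst ▹ basic Op.snd ▹ basic Op.snd ⟩ ▹ power-feasible 6 ⟩ ▹ basic Op.leq)
  ⟨ ⟨ basic Op.snd ▹ basic Op.fst
    , ⟨ basic Op.unit , kept ⟩ ▹ collect-feasible {Ty.unit} {nat} {nat} proj₂ (basic Op.snd) ⟩ ▹ interpret-feasible (0F ~ 1F)
  , basic Op.fst ⟩
  (constant (list (list bool) `× nat) no-instance)
  where
  kept : Feasible (nat `× (Context `× list nat)) (list nat) _
  kept = basic Op.snd ▹ basic Op.snd
  bound′ : Feasible (nat `× (Context `× list nat)) nat (λ (k , _) → side k)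
  bound′ = doubled (doubled (doubled (doubled (basic Op.fst ▹ basic Op.suc))))

encodeGraph≡matrix : ∀ {n} (E : PairSet n) → encodeGraph (graph n E) ≡ matrix E
encodeGraph≡matrix E = trans (map-tabulate (λ i → i) _) (tabulate-cong λ i → map-tabulate (λ j → j) _)

prepare-correct : ∀ {n} (E : PairSet n) k → prepare (encodeInstance ⟪ graph n E , k ⟫) ≡ (k , context E (threshold k))
prepare-correct {n} E k rewrite encodeGraph≡matrix E =
  cong (λ vs → k , matrix E , threshold k , vs) (trans
    (cong (λ N → positions N (matrix E)) (count-up≡length (matrix E)))
    (trans (positions≡downFrom (matrix E)) (cong downFrom (length-tabulate _))))

shrink-correct : ∀ {n} (E : PairSet n) k → shrink (k , context E (threshold k)) ≡
                 (k , context (Kernel.core E k) (threshold k) , map toℕ (Kernel.survivors E k))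
shrink-correct {n} E k rewrite iterate≡reduces k E =
  cong (λ xs → k , context (Kernel.core E k) (threshold k) , xs) (select≡filter (nonisolated 0F) (Kernel.core E k) (threshold k))

verdict-correct : ∀ {P : Set} (p? : Dec P) I →
                  cond (encodeBool (does p?)) (encodeInstance I) no-instance ≡ encodeInstance (verdict p? I)
verdict-correct (yes _) I = refl
verdict-correct (no _)  I = refl

answer-correct : ∀ {n} (E : PairSet n) k →
                 answer (k , context (Kernel.core E k) (threshold k) , map toℕ (Kernel.survivors E k)) ≡
                 encodeInstance (kernel ⟪ graph n E , k ⟫)
answer-correct {n} E k = begin
  cond (leqᵇ (count-up {nat} (map toℕ xs)) (power 6 (side k) (downFrom n))) (result , k) no-instance
    ≡⟨ cong (λ l → cond (leqᵇ l (power 6 (side k) (downFrom n))) (result , k) no-instance) order≡ ⟩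
  cond (leqᵇ (length xs) (power 6 (side k) (downFrom n))) (result , k) no-instance
    ≡⟨ cong (λ p → cond (leqᵇ (length xs) p) (result , k) no-instance) cap≡ ⟩
  cond (leqᵇ (length xs) (cap k n)) (result , k) no-instance
    ≡⟨ cong (λ M → cond (leqᵇ (length xs) (cap k n)) (M , k) no-instance) result≡ ⟩
  cond (leqᵇ (length xs) (cap k n)) (encodeInstance ⟪ graph _ (restrict (Kernel.φ E k) F) , k ⟫) no-instance
    ≡⟨ verdict-correct (length xs ≤? cap k n) ⟪ graph _ (restrict (Kernel.φ E k) F) , k ⟫ ⟩
  encodeInstance (kernel ⟪ graph n E , k ⟫) ∎
  where
  open ≡-Reasoning
  xs = Kernel.survivors E k
  F  = Kernel.core E k
  result : List (List ⟦ bool ⟧)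
  result = interpret (0F ~ 1F) (context F (threshold k) , collect {Ty.unit} {nat} {nat} proj₂ tt (map toℕ xs))
  order≡ : count-up {nat} (map toℕ xs) ≡ length xs
  order≡ = trans (count-up≡length {nat} (map toℕ xs)) (length-map toℕ xs)
  cap≡ : power 6 (side k) (downFrom n) ≡ cap k n
  cap≡ = trans (power≡ 6 (side k) (downFrom n)) (cong (λ l → (side k ⊓ l) ^ 6) (length-downFrom n))
  result≡ : result ≡ encodeGraph (graph _ (restrict (Kernel.φ E k) F))
  result≡ = trans (interpret-reverse (0F ~ 1F) F (threshold k) xs)
    (trans (sym (matrix-restrict F xs)) (sym (encodeGraph≡matrix (restrict (Kernel.φ E k) F))))

polynomialTime : ∀ {X Y : Set} {a b : Ty} {encodeX : X → ⟦ a ⟧} {encodeY : Y → ⟦ b ⟧} {f : X → Y} {g} →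
                 Feasible a b g → (∀ x → g (encodeX x) ≡ encodeY (f x)) → PolynomialTime {a = a} {b} encodeX encodeY f
polynomialTime {a = a} {encodeX = encodeX} G correct = record
  { program  = program G
  ; time     = λ x → time G (encodeX x)
  ; computes = λ x → subst (λ y → program G ∣ encodeX x ⇓ y [ time G (encodeX x) ]) (correct x) (runs G (encodeX x))
  ; constant = coefficient (bound G)
  ; degree   = exponent (bound G)
  ; bounded  = λ x → ≤-trans (bounded G (encodeX x)) (monomial (size {a} (encodeX x)) (size≥1 a (encodeX x)))
  }
  where
  monomial : ∀ s → 1 ≤ s → eval (bound G) s ≤ coefficient (bound G) * s ^ exponent (bound G)
  monomial (suc s) _ = eval-monomial (bound G) s

kernel-feasible : Feasible (list (list bool) `× nat) (list (list bool) `× nat) (λ I → answer (shrink (prepare I)))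
kernel-feasible = prepare-feasible ▹ shrink-feasible ▹ answer-feasible

kernel-correct : ∀ I → answer (shrink (prepare (encodeInstance I))) ≡ encodeInstance (kernel I)
kernel-correct ⟪ graph n E , k ⟫ = trans (cong (λ s → answer (shrink s)) (prepare-correct E k))
  (trans (cong answer (shrink-correct E k)) (answer-correct E k))

kernel-polynomial : PolynomialTime encodeInstance encodeInstance kernel
kernel-polynomial = polynomialTime kernel-feasible kernel-correct

theorem2 : Σ (Instance → Instance) λ kernel →
    PolynomialTime encodeInstance encodeInstance kernel
    × (∀ I → budget (kernel I) ≤ budget I)
    × (∀ I → Editable (kernel I) ⇔ Editable I)
    × (Σ (ℕ → ℕ) λ f → (f ∈O (λ k → k ^ 6))
    × (∀ I → order (input (kernel I)) ≤ f (budget I)))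
theorem2 = kernel , kernel-polynomial , kernel-budget , kernel-equivalent , (λ k → side k ^ 6) , order-growth , kernel-order
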